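{- Let $G$ be a vertex-colored graph, with stable partition $\mathcal{P}_G$ and cell graph $C(G)$ as defined in the context. The following three conditions are equivalent: (i) $G$ is amenable. (ii) $G$ satisfies Conditions A, B, C, D, E and F. (iii) $G$ satisfies Conditions A, B, G and H. The conditions are: (A) For every cell $X\in\mathcal{P}_G$, the induced graph $G[X]$ is an empty graph, a complete graph, a matching graph $mK_2$, the complement of a matching graph, or the 5-cycle $C_5$. (B) For any two distinct cells $X,Y\in\mathcal{P}_G$, the bipartite graph $G[X,Y]$ is empty, complete bipartite, a disjoint union of stars $sK_{1,t}$ where one of $X,Y$ is the set of the $s$ centers and the other is the set of the $st$ leaves, or the bipartite complement of such a disjoint union of stars. (C) $C(G)$ contains no uniform anisotropic path connecting two heterogeneous cells. (D) $C(G)$ contains no uniform anisotropic cycle. (E) $C(G)$ contains neither an anisotropic path $XY_1\ldots Y_lZ$ with $|X|<|Y_1|=\dots=|Y_l|>|Z|$, nor an anisotropic cycle $XY_1\ldots Y_lX$ with $|X|<|Y_1|=\dots=|Y_l|$. (F) $C(G)$ contains no anisotropic path $XY_1\ldots Y_l$ with $|X|<|Y_1|=\dots=|Y_l|$ such that the cell $Y_l$ is heterogeneous. (G) Every anisotropic component $A$ of $C(G)$ is a tree with the following monotonicity property: if $R$ is a cell of $A$ of minimum cardinality and $A_R$ is the rooted directed tree obtained from $A$ by rooting it at $R$ (edges directed away from $R$), then $|X|\le|Y|$ for every directed edge $(X,Y)$ of $A_R$. (H) Every anisotropic component $A$ of $C(G)$ contains at most one heterogeneous vertex, and if $R$ is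 such a vertex then $R$ has minimum cardinality among the cells of $A$.
   Context: A vertex-colored graph is a finite simple undirected graph $G$ together with a coloring $c: V(G)\to\{1,\dots,k\}$; isomorphisms and automorphisms of vertex-colored graphs must preserve colors (uncolored graphs are those with constant coloring). $N(u)$ denotes the neighborhood of $u$, $G[X]$ the induced subgraph on $X$, and for disjoint $X,Y$, $G[X,Y]$ the bipartite graph with parts $X,Y$ formed by the edges of $G$ between $X$ and $Y$. The bipartite complement of a bipartite graph with parts $X,Y$ has the same parts and joins $x\in X$, $y\in Y$ iff they are not joined in the original. Color refinement (CR) computes colorings $C^i$ of $V(G)$: $C^0(u)=c(u)$ and $C^{i+1}(u)=(C^i(u),\{\!\{C^i(a): a\in N(u)\}\!\})$, where $\{\!\{\cdot\}\!\}$ denotes a multiset; colors are formal objects, so colors of vertices of different graphs can be compared. The partition $\mathcal{P}^{i}$ of $V(G)$ into color classes of $C^i$ is refined by $\mathcal{P}^{i+1}$, and eventually $\mathcal{P}^{s+1}=\mathcal{P}^s$; this $\mathcal{P}^s$ is the stable partition $\mathcal{P}_G$, whose elements are called cells. $G$ is amenable if for every vertex-colored graph $H$ such that $\{\!\{C^i(u):u\in V(G)\}\!\}=\{\!\{C^i(v):v\in V(H)\}\!\}$ for all $i\ge0$, the graphs $G$ and $H$ are isomorphic. The cell graph $C(G)$ is the complete graph on vertex set $\mathcal{P}_G$. A vertex $X$ of $C(G)$ is homogeneous if $G[X]$ is complete or empty, and heterogeneous otherwise. An edge $\{X,Y\}$ of $C(G)$ is isotropic if $G[X,Y]$ is complete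 bipartite or empty, and anisotropic otherwise. An anisotropic path (resp. cycle) is a path (resp. cycle) in $C(G)$ all of whose edges are anisotropic; it is uniform if all its cells have the same cardinality. An anisotropic component of $C(G)$ is a maximal connected subgraph of $C(G)$ all of whose edges are anisotropic (a vertex with no incident anisotropic edge forms a one-vertex anisotropic component). -}

module Defs where

open import Data.Nat using (ℕ; zero; suc; _≤_; _<_)
open import Data.Fin using (Fin)
open import Data.Bool using (Bool; T)
open import Data.List using (List; []; _∷_; _∷ʳ_; length; map; lookup; allFin; filterᵇ)
open import Data.List.Relation.Unary.All using (All)
open import Data.List.Relation.Unary.AllPairs using (AllPairs)
open import Data.List.Relation.Unary.Linked using (Linked)
open import Data.Product using (Σ; ∃; _×_; _,_)
open import Data.Sum using (_⊎_)
open import Relation.Nullary using (¬_)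
open import Relation.Binary.PropositionalEquality using (_≡_; _≢_)
open import Function.Bundles using (_↔_; _⇔_; Inverse)
open import Function.Definitions using (Injective)

-- Vertex-colored finite simple graphs on vertex set Fin n.
-- Colors are natural numbers (any coloring into {1..k} is one of these).

record Graph : Set where
  field
    n      : ℕ
    adj    : Fin n → Fin n → Bool
    sym    : ∀ u v → adj u v ≡ adj v u
    irrefl : ∀ u → adj u u ≡ Bool.false
    col    : Fin n → ℕ
open Graph public

E : (G : Graph) → Fin (n G) → Fin (n G) → Set
E G u v = T (adj G u v)

Iso : Graph → Graph → Set
Iso G H = Σ (Fin (n G) ↔ Fin (n H)) λ f →
  (∀ u v → adj G u v ≡ adj H (Inverse.to f u) (Inverse.to f v)) ×
  (∀ u → col G u ≡ col H (Inverse.to f u))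

-- Formal colors of color refinement and their equality.
-- C^{i+1}(u) = (C^i(u), multiset of neighbour colours); a multiset is
-- represented by a list, and two lists denote the same multiset iff
-- they agree up to a permutation (BagEqBy).

data Col : Set where
  base : ℕ → Col
  ref  : Col → List Col → Col

BagEqBy : {A B : Set} → (A → B → Set) → List A → List B → Set
BagEqBy R l m = Σ (Fin (length l) ↔ Fin (length m)) λ σ →
  ∀ k → R (lookup l k) (lookup m (Inverse.to σ k))

data _≈_ : Col → Col → Set where
  base≈ : ∀ {a b} → a ≡ b → base a ≈ base b
  ref≈  : ∀ {c d l m} → c ≈ d →
          (σ : Fin (length l) ↔ Fin (length m)) →
          (∀ k → lookup l k ≈ lookup m (Inverse.to σ k)) →
          ref c l ≈ ref d m

nbrs : (G : Graph) → Fin (n G) → List (Fin (n G))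
nbrs G u = filterᵇ (adj G u) (allFin (n G))

CR : (G : Graph) → ℕ → Fin (n G) → Col
CR G zero    u = base (col G u)
CR G (suc i) u = ref (CR G i u) (map (CR G i) (nbrs G u))

SameColorMultiset : ℕ → Graph → Graph → Set
SameColorMultiset i G H =
  BagEqBy _≈_ (map (CR G i) (allFin (n G))) (map (CR H i) (allFin (n H)))

Amenable : Graph → Set
Amenable G = ∀ (H : Graph) → (∀ i → SameColorMultiset i G H) → Iso G H

-- P^{s+1} = P^s : then P^s is the stable partition P_G
IsStable : Graph → ℕ → Set
IsStable G s = ∀ u v →
  (CR G s u ≈ CR G s v → CR G (suc s) u ≈ CR G (suc s) v) ×
  (CR G (suc s) u ≈ CR G (suc s) v → CR G s u ≈ CR G s v)

-- Cells of P^s, the cell graph and the conditions A–H.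
-- A cell is represented by any of its vertices: the cell of u is
-- { v | u ∼ v }.

lastOf : {A : Set} → A → List A → A
lastOf a []      = a
lastOf a (b ∷ l) = lastOf b l

module Cells (G : Graph) (s : ℕ) where

  V : Set
  V = Fin (n G)

  _∼_ : V → V → Set
  u ∼ v = CR G s u ≈ CR G s v

  Enumerates : {T : Set} → V → (T → V) → Set
  Enumerates u f = Injective _≡_ _≡_ f × (∀ v → u ∼ v ⇔ ∃ λ t → f t ≡ v)

  Card : V → ℕ → Set
  Card u k = Σ (Fin k → V) λ f → Enumerates u f

  CardLe CardLt CardEq : V → V → Set
  CardLe u v = ∃ λ a → ∃ λ b → Card u a × Card v b × a ≤ b
  CardLt u v = ∃ λ a → ∃ λ b → Card u a × Card v b × a < b
  CardEq u v = ∃ λ a → Card u a × Card v a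

  InducedIso : V → (T : Set) → (T → T → Set) → Set
  InducedIso x T M = Σ (T → V) λ f → Enumerates x f × (∀ a b → E G (f a) (f b) ⇔ M a b)

  BipIso : V → V → (S T : Set) → (S → T → Set) → Set
  BipIso x y S T M = Σ (S → V) λ f → Σ (T → V) λ g →
    Enumerates x f × Enumerates y g × (∀ a b → E G (f a) (g b) ⇔ M a b)

  EmptyCell CompleteCell : V → Set
  EmptyCell x    = ∀ a b → x ∼ a → x ∼ b → ¬ E G a b
  CompleteCell x = ∀ a b → x ∼ a → x ∼ b → a ≢ b → E G a b

  Homogeneous Heterogeneous : V → Set
  Homogeneous x   = CompleteCell x ⊎ EmptyCell x
  Heterogeneous x = ¬ Homogeneous x

  EmptyBip CompleteBip : V → V → Set
  EmptyBip x y    = ∀ a b → x ∼ a → y ∼ b → ¬ E G a b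
  CompleteBip x y = ∀ a b → x ∼ a → y ∼ b → E G a b

  Isotropic Anisotropic : V → V → Set
  Isotropic x y   = CompleteBip x y ⊎ EmptyBip x y
  Anisotropic x y = ¬ Isotropic x y

  matching : (m : ℕ) → Fin m × Fin 2 → Fin m × Fin 2 → Set
  matching m (a , i) (b , j) = a ≡ b × i ≢ j
  comatching : (m : ℕ) → Fin m × Fin 2 → Fin m × Fin 2 → Set
  comatching m (a , i) (b , j) = a ≢ b
  suc5 : Fin 5 → Fin 5
  suc5 Fin.zero = Fin.suc Fin.zero
  suc5 (Fin.suc Fin.zero) = Fin.suc (Fin.suc Fin.zero)
  suc5 (Fin.suc (Fin.suc Fin.zero)) = Fin.suc (Fin.suc (Fin.suc Fin.zero))
  suc5 (Fin.suc (Fin.suc (Fin.suc Fin.zero))) = Fin.suc (Fin.suc (Fin.suc (Fin.suc Fin.zero)))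
  suc5 (Fin.suc (Fin.suc (Fin.suc (Fin.suc Fin.zero)))) = Fin.zero
  cycle5 : Fin 5 → Fin 5 → Set
  cycle5 a b = (b ≡ suc5 a) ⊎ (a ≡ suc5 b)
  stars : (s t : ℕ) → Fin s → Fin s × Fin t → Set
  stars s t a (b , _) = a ≡ b
  costars : (s t : ℕ) → Fin s → Fin s × Fin t → Set
  costars s t a (b , _) = a ≢ b

  CondA : Set
  CondA = ∀ x → EmptyCell x ⊎ CompleteCell x
    ⊎ (∃ λ m → InducedIso x (Fin m × Fin 2) (matching m))
    ⊎ (∃ λ m → InducedIso x (Fin m × Fin 2) (comatching m))
    ⊎ InducedIso x (Fin 5) cycle5

  StarsBetween CoStarsBetween : V → V → Set
  StarsBetween x y   = ∃ λ s → ∃ λ t → BipIso x y (Fin s) (Fin s × Fin t) (stars s t)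
  CoStarsBetween x y = ∃ λ s → ∃ λ t → BipIso x y (Fin s) (Fin s × Fin t) (costars s t)

  CondB : Set
  CondB = ∀ x y → ¬ x ∼ y → EmptyBip x y ⊎ CompleteBip x y
    ⊎ StarsBetween x y ⊎ StarsBetween y x
    ⊎ CoStarsBetween x y ⊎ CoStarsBetween y x

  AnisoPath : List V → Set
  AnisoPath xs = AllPairs (λ a b → ¬ a ∼ b) xs × Linked Anisotropic xs

  -- cycle X₀ X₁ … X_k X₀ with k ≥ 2 (at least three distinct cells)
  AnisoCycle : List V → Set
  AnisoCycle [] = Data.Empty.⊥ where import Data.Empty
  AnisoCycle (x ∷ xs) = 2 ≤ length xs × AnisoPath (x ∷ xs) × Anisotropic (lastOf x xs) x

  Uniform : List V → Set
  Uniform xs = ∃ λ k → All (λ x → Card x k) xs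

  CondC : Set
  CondC = ¬ (∃ λ x → ∃ λ ys → ∃ λ z →
    AnisoPath (x ∷ ys ∷ʳ z) × Uniform (x ∷ ys ∷ʳ z) × Heterogeneous x × Heterogeneous z)

  CondD : Set
  CondD = ¬ (∃ λ xs → AnisoCycle xs × Uniform xs)

  CondE : Set
  CondE =
    ¬ (∃ λ x → ∃ λ y → ∃ λ ys → ∃ λ z → ∃ λ k → ∃ λ kx → ∃ λ kz →
        AnisoPath (x ∷ (y ∷ ys) ∷ʳ z) × Card x kx × All (λ w → Card w k) (y ∷ ys) ×
        Card z kz × kx < k × kz < k)
    × ¬ (∃ λ x → ∃ λ ys → ∃ λ k → ∃ λ kx →
        AnisoCycle (x ∷ ys) × Card x kx × All (λ w → Card w k) ys × kx < k)

  CondF : Set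
  CondF = ¬ (∃ λ x → ∃ λ ys → ∃ λ y → ∃ λ k → ∃ λ kx →
    AnisoPath (x ∷ ys ∷ʳ y) × Card x kx × All (λ w → Card w k) (ys ∷ʳ y) × kx < k ×
    Heterogeneous y)

  Conn : V → V → Set
  Conn u v = u ∼ v ⊎ (∃ λ ys → AnisoPath (u ∷ ys ∷ʳ v))

  MinInComp : V → V → Set
  MinInComp u r = Conn u r × (∀ z → Conn u z → CardLe r z)

  -- the component of u is a tree (it is connected by definition)
  CompIsTree : V → Set
  CompIsTree u = ¬ (∃ λ xs → AnisoCycle xs × All (Conn u) xs)

  -- directed edges (X,Y) of the tree rooted at r are exactly the last
  -- edges of anisotropic paths starting at r
  CondG : Set
  CondG = ∀ u → CompIsTree u ×
    (∀ r → MinInComp u r → ∀ ys y → AnisoPath (r ∷ ys ∷ʳ y) → CardLe (lastOf r ys) y)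

  CondH : Set
  CondH = ∀ u →
    (∀ v w → Conn u v → Conn u w → Heterogeneous v → Heterogeneous w → v ∼ w) ×
    (∀ r → Conn u r → Heterogeneous r → MinInComp u r)

{-# OPTIONS --safe #-}
module Submission where

-- Since the stable partition is equitable, the graphs which color refinement cannot tell from G are, up to isomorphism,
-- the rewirings of G: the graphs on the same vertices in which every vertex has as many neighbours in every cell as
-- it has in G. So G is amenable iff every rewiring is isomorphic to G by a bijection respecting the cells.
--
-- (i) ⇒ (ii). Any regular graph of the right degree may be put in place of G[X], and any biregular one in place of
-- G[X, Y]. Apart from the cases listed in A and B there is a choice that is regular and rotation invariant, hence has
-- all its vertices alike, and a switch of two edges that changes an isomorphism invariant of a single vertex.
-- For C to F, a path of equally large cells transports the structure that its first cell receives from G to its last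
-- cell Y. Twisting the edges which define a second structure on Y by a permutation of Y gives a rewiring, but the
-- relative position of the two structures depends on the permutation. Cycles are treated alike.
--
-- (ii) ⇒ (iii). By E, the cell sizes along an anisotropic path never fall after having risen.
--
-- (iii) ⇒ (i). The isomorphism onto a rewiring is built cell by cell along the trees.

open import Defs
open import Data.Bool using (Bool; true; false; T; _∧_; _∨_; not; _xor_)
import Data.Bool.Properties as Boolₚ
open import Data.Empty using (⊥; ⊥-elim)
open import Data.Fin using (Fin; zero; suc; toℕ; fromℕ; fromℕ<; punchIn; combine; remQuot; cast)
import Data.Fin.Induction
open import Data.Fin.Patterns using (0F; 1F; 2F; 3F; 4F)
open import Data.Fin.Permutation using (Permutation; permutation; _⟨$⟩ʳ_; _⟨$⟩ˡ_; _∘ₚ_)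
import Data.Fin.Permutation as Perm
import Data.Fin.Properties as Finₚ
open import Data.List
  using (List; []; _∷_; _∷ʳ_; _++_; initLast; _∷ʳ′_; reverse; length; map; lookup; allFin; filterᵇ; tabulate)
import Data.List.Properties as Listₚ
open import Data.List.Relation.Unary.All using (All; []; _∷_)
import Data.List.Relation.Unary.All as All
import Data.List.Relation.Unary.All.Properties as Allₚ
open import Data.List.Relation.Unary.AllPairs using (AllPairs; []; _∷_)
open import Data.List.Relation.Unary.Linked using (Linked; []; [-]; _∷_)
open import Data.Nat
  using (ℕ; zero; suc; _+_; _*_; _∸_; _≤_; _<_; z≤n; s≤s; _≤?_; _<?_; ∣_-_∣; parity; NonZero; >-nonZero)
open import Data.Nat.Coprimality using (Coprime; Bézout-coprime; coprime-divisor)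
open import Data.Nat.Divisibility using (_∣_; divides)
open import Data.Nat.GCD using (GCD; mkGCD; module GCD; module Bézout)
import Data.Nat.Properties as ℕₚ
open import Data.Parity.Base as Parity using (Parity; 0ℙ; 1ℙ)
import Data.Parity.Properties as Parityₚ
open import Data.Product using (Σ; ∃; ∃₂; _×_; _,_; proj₁; proj₂)
open import Data.Sum using (_⊎_; inj₁; inj₂; [_,_]; [_,_]′)
open import Data.Unit using (⊤; tt)
open import Function using (_∘_; id)
open import Function.Bundles using (_↔_; _⇔_; mk⇔; mk↔ₛ′; Inverse; Equivalence)
open import Function.Definitions using (Injective)
open import Relation.Binary.Definitions using (tri<; tri≈; tri>)
open import Relation.Binary.PropositionalEquality using (_≡_; _≢_; refl; trans; cong; cong₂; subst; subst₂; module ≡-Reasoning)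
  renaming (sym to ≡sym)
open import Relation.Nullary using (¬_; Dec; yes; no; contradiction; does; _×-dec_; _⊎-dec_; _→-dec_; ¬?)
open import Relation.Nullary.Decidable using (dec-true; dec-false; map′; decidable-stable)
open import Algebra.Properties.CommutativeMonoid.Sum ℕₚ.+-0-commutativeMonoid
  using (sum; sum-cong-≗; sum-permute; sum-remove; ∑-distrib-+; ∑-comm)

-- Counting in finite sets

-- Conditions C to F are negations, whereas amenability asks for an actual permutation. Decidability
-- bridges the gap: equality of colours reduces to finitely many equations between neighbour counts,
-- so cells become Boolean predicates and everything about them can be decided or found by search. A
-- colour `c` treats a graph and its complement at once: `c xor A u v` reads A or its complement, so
-- stars and their bipartite complements, or matchings and their complements, share one argument.
-- The path conditions C, E and F have a common source. A heterogeneous cell imposes on itself, and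
-- a smaller anisotropic neighbour imposes on a cell, either a partition into at least two blocks of
-- at least two points or a five-cycle. Two such structures on one set always admit more than one
-- relative position, and degrees cannot see the position. Around a cycle the blocks may be single
-- points, so there the monodromy on the first cell is varied instead. In the converse direction a
-- permutation of the centres of stars always extends to the leaves, but one of the leaves extends
-- to the centres only if it respects the blocks. Hence isomorphisms grow from small cells to large
-- ones.

bit : Bool → ℕ
bit true  = 1
bit false = 0

# : ∀ {m} → (Fin m → Bool) → ℕ
# p = sum (λ i → bit (p i))

-- The index set is arbitrary, so that a cell can be indexed directly by pairs: (centre, leaf) for
-- stars, (edge, end) for matchings.
Enum : ∀ {m} {A : Set} → (Fin m → Bool) → (A → Fin m) → Set
Enum p f = Injective _≡_ _≡_ f × (∀ v → p v ≡ true ⇔ ∃ λ t → f t ≡ v)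

↔-injective : ∀ {A B : Set} (φ : A ↔ B) → Injective _≡_ _≡_ (Inverse.to φ)
↔-injective φ {x} {y} e = trans (≡sym (Inverse.strictlyInverseʳ φ x)) (trans (cong (Inverse.from φ) e) (Inverse.strictlyInverseʳ φ y))

∧-true : ∀ {a b} → a ≡ true → b ≡ true → a ∧ b ≡ true
∧-true refl refl = refl

∧-left : ∀ {a b} → a ∧ b ≡ true → a ≡ true
∧-left {true} _ = refl

∧-right : ∀ {a b} → a ∧ b ≡ true → b ≡ true
∧-right {true} h = h

not-true : ∀ {a} → a ≡ false → not a ≡ true
not-true refl = refl

not-true⁻ : ∀ {a} → not a ≡ true → a ≡ false
not-true⁻ {false} _ = refl

true≢false : ∀ {a} {A : Set} → a ≡ true → a ≡ false → A
true≢false refl ()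

bool-iff : ∀ {a b} → (a ≡ true → b ≡ true) → (b ≡ true → a ≡ true) → a ≡ b
bool-iff {true}          f g = ≡sym (f refl)
bool-iff {false} {true}  f g = g refl
bool-iff {false} {false} f g = refl

T⇒≡ : ∀ {b} → T b → b ≡ true
T⇒≡ {true} _ = refl

≡⇒T : ∀ {b} → b ≡ true → T b
≡⇒T refl = tt

dec-true⁻ : ∀ {A : Set} (d : Dec A) → does d ≡ true → A
dec-true⁻ (yes a) _ = a

dec-false⁻ : ∀ {A : Set} (d : Dec A) → does d ≡ false → ¬ A
dec-false⁻ (no ¬a) _ = ¬a

private
  enumerate-cons : ∀ {m} (p : Fin (suc m) → Bool) b → p zero ≡ b →
    Σ (Fin (# (p ∘ suc)) → Fin m) (Enum (p ∘ suc)) →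
    Σ (Fin (bit b + # (p ∘ suc)) → Fin (suc m)) (Enum p)
  enumerate-cons p true e (f , inj , on) = g , inj′ , on′
    where
    g : Fin (suc (# (p ∘ suc))) → Fin _
    g zero    = zero
    g (suc i) = suc (f i)
    inj′ : Injective _≡_ _≡_ g
    inj′ {zero}  {zero}  _  = refl
    inj′ {suc i} {suc j} eq = cong suc (inj (Finₚ.suc-injective eq))
    fwd : ∀ v → p v ≡ true → ∃ λ t → g t ≡ v
    fwd zero    h = zero , refl
    fwd (suc v) h = let t , q = Equivalence.to (on v) h in suc t , cong suc q
    bwd : ∀ v → (∃ λ t → g t ≡ v) → p v ≡ true
    bwd _ (zero  , refl) = e
    bwd _ (suc t , refl) = Equivalence.from (on (f t)) (t , refl)
    on′ : ∀ v → p v ≡ true ⇔ ∃ λ t → g t ≡ v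
    on′ v = mk⇔ (fwd v) (bwd v)
  enumerate-cons p false e (f , inj , on) = suc ∘ f , (λ eq → inj (Finₚ.suc-injective eq)) , λ v → mk⇔ (fwd v) (bwd v)
    where
    fwd : ∀ v → p v ≡ true → ∃ λ t → suc (f t) ≡ v
    fwd zero    h = true≢false h e
    fwd (suc v) h = let t , q = Equivalence.to (on v) h in t , cong suc q
    bwd : ∀ v → (∃ λ t → suc (f t) ≡ v) → p v ≡ true
    bwd _ (t , refl) = Equivalence.from (on (f t)) (t , refl)

enumerate : ∀ {m} (p : Fin m → Bool) → Σ (Fin (# p) → Fin m) (Enum p)
enumerate {zero}  p = (λ ()) , (λ { {()} }) , λ ()
enumerate {suc m} p = enumerate-cons p (p zero) refl (enumerate (p ∘ suc))

Enum-∈ : ∀ {m} {A : Set} {p : Fin m → Bool} {f : A → Fin m} → Enum p f → ∀ t → p (f t) ≡ true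
Enum-∈ {f = f} (_ , on) t = Equivalence.from (on (f t)) (t , refl)

Enum-index : ∀ {m} {A : Set} {p : Fin m → Bool} {f : A → Fin m} → Enum p f →
  ∀ v → p v ≡ true → ∃ λ t → f t ≡ v
Enum-index (_ , on) v = Equivalence.to (on v)

Enum-≤ : ∀ {m a b} {p q : Fin m → Bool} {f : Fin a → Fin m} {g : Fin b → Fin m} →
  Enum p f → Enum q g → (∀ v → p v ≡ true → q v ≡ true) → a ≤ b
Enum-≤ {f = f} {g} P Q p⊆q = Finₚ.injective⇒≤ {f = h} h-inj
  where
  h : Fin _ → Fin _
  h t = proj₁ (Enum-index Q (f t) (p⊆q (f t) (Enum-∈ P t)))
  gh : ∀ t → g (h t) ≡ f t
  gh t = proj₂ (Enum-index Q (f t) (p⊆q (f t) (Enum-∈ P t)))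
  h-inj : Injective _≡_ _≡_ h
  h-inj {s} {t} e = proj₁ P (trans (≡sym (gh s)) (trans (cong g e) (gh t)))

Enum-≡ : ∀ {m a b} {p q : Fin m → Bool} {f : Fin a → Fin m} {g : Fin b → Fin m} →
  Enum p f → Enum q g → (∀ v → p v ≡ q v) → a ≡ b
Enum-≡ P Q e = ℕₚ.≤-antisym (Enum-≤ P Q (λ v h → trans (≡sym (e v)) h)) (Enum-≤ Q P (λ v h → trans (e v) h))

Enum-# : ∀ {m a} {p : Fin m → Bool} {f : Fin a → Fin m} → Enum p f → a ≡ # p
Enum-# {p = p} P = Enum-≡ P (proj₂ (enumerate p)) (λ _ → refl)

Enum-subst : ∀ {m a b} {p : Fin m → Bool} (e : a ≡ b) → Σ (Fin a → Fin m) (Enum p) → Σ (Fin b → Fin m) (Enum p)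
Enum-subst refl P = P

#-mono : ∀ {m} {p q : Fin m → Bool} → (∀ v → p v ≡ true → q v ≡ true) → # p ≤ # q
#-mono {p = p} {q} = Enum-≤ (proj₂ (enumerate p)) (proj₂ (enumerate q))

#-cong : ∀ {m} {p q : Fin m → Bool} → (∀ v → p v ≡ q v) → # p ≡ # q
#-cong e = sum-cong-≗ (λ v → cong bit (e v))

#-iff : ∀ {m} {p q : Fin m → Bool} → (∀ v → p v ≡ true → q v ≡ true) → (∀ v → q v ≡ true → p v ≡ true) → # p ≡ # q
#-iff f g = #-cong (λ v → bool-iff (f v) (g v))

#-witness : ∀ {m} (p : Fin m → Bool) → 0 < # p → ∃ λ v → p v ≡ true
#-witness p h with # p | enumerate p
... | suc _ | f , P = f zero , Enum-∈ P zero

#-positive : ∀ {m} (p : Fin m → Bool) v → p v ≡ true → 0 < # p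
#-positive p v h with # p | enumerate p
... | zero  | f , P with () ← proj₁ (Enum-index P v h)
... | suc _ | _     = s≤s z≤n

#-zero : ∀ {m} (p : Fin m → Bool) → # p ≡ 0 → ∀ v → p v ≡ false
#-zero p e v with p v in eq
... | false = refl
... | true  = contradiction e (ℕₚ.>⇒≢ (#-positive p v eq))

#-none : ∀ {m} (p : Fin m → Bool) → (∀ v → p v ≡ false) → # p ≡ 0
#-none p h with # p in eq
... | zero  = refl
... | suc k with v , e ← #-witness p (subst (0 <_) (≡sym eq) (s≤s z≤n)) = true≢false e (h v)

#-all : ∀ {m} (p : Fin m → Bool) → (∀ v → p v ≡ true) → # p ≡ m
#-all p h = ≡sym (Enum-# {f = id} (id , λ v → mk⇔ (λ _ → v , refl) (λ _ → h v)))

#-single : ∀ {m} (p : Fin m → Bool) v → p v ≡ true → (∀ w → p w ≡ true → v ≡ w) → # p ≡ 1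
#-single p v h u = ≡sym (Enum-# {f = λ (_ : Fin 1) → v} ((λ { {zero} {zero} _ → refl }) ,
  λ w → mk⇔ (λ e → zero , u w e) (λ { (_ , refl) → h })))

#-unique : ∀ {m} (p : Fin m → Bool) → # p ≡ 1 → ∃ λ v → p v ≡ true × (∀ w → p w ≡ true → v ≡ w)
#-unique p e with # p | enumerate p
#-unique p refl | _ | f , P = f zero , Enum-∈ P zero , only
  where
  only : ∀ w → p w ≡ true → f zero ≡ w
  only w h with Enum-index P w h
  ... | zero , q = q

#-split : ∀ {m} (p q : Fin m → Bool) → # (λ v → p v ∧ q v) + # (λ v → p v ∧ not (q v)) ≡ # p
#-split p q = trans (≡sym (∑-distrib-+ (λ v → bit (p v ∧ q v)) (λ v → bit (p v ∧ not (q v)))))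
  (sum-cong-≗ (λ v → pt (p v) (q v)))
  where
  pt : ∀ a b → bit (a ∧ b) + bit (a ∧ not b) ≡ bit a
  pt true  true  = refl
  pt true  false = refl
  pt false b     = refl

#-strict : ∀ {m} {p q : Fin m → Bool} → (∀ v → p v ≡ true → q v ≡ true) → ∀ v → p v ≡ false → q v ≡ true → # p < # q
#-strict {p = p} {q} p⊆q v pv qv = begin-strict
  # p                                                     ≡⟨ #-iff (λ w h → ∧-true (p⊆q w h) h) (λ w h → ∧-right {q w} h) ⟩
  # (λ w → q w ∧ p w)                                     <⟨ ℕₚ.m<m+n _ (#-positive _ v (∧-true qv (not-true pv))) ⟩
  # (λ w → q w ∧ p w) + # (λ w → q w ∧ not (p w))         ≡⟨ #-split q p ⟩
  # q                                                     ∎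
  where open ℕₚ.≤-Reasoning

#-full : ∀ {m} {p q : Fin m → Bool} → (∀ v → p v ≡ true → q v ≡ true) → # q ≤ # p → ∀ v → q v ≡ true → p v ≡ true
#-full {p = p} p⊆q le v qv with p v in eq
... | true  = refl
... | false = contradiction (#-strict p⊆q v eq qv) (ℕₚ.≤⇒≯ le)

#-reindex : ∀ {m a} {p : Fin m → Bool} {f : Fin a → Fin m} → Enum p f → (q : Fin m → Bool) →
  # (λ v → p v ∧ q v) ≡ # (q ∘ f)
#-reindex {p = p} {f} P q with e , Q ← enumerate (q ∘ f) = ≡sym (Enum-# {f = f ∘ e}
  ((λ eq → proj₁ Q (proj₁ P eq)) , λ v → mk⇔ (fwd v) (bwd v)))
  where
  fwd : ∀ v → p v ∧ q v ≡ true → ∃ λ t → f (e t) ≡ v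
  fwd v h with t , refl ← Enum-index P v (∧-left h) with s , refl ← Enum-index Q t (∧-right {p (f t)} h) = s , refl
  bwd : ∀ v → (∃ λ t → f (e t) ≡ v) → p v ∧ q v ≡ true
  bwd _ (t , refl) = ∧-true (Enum-∈ P (e t)) (Enum-∈ Q t)

#-bijection : ∀ {m k} (φ : Fin m ↔ Fin k) (p : Fin k → Bool) → # p ≡ # (p ∘ Inverse.to φ)
#-bijection φ p = #-reindex {p = λ _ → true} {f = Inverse.to φ}
  (↔-injective φ , λ v → mk⇔ (λ _ → Inverse.from φ v , Perm.inverseʳ φ) (λ _ → refl)) p

sum-const-on : ∀ {m} (p : Fin m → Bool) (F : Fin m → ℕ) c → (∀ v → p v ≡ true → F v ≡ c) → (∀ v → p v ≡ false → F v ≡ 0) →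
  sum F ≡ # p * c
sum-const-on {zero}  p F c on off = refl
sum-const-on {suc m} p F c on off with p zero in eq
... | true  = cong₂ _+_ (on zero eq) (sum-const-on (p ∘ suc) (F ∘ suc) c (on ∘ suc) (off ∘ suc))
... | false = cong₂ _+_ (off zero eq) (sum-const-on (p ∘ suc) (F ∘ suc) c (on ∘ suc) (off ∘ suc))

-- Both sides count the pairs of `r` between `p` and `q`, once by rows and once by columns.
double-count : ∀ {m k} (p : Fin m → Bool) (q : Fin k → Bool) (r : Fin m → Fin k → Bool) a b →
  (∀ u → p u ≡ true → # (λ v → q v ∧ r u v) ≡ a) → (∀ v → q v ≡ true → # (λ u → p u ∧ r u v) ≡ b) →
  # p * a ≡ # q * b
double-count p q r a b ha hb = begin
  # p * a                                              ≡⟨ ≡sym (sum-const-on p _ a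
                                                            (λ u e → trans (#-cong (λ v → cong (_∧ (q v ∧ r u v)) e)) (ha u e))
                                                            (λ u e → #-none _ (λ v → cong (_∧ (q v ∧ r u v)) e))) ⟩
  sum (λ u → # (λ v → p u ∧ (q v ∧ r u v)))            ≡⟨ ∑-comm (λ u v → bit (p u ∧ (q v ∧ r u v))) ⟩
  sum (λ v → # (λ u → p u ∧ (q v ∧ r u v)))            ≡⟨ sum-const-on q _ b
                                                            (λ v e → trans (#-cong (λ u → cong (λ z → p u ∧ (z ∧ r u v)) e)) (hb v e))
                                                            (λ v e → #-none _ (λ u → trans (cong (λ z → p u ∧ (z ∧ r u v)) e)
                                                                (Boolₚ.∧-zeroʳ (p u)))) ⟩
  # q * b                                              ∎
  where open ≡-Reasoning

sum-mono : ∀ {m} {F G : Fin m → ℕ} → (∀ v → F v ≤ G v) → sum F ≤ sum G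
sum-mono {zero}  le = z≤n
sum-mono {suc m} le = ℕₚ.+-mono-≤ (le zero) (sum-mono (le ∘ suc))

sum-strict : ∀ {m} {F G : Fin m → ℕ} → (∀ v → F v ≤ G v) → ∀ v → F v < G v → sum F < sum G
sum-strict le zero    lt = ℕₚ.+-mono-<-≤ lt (sum-mono (le ∘ suc))
sum-strict le (suc v) lt = ℕₚ.+-mono-≤-< (le zero) (sum-strict (le ∘ suc) v lt)

-- Induction: the first member of `f` is paired with any equivalent member of `g`, and deleting both
-- lowers the same multiplicities. This turns equalities of counts into the permutations that
-- `BagEqBy` asks for.
match-families : ∀ {A : Set} (eq : A → A → Bool) → (∀ a → eq a a ≡ true) →
  (∀ a b → eq a b ≡ true → ∀ c → eq c a ≡ eq c b) →
  ∀ {m k} (f : Fin m → A) (g : Fin k → A) → (∀ a → # (λ i → eq a (f i)) ≡ # (λ j → eq a (g j))) →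
  Σ (Fin m ↔ Fin k) λ σ → ∀ i → eq (f i) (g (Inverse.to σ i)) ≡ true
match-families eq rfl rsp {zero} {zero} f g h = Perm.id , λ ()
match-families eq rfl rsp {zero} {suc k} f g h =
  contradiction (≡sym (h (g zero))) (ℕₚ.>⇒≢ (#-positive (λ j → eq (g zero) (g j)) zero (rfl (g zero))))
match-families {A} eq rfl rsp {suc m} {k} f g h
  with j , ej ← #-witness _ (subst (0 <_) (h (f zero)) (#-positive (λ i → eq (f zero) (f i)) zero (rfl (f zero)))) = go k g h j ej
  where
  go : ∀ k (g : Fin k → A) → (∀ a → # (λ i → eq a (f i)) ≡ # (λ j → eq a (g j))) → ∀ j → eq (f zero) (g j) ≡ true →
    Σ (Fin (suc m) ↔ Fin k) λ σ → ∀ i → eq (f i) (g (Inverse.to σ i)) ≡ true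
  go (suc k) g h j ej = Perm.insert zero j (proj₁ rec) , good
    where
    h′ : ∀ a → # (λ i → eq a (f (suc i))) ≡ # (λ i → eq a (g (punchIn j i)))
    h′ a = ℕₚ.+-cancelˡ-≡ (bit (eq a (f zero))) _ _ (trans (h a) (trans (sum-remove {i = j} (λ i → bit (eq a (g i))))
      (cong (λ z → bit z + # (λ i → eq a (g (punchIn j i)))) (≡sym (rsp (f zero) (g j) ej a)))))
    rec : Σ (Fin m ↔ Fin k) λ σ → ∀ i → eq (f (suc i)) (g (punchIn j (Inverse.to σ i))) ≡ true
    rec = match-families eq rfl rsp (f ∘ suc) (g ∘ punchIn j) h′
    good : ∀ i → eq (f i) (g (Perm.insert zero j (proj₁ rec) ⟨$⟩ʳ i)) ≡ true
    good zero    = ej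
    good (suc i) = trans (cong (λ z → eq (f (suc i)) (g z)) (Perm.insert-punchIn zero j (proj₁ rec) i)) (proj₂ rec i)

-- Color refinement and rewirings

mutual
  ≈-refl : ∀ {c} → c ≈ c
  ≈-refl {base a}  = base≈ refl
  ≈-refl {ref c l} = ref≈ (≈-refl {c}) Perm.id (≈-refl-lookup l)

  -- Recursion along the list keeps every colour met a visible subterm, which `lookup l k` is not.
  ≈-refl-lookup : ∀ l k → lookup l k ≈ lookup l k
  ≈-refl-lookup (c ∷ l) zero    = ≈-refl {c}
  ≈-refl-lookup (c ∷ l) (suc k) = ≈-refl-lookup l k

≈-sym : ∀ {c d} → c ≈ d → d ≈ c
≈-sym (base≈ e) = base≈ (≡sym e)
≈-sym (ref≈ {l = l} {m = m} p σ q) = ref≈ (≈-sym p) (Perm.flip σ) λ k →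
  subst (λ j → lookup m j ≈ lookup l (σ ⟨$⟩ˡ k)) (Perm.inverseʳ σ) (≈-sym (q (σ ⟨$⟩ˡ k)))

≈-trans : ∀ {c d e} → c ≈ d → d ≈ e → c ≈ e
≈-trans (base≈ p) (base≈ q) = base≈ (trans p q)
≈-trans (ref≈ p σ q) (ref≈ p′ σ′ q′) = ref≈ (≈-trans p p′) (σ ∘ₚ σ′) λ k → ≈-trans (q k) (q′ (σ ⟨$⟩ʳ k))

ref≈⁻ : ∀ {c d l m} → ref c l ≈ ref d m → c ≈ d
ref≈⁻ (ref≈ p _ _) = p

module _ {A B : Set} where

  map-index : (f : A → B) (l : List A) → Fin (length l) ↔ Fin (length (map f l))
  map-index f l = Perm.cast-id (≡sym (Listₚ.length-map f l))

  lookup-map-index : (f : A → B) (l : List A) → ∀ k → lookup (map f l) (Inverse.to (map-index f l) k) ≡ f (lookup l k)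
  lookup-map-index f (a ∷ l) zero    = refl
  lookup-map-index f (a ∷ l) (suc k) = lookup-map-index f l k

module _ {A B C : Set} {R : C → C → Set} (f : A → C) (g : B → C) (l : List A) (m : List B) where

  BagEqBy-map⁺ : BagEqBy (λ a b → R (f a) (g b)) l m → BagEqBy R (map f l) (map g m)
  BagEqBy-map⁺ (σ , h) = (Perm.flip (map-index f l) ∘ₚ (σ ∘ₚ map-index g m)) , λ k →
    subst (λ c → R c (lookup (map g m) (map-index g m ⟨$⟩ʳ (σ ⟨$⟩ʳ (map-index f l ⟨$⟩ˡ k)))))
      (trans (≡sym (lookup-map-index f l _)) (cong (lookup (map f l)) (Perm.inverseʳ (map-index f l))))
      (subst (R _) (≡sym (lookup-map-index g m _)) (h (map-index f l ⟨$⟩ˡ k)))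

  BagEqBy-map⁻ : BagEqBy R (map f l) (map g m) → BagEqBy (λ a b → R (f a) (g b)) l m
  BagEqBy-map⁻ (σ , h) = (map-index f l ∘ₚ (σ ∘ₚ Perm.flip (map-index g m))) , λ k →
    subst (λ c → R c (g (lookup m (map-index g m ⟨$⟩ˡ (σ ⟨$⟩ʳ (map-index f l ⟨$⟩ʳ k)))))) (lookup-map-index f l k)
      (subst (R _) (trans (cong (lookup (map g m)) (≡sym (Perm.inverseʳ (map-index g m)))) (lookup-map-index g m _))
        (h (map-index f l ⟨$⟩ʳ k)))

allFin-index : ∀ m → Fin m ↔ Fin (length (allFin m))
allFin-index m = Perm.cast-id (≡sym (Listₚ.length-tabulate {n = m} id))

lookup-tabulate-cast : ∀ {A : Set} {m} (f : Fin m → A) .(e : m ≡ length (tabulate f)) k → lookup (tabulate f) (cast e k) ≡ f k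
lookup-tabulate-cast {m = suc m} f e zero    = refl
lookup-tabulate-cast {m = suc m} f e (suc k) = lookup-tabulate-cast (f ∘ suc) (ℕₚ.suc-injective e) k

lookup-allFin-index : ∀ m k → lookup (allFin m) (allFin-index m ⟨$⟩ʳ k) ≡ k
lookup-allFin-index m k = lookup-tabulate-cast {m = m} id _ k

module _ {a b : ℕ} {R : Fin a → Fin b → Set} where

  BagEqBy-allFin⁺ : (Σ (Fin a ↔ Fin b) λ φ → ∀ u → R u (Inverse.to φ u)) → BagEqBy R (allFin a) (allFin b)
  BagEqBy-allFin⁺ (φ , h) = (Perm.flip (allFin-index a) ∘ₚ (φ ∘ₚ allFin-index b)) , λ k →
    subst (λ c → R c (lookup (allFin b) (allFin-index b ⟨$⟩ʳ (φ ⟨$⟩ʳ (allFin-index a ⟨$⟩ˡ k)))))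
      (trans (≡sym (lookup-allFin-index a _)) (cong (lookup (allFin a)) (Perm.inverseʳ (allFin-index a))))
      (subst (R _) (≡sym (lookup-allFin-index b _)) (h (allFin-index a ⟨$⟩ˡ k)))

  BagEqBy-allFin⁻ : BagEqBy R (allFin a) (allFin b) → Σ (Fin a ↔ Fin b) λ φ → ∀ u → R u (Inverse.to φ u)
  BagEqBy-allFin⁻ (σ , h) = (allFin-index a ∘ₚ (σ ∘ₚ Perm.flip (allFin-index b))) , λ k →
    subst (λ c → R c (allFin-index b ⟨$⟩ˡ (σ ⟨$⟩ʳ (allFin-index a ⟨$⟩ʳ k)))) (lookup-allFin-index a k)
      (subst (R _) (trans (cong (lookup (allFin b)) (≡sym (Perm.inverseʳ (allFin-index b)))) (lookup-allFin-index b _))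
        (h (allFin-index a ⟨$⟩ʳ k)))

#-filter : ∀ {A : Set} {m} (f : Fin m → A) (p q : A → Bool) →
  # (λ k → q (lookup (filterᵇ p (tabulate f)) k)) ≡ # (λ v → p (f v) ∧ q (f v))
#-filter {m = zero}  f p q = refl
#-filter {m = suc m} f p q with p (f zero)
... | true  = cong (bit (q (f zero)) +_) (#-filter (f ∘ suc) p q)
... | false = #-filter (f ∘ suc) p q

CR-col : ∀ G H i u v → CR G i u ≈ CR H i v → col G u ≡ col H v
CR-col G H zero    u v (base≈ e) = e
CR-col G H (suc i) u v e         = CR-col G H i u v (ref≈⁻ e)

-- Decidability of level `i` is a parameter, because `CR-dec` decides level `i + 1` by counting with
-- it.
module Level (G : Graph) (i : ℕ) (d : ∀ u v → Dec (CR G i u ≈ CR G i v)) where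

  cell : Fin (n G) → Fin (n G) → Bool
  cell u v = does (d u v)

  cell⁺ : ∀ {u v} → CR G i u ≈ CR G i v → cell u v ≡ true
  cell⁺ {u} {v} = dec-true (d u v)

  cell⁻ : ∀ {u v} → cell u v ≡ true → CR G i u ≈ CR G i v
  cell⁻ {u} {v} = dec-true⁻ (d u v)

  cell-refl : ∀ u → cell u u ≡ true
  cell-refl u = cell⁺ ≈-refl

  cell-resp : ∀ u v → CR G i u ≈ CR G i v → ∀ y → cell y u ≡ cell y v
  cell-resp u v e y = bool-iff (λ h → cell⁺ (≈-trans (cell⁻ h) e)) (λ h → cell⁺ (≈-trans (cell⁻ h) (≈-sym e)))

  -- `ψ` names for every vertex of H some vertex of G of the same colour, so that the classes of G
  -- can be counted inside H as well. The permutation of neighbours contained in an equality of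
  -- refined colours preserves classes, hence all counts.
  CR-counts : ∀ H (ψ : Fin (n H) → Fin (n G)) → (∀ w → CR H i w ≈ CR G i (ψ w)) →
    ∀ u v → CR G (suc i) u ≈ CR H (suc i) v →
    ∀ y → # (λ w → adj G u w ∧ cell y w) ≡ # (λ w → adj H v w ∧ cell y (ψ w))
  CR-counts H ψ ok u v (ref≈ _ σ q) y
    with τ , h ← BagEqBy-map⁻ {R = _≈_} (CR G i) (CR H i) (nbrs G u) (nbrs H v) (σ , q) = begin
    # (λ w → adj G u w ∧ cell y w)                  ≡⟨ #-filter id (adj G u) (cell y) ⟨
    # (λ k → cell y (lookup (nbrs G u) k))          ≡⟨ #-cong (λ k → cell-resp _ _ (≈-trans (h k) (ok _)) y) ⟩
    # (λ k → cell y (ψ (lookup (nbrs H v) (τ ⟨$⟩ʳ k)))) ≡⟨ #-bijection τ (λ k → cell y (ψ (lookup (nbrs H v) k))) ⟨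
    # (λ k → cell y (ψ (lookup (nbrs H v) k)))      ≡⟨ #-filter id (adj H v) (λ w → cell y (ψ w)) ⟩
    # (λ w → adj H v w ∧ cell y (ψ w))              ∎
    where open ≡-Reasoning

  counts-bag : ∀ (p q : Fin (n G) → Bool) → (∀ y → # (λ w → p w ∧ cell y w) ≡ # (λ w → q w ∧ cell y w)) →
    BagEqBy (λ a b → cell a b ≡ true) (filterᵇ p (allFin (n G))) (filterᵇ q (allFin (n G)))
  counts-bag p q h = match-families cell cell-refl (λ a b e → cell-resp a b (cell⁻ e)) _ _
    λ y → trans (#-filter id p (cell y)) (trans (h y) (≡sym (#-filter id q (cell y))))

-- Refined colours agree iff the old ones do and every old class contains equally many neighbours;
-- comparing these counts replaces a search through all permutations.
CR-dec : ∀ G i u v → Dec (CR G i u ≈ CR G i v)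
CR-dec G zero    u v = map′ base≈ (λ { (base≈ e) → e }) (col G u ℕₚ.≟ col G v)
CR-dec G (suc i) u v = map′ fwd bwd
  (CR-dec G i u v ×-dec Finₚ.all? λ y → # (λ w → adj G u w ∧ cell y w) ℕₚ.≟ # (λ w → adj G v w ∧ cell y w))
  where
  open Level G i (CR-dec G i)
  Counts : Set
  Counts = ∀ y → # (λ w → adj G u w ∧ cell y w) ≡ # (λ w → adj G v w ∧ cell y w)
  fwd : (CR G i u ≈ CR G i v) × Counts → CR G (suc i) u ≈ CR G (suc i) v
  fwd (e , h) with τ , t ← counts-bag (adj G u) (adj G v) h
    with σ , q ← BagEqBy-map⁺ {R = _≈_} (CR G i) (CR G i) (nbrs G u) (nbrs G v) (τ , cell⁻ ∘ t) = ref≈ e σ q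
  bwd : CR G (suc i) u ≈ CR G (suc i) v → (CR G i u ≈ CR G i v) × Counts
  bwd e = ref≈⁻ e , CR-counts G id (λ _ → ≈-refl) u v e

Iso-CR : ∀ G H ((f , _) : Iso G H) i u → CR G i u ≈ CR H i (Inverse.to f u)
Iso-CR G H (f , fa , fc) zero    u = base≈ (fc u)
Iso-CR G H F@(f , fa , fc) (suc i) u = ref≈ (Iso-CR G H F i u) (proj₁ bag) (proj₂ bag)
  where
  eq : Fin (n H) → Fin (n H) → Bool
  eq a b = does (a Finₚ.≟ b)
  counts : ∀ a → # (λ k → eq a (f ⟨$⟩ʳ lookup (nbrs G u) k)) ≡ # (λ k → eq a (lookup (nbrs H (f ⟨$⟩ʳ u)) k))
  counts a = begin
    # (λ k → eq a (f ⟨$⟩ʳ lookup (nbrs G u) k))              ≡⟨ #-filter id (adj G u) (λ v → eq a (f ⟨$⟩ʳ v)) ⟩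
    # (λ v → adj G u v ∧ eq a (f ⟨$⟩ʳ v))                    ≡⟨ #-cong (λ v → cong (_∧ eq a (f ⟨$⟩ʳ v)) (fa u v)) ⟩
    # (λ v → adj H (f ⟨$⟩ʳ u) (f ⟨$⟩ʳ v) ∧ eq a (f ⟨$⟩ʳ v))  ≡⟨ #-bijection f (λ w → adj H (f ⟨$⟩ʳ u) w ∧ eq a w) ⟨
    # (λ w → adj H (f ⟨$⟩ʳ u) w ∧ eq a w)                    ≡⟨ #-filter id (adj H (f ⟨$⟩ʳ u)) (eq a) ⟨
    # (λ k → eq a (lookup (nbrs H (f ⟨$⟩ʳ u)) k))            ∎
    where open ≡-Reasoning
  matched : Σ (Fin (length (nbrs G u)) ↔ Fin (length (nbrs H (f ⟨$⟩ʳ u)))) λ σ →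
    ∀ k → eq (f ⟨$⟩ʳ lookup (nbrs G u) k) (lookup (nbrs H (f ⟨$⟩ʳ u)) (Inverse.to σ k)) ≡ true
  matched = match-families eq (λ a → dec-true (a Finₚ.≟ a) refl)
    (λ a b e c → cong (eq c) (dec-true⁻ (a Finₚ.≟ b) e)) _ _ counts
  bag : BagEqBy _≈_ (map (CR G i) (nbrs G u)) (map (CR H i) (nbrs H (f ⟨$⟩ʳ u)))
  bag = BagEqBy-map⁺ {R = _≈_} (CR G i) (CR H i) (nbrs G u) (nbrs H (f ⟨$⟩ʳ u)) (proj₁ matched , λ k →
    ≈-trans (Iso-CR G H F i (lookup (nbrs G u) k))
      (subst (λ w → CR H i (f ⟨$⟩ʳ lookup (nbrs G u) k) ≈ CR H i w) (dec-true⁻ (_ Finₚ.≟ _) (proj₂ matched k)) ≈-refl))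

module Bridge (G : Graph) (s : ℕ) (st : IsStable G s) where

  open Cells G s using (V; _∼_)
  open Level G s (CR-dec G s) public

  deg : (V → V → Bool) → V → V → ℕ
  deg A u y = # (λ w → A u w ∧ cell y w)

  deg-cell : ∀ u v → u ∼ v → ∀ y → deg (adj G) u y ≡ deg (adj G) v y
  deg-cell u v e = CR-counts G id (λ _ → ≈-refl) u v (proj₁ (st u v) e)

  Rewiring : (V → V → Bool) → Set
  Rewiring A = (∀ u v → A u v ≡ A v u) × (∀ u → A u u ≡ false) × (∀ u y → deg A u y ≡ deg (adj G) u y)

  CellPreserving : (V ↔ V) → Set
  CellPreserving f = ∀ u → u ∼ Inverse.to f u

  Rigid : Set
  Rigid = ∀ A → Rewiring A → Σ (V ↔ V) λ f → CellPreserving f ×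
    (∀ u v → adj G u v ≡ A (Inverse.to f u) (Inverse.to f v))

  rewired : ∀ A → Rewiring A → Graph
  rewired A (A-sym , A-irrefl , _) = record { n = n G ; adj = A ; sym = A-sym ; irrefl = A-irrefl ; col = col G }

  -- The induction needs any `u` and `v` of one cell, not just `u = v`: equal degrees into the cells
  -- pair the neighbours of the two vertices only up to cells.
  rewired-CR : ∀ A (R : Rewiring A) i u v → u ∼ v → CR (rewired A R) i u ≈ CR G i v
  rewired-CR A R zero u v e = base≈ (CR-col G G s u v e)
  rewired-CR A R (suc i) u v e
    with τ , t ← counts-bag (A u) (adj G v) (λ y → trans (proj₂ (proj₂ R) u y) (deg-cell u v e y))
    with σ , q ← BagEqBy-map⁺ {R = _≈_} (CR (rewired A R) i) (CR G i) (filterᵇ (A u) (allFin (n G))) (nbrs G v)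
      (τ , λ k → rewired-CR A R i _ _ (cell⁻ (t k)))
    = ref≈ (rewired-CR A R i u v e) σ q

  amenable⇒rigid : Amenable G → Rigid
  amenable⇒rigid am A R = proj₁ iso , (λ u → ≈-trans (Iso-CR G H iso s u) (rewired-CR A R s _ _ ≈-refl)) , proj₁ (proj₂ iso)
    where
    H : Graph
    H = rewired A R
    iso : Iso G H
    iso = am H λ i → BagEqBy-map⁺ {R = _≈_} (CR G i) (CR H i) (allFin (n G)) (allFin (n G))
      (BagEqBy-allFin⁺ {R = λ u v → CR G i u ≈ CR H i v} (Perm.id , λ u → ≈-sym (rewired-CR A R i u u ≈-refl)))

  -- A bijection φ matching the colours of G and H at level s + 1 pulls H back to the vertices of G.
  -- Level s + 1 rather than s is used because its colours record how many neighbours lie in each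
  -- cell of level s, so the pullback is a rewiring.
  rigid⇒amenable : Rigid → Amenable G
  rigid⇒amenable rigid H same with φ , φ-CR ← BagEqBy-allFin⁻ {R = λ u v → CR G (suc s) u ≈ CR H (suc s) v}
    (BagEqBy-map⁻ {R = _≈_} (CR G (suc s)) (CR H (suc s)) (allFin (n G)) (allFin (n H)) (same (suc s)))
    = (f ∘ₚ φ) , (λ u v → proj₂ (proj₂ res) u v) ,
      λ u → trans (CR-col G G s u _ (proj₁ (proj₂ res) u)) (CR-col G H (suc s) _ _ (φ-CR (f ⟨$⟩ʳ u)))
    where
    A : V → V → Bool
    A u v = adj H (φ ⟨$⟩ʳ u) (φ ⟨$⟩ʳ v)
    A-deg : ∀ u y → deg A u y ≡ deg (adj G) u y
    A-deg u y = begin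
      # (λ w → adj H (φ ⟨$⟩ʳ u) (φ ⟨$⟩ʳ w) ∧ cell y w)
        ≡⟨ #-cong (λ w → cong (λ z → A u w ∧ cell y z) (Perm.inverseˡ φ)) ⟨
      # (λ w → adj H (φ ⟨$⟩ʳ u) (φ ⟨$⟩ʳ w) ∧ cell y (φ ⟨$⟩ˡ (φ ⟨$⟩ʳ w)))
        ≡⟨ #-bijection φ (λ w → adj H (φ ⟨$⟩ʳ u) w ∧ cell y (φ ⟨$⟩ˡ w)) ⟨
      # (λ w → adj H (φ ⟨$⟩ʳ u) w ∧ cell y (φ ⟨$⟩ˡ w))
        ≡⟨ CR-counts H (φ ⟨$⟩ˡ_) ψ-CR u (φ ⟨$⟩ʳ u) (φ-CR u) y ⟨
      # (λ w → adj G u w ∧ cell y w) ∎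
      where
      open ≡-Reasoning
      ψ-CR : ∀ w → CR H s w ≈ CR G s (φ ⟨$⟩ˡ w)
      ψ-CR w = subst (λ z → CR H s z ≈ CR G s (φ ⟨$⟩ˡ w)) (Perm.inverseʳ φ) (≈-sym (ref≈⁻ (φ-CR (φ ⟨$⟩ˡ w))))
    res = rigid A ((λ u v → Graph.sym H _ _) , (λ u → irrefl H _) , A-deg)
    f : V ↔ V
    f = proj₁ res

-- Stars, perfect matchings and the five-cycle

∀-bool? : ∀ {P : Bool → Set} → (∀ b → Dec (P b)) → Dec (∀ b → P b)
∀-bool? d = map′ (λ { (t , f) true → t ; (t , f) false → f }) (λ h → h true , h false) (d true ×-dec d false)

Enum-∘ : ∀ {m} {A B : Set} {p : Fin m → Bool} {f : B → Fin m} (φ : A ↔ B) → Enum p f → Enum p (f ∘ Inverse.to φ)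
Enum-∘ {f = f} φ P = (λ e → ↔-injective φ (proj₁ P e)) , λ v → mk⇔
  (λ h → let t , e = Enum-index P v h in Inverse.from φ t , trans (cong f (Inverse.strictlyInverseˡ φ t)) e)
  (λ { (t , refl) → Enum-∈ P (Inverse.to φ t) })

Enum-×-# : ∀ {m a b} {p : Fin m → Bool} {f : Fin a × Fin b → Fin m} → Enum p f → a * b ≡ # p
Enum-×-# P = Enum-# (Enum-∘ Finₚ.*↔× P)

Enum-from-injection : ∀ {m k} {p : Fin m → Bool} {f : Fin k → Fin m} → Injective _≡_ _≡_ f → (∀ t → p (f t) ≡ true) →
  # p ≡ k → Enum p f
Enum-from-injection {p = p} {f} inj f∈p e = inj , λ v → mk⇔
  (λ h → dec-true⁻ (im? v) (#-full {p = im} im⊆p (ℕₚ.≤-reflexive (trans e (Enum-# im-enum))) v h)) (λ { (t , refl) → f∈p t })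
  where
  im? : ∀ v → Dec (∃ λ t → f t ≡ v)
  im? v = Finₚ.any? (λ t → f t Finₚ.≟ v)
  im : Fin _ → Bool
  im v = does (im? v)
  im-enum : Enum im f
  im-enum = inj , λ v → mk⇔ (dec-true⁻ (im? v)) (dec-true (im? v))
  im⊆p : ∀ v → im v ≡ true → p v ≡ true
  im⊆p v h with t , refl ← dec-true⁻ (im? v) h = f∈p t

-- The labels `f` of the centres are prescribed, so that the stars of two relations can be labelled
-- over the same centres; `star-relabel` then moves leaves only.
star-enum : ∀ {m k s t} {p : Fin m → Bool} {q : Fin k → Bool} (r : Fin m → Fin k → Bool) {f : Fin s → Fin m} → Enum p f →
  (∀ v → q v ≡ true → # (λ u → p u ∧ r u v) ≡ 1) → (∀ u → p u ≡ true → # (λ v → q v ∧ r u v) ≡ t) →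
  Σ (Fin s × Fin t → Fin k) λ g → Enum q g × (∀ i b → r (f i) (g b) ≡ true ⇔ i ≡ proj₁ b)
star-enum {s = s} {t} {p} {q} r {f} P ones ts = g , (g-inj , λ v → mk⇔ (g-on v) (λ { ((i , l) , refl) → ∧-left (Enum-∈ (E′ i) l) })) , g-r
  where
  E′ : ∀ i → Enum (λ v → q v ∧ r (f i) v) (proj₁ (Enum-subst (ts (f i) (Enum-∈ P i)) (enumerate (λ v → q v ∧ r (f i) v))))
  E′ i = proj₂ (Enum-subst (ts (f i) (Enum-∈ P i)) (enumerate (λ v → q v ∧ r (f i) v)))
  g : Fin s × Fin t → Fin _
  g (i , l) = proj₁ (Enum-subst (ts (f i) (Enum-∈ P i)) (enumerate (λ v → q v ∧ r (f i) v))) l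
  g∈q : ∀ b → q (g b) ≡ true
  g∈q (i , l) = ∧-left (Enum-∈ (E′ i) l)
  r-fg : ∀ i l → r (f i) (g (i , l)) ≡ true
  r-fg i l = ∧-right {q (g (i , l))} (Enum-∈ (E′ i) l)
  same : ∀ i j v → q v ≡ true → r (f i) v ≡ true → r (f j) v ≡ true → i ≡ j
  same i j v qv ri rj with u , _ , only ← #-unique _ (ones v qv) =
    proj₁ P (trans (≡sym (only (f i) (∧-true (Enum-∈ P i) ri))) (only (f j) (∧-true (Enum-∈ P j) rj)))
  g-r : ∀ i b → r (f i) (g b) ≡ true ⇔ i ≡ proj₁ b
  g-r i (j , l) = mk⇔ (λ h → same i j (g (j , l)) (g∈q (j , l)) h (r-fg j l)) (λ { refl → r-fg i l })
  g-inj : Injective _≡_ _≡_ g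
  g-inj {i , l} {j , l′} e with same i j (g (i , l)) (g∈q (i , l)) (r-fg i l) (subst (λ v → r (f j) v ≡ true) (≡sym e) (r-fg j l′))
  ... | refl = cong (i ,_) (proj₁ (E′ i) e)
  g-on : ∀ v → q v ≡ true → ∃ λ b → g b ≡ v
  g-on v qv with u , pr , _ ← #-unique _ (ones v qv) with i , refl ← Enum-index P u (∧-left pr)
    with l , e ← Enum-index (E′ i) v (∧-true qv (∧-right {p u} pr)) = (i , l) , e

star-ones : ∀ {m k s t} {p : Fin m → Bool} {q : Fin k → Bool} (r : Fin m → Fin k → Bool) {f : Fin s → Fin m}
  {g : Fin s × Fin t → Fin k} → Enum p f → Enum q g → (∀ i b → r (f i) (g b) ≡ true ⇔ i ≡ proj₁ b) →
  ∀ v → q v ≡ true → # (λ u → p u ∧ r u v) ≡ 1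
star-ones {p = p} r {f} {g} P Q fg v qv with (i , l) , refl ← Enum-index Q v qv =
  #-single _ (f i) (∧-true (Enum-∈ P i) (Equivalence.from (fg i (i , l)) refl)) only
  where
  only : ∀ w → p w ∧ r w (g (i , l)) ≡ true → f i ≡ w
  only w h with j , refl ← Enum-index P w (∧-left h) = cong f (≡sym (Equivalence.to (fg j (i , l)) (∧-right {p w} h)))

Matched : ∀ m → Fin m × Fin 2 → Fin m × Fin 2 → Set
Matched m (a , i) (b , j) = a ≡ b × i ≢ j

other : Fin 2 → Fin 2
other 0F       = 1F
other 1F = 0F

other-≢ : ∀ i → i ≢ other i
other-≢ 0F       ()
other-≢ 1F ()

≢⇒other : ∀ i j → i ≢ j → j ≡ other i
≢⇒other 0F       0F       h = contradiction refl h
≢⇒other 0F       1F h = refl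
≢⇒other 1F 0F       h = refl
≢⇒other 1F 1F h = contradiction refl h

-- Each edge is represented by its smaller end; end 0 of the edge is this representative and end 1
-- its partner.
matching-enum : ∀ {k} (q : Fin k → Bool) (M : Fin k → Fin k → Bool) → (∀ u v → M u v ≡ M v u) → (∀ u → M u u ≡ false) →
  (∀ u → q u ≡ true → # (λ v → q v ∧ M u v) ≡ 1) →
  ∃ λ m → Σ (Fin m × Fin 2 → Fin k) λ h → Enum q h × (∀ a b → M (h a) (h b) ≡ true ⇔ Matched m a b)
matching-enum {k} q M M-sym M-irrefl one = # rep , h , (h-inj , λ v → mk⇔ (h-on v) (λ { (b , refl) → h∈q b })) , h-M
  where
  find : ∀ u b → q u ≡ b → Fin k
  find u true  e = proj₁ (#-unique (λ v → q v ∧ M u v) (one u e))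
  -- A default value: partners are only taken inside `q`.
  find u false e = u
  partner : Fin k → Fin k
  partner u = find u (q u) refl
  partner-spec : ∀ u → q u ≡ true → (q (partner u) ≡ true × M u (partner u) ≡ true) ×
    (∀ w → q w ≡ true → M u w ≡ true → partner u ≡ w)
  partner-spec u qu = go (q u) refl
    where
    go : ∀ b (e : q u ≡ b) → (q (find u b e) ≡ true × M u (find u b e) ≡ true) ×
      (∀ w → q w ≡ true → M u w ≡ true → find u b e ≡ w)
    go true e = let v , pr , only = #-unique (λ v → q v ∧ M u v) (one u e) in
      (∧-left pr , ∧-right {q v} pr) , λ w qw Mw → only w (∧-true qw Mw)
    go false e = true≢false qu e
  partner∈ : ∀ u → q u ≡ true → q (partner u) ≡ true
  partner∈ u qu = proj₁ (proj₁ (partner-spec u qu))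
  partner-M : ∀ u → q u ≡ true → M u (partner u) ≡ true
  partner-M u qu = proj₂ (proj₁ (partner-spec u qu))
  partner-only : ∀ u → q u ≡ true → ∀ w → q w ≡ true → M u w ≡ true → partner u ≡ w
  partner-only u qu = proj₂ (partner-spec u qu)
  partner² : ∀ u → q u ≡ true → partner (partner u) ≡ u
  partner² u qu = partner-only (partner u) (partner∈ u qu) u qu (trans (M-sym (partner u) u) (partner-M u qu))
  rep : Fin k → Bool
  rep u = q u ∧ does (u Finₚ.<? partner u)
  f : Fin (# rep) → Fin k
  f = proj₁ (enumerate rep)
  F : Enum rep f
  F = proj₂ (enumerate rep)
  f∈q : ∀ a → q (f a) ≡ true
  f∈q a = ∧-left (Enum-∈ F a)
  f< : ∀ a → f a Data.Fin.< partner (f a)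
  f< a = dec-true⁻ (f a Finₚ.<? partner (f a)) (∧-right {q (f a)} (Enum-∈ F a))
  h : Fin (# rep) × Fin 2 → Fin k
  h (a , zero)     = f a
  h (a , suc zero) = partner (f a)
  h∈q : ∀ b → q (h b) ≡ true
  h∈q (a , zero)     = f∈q a
  h∈q (a , suc zero) = partner∈ (f a) (f∈q a)
  h-other : ∀ a i → partner (h (a , i)) ≡ h (a , other i)
  h-other a zero       = refl
  h-other a (suc zero) = partner² (f a) (f∈q a)
  clash : ∀ a b → f a ≢ partner (f b)
  clash a b e = ℕₚ.<-asym (f< a) (subst (λ z → toℕ z < toℕ (f a)) (≡sym (trans (cong partner e) (partner² (f b) (f∈q b))))
    (subst (λ z → toℕ (f b) < toℕ z) (≡sym e) (f< b)))
  h-inj : Injective _≡_ _≡_ h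
  h-inj {a , zero}     {b , zero}     e = cong (_, zero) (proj₁ F e)
  h-inj {a , zero}     {b , suc zero} e = contradiction e (clash a b)
  h-inj {a , suc zero} {b , zero}     e = contradiction (≡sym e) (clash b a)
  h-inj {a , suc zero} {b , suc zero} e = cong (_, suc zero) (proj₁ F
    (trans (≡sym (partner² (f a) (f∈q a))) (trans (cong partner e) (partner² (f b) (f∈q b)))))
  h-on : ∀ v → q v ≡ true → ∃ λ b → h b ≡ v
  h-on v qv with v Finₚ.<? partner v in lt
  ... | yes p with a , e ← Enum-index F v (∧-true qv (cong does lt)) = (a , zero) , e
  ... | no ¬p with a , e ← Enum-index F (partner v) (∧-true (partner∈ v qv)
          (dec-true (partner v Finₚ.<? partner (partner v)) (subst (λ z → toℕ (partner v) < toℕ z) (≡sym (partner² v qv))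
            (ℕₚ.≤∧≢⇒< (ℕₚ.≮⇒≥ ¬p) λ z → true≢false (partner-M v qv) (trans (cong (M v) (Finₚ.toℕ-injective z)) (M-irrefl v))))))
    = (a , suc zero) , trans (cong partner e) (partner² v qv)
  h-M : ∀ a b → M (h a) (h b) ≡ true ⇔ Matched _ a b
  h-M (a , i) (b , j) = mk⇔ to from
    where
    to : M (h (a , i)) (h (b , j)) ≡ true → a ≡ b × i ≢ j
    to e with refl ← h-inj {a , other i} {b , j} (trans (≡sym (h-other a i)) (partner-only _ (h∈q (a , i)) _ (h∈q (b , j))
        e)) = refl , other-≢ i
    from : a ≡ b × i ≢ j → M (h (a , i)) (h (b , j)) ≡ true
    from (refl , ne) with refl ← ≢⇒other i j ne = trans (cong (M (h (a , i))) (≡sym (h-other a i))) (partner-M _ (h∈q (a , i)))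

module FiveCycle where

  open import Data.Vec using (Vec; []; _∷_) renaming (lookup to _!_)

  next : Fin 5 → Fin 5
  next 0F = 1F
  next 1F = 2F
  next 2F = 3F
  next 3F = 4F
  next 4F = 0F

  adjacent? : ∀ i j → Dec (j ≡ next i ⊎ i ≡ next j)
  adjacent? i j = (j Finₚ.≟ next i) ⊎-dec (i Finₚ.≟ next j)

  two-neighbours : ∀ i → # (λ j → does (adjacent? i j)) ≡ 2
  two-neighbours 0F = refl
  two-neighbours 1F = refl
  two-neighbours 2F = refl
  two-neighbours 3F = refl
  two-neighbours 4F = refl

  private
    relation : (a b c d e f g h i j : Bool) → Fin 5 → Fin 5 → Bool
    relation a b c d e f g h i j u v = ((
      (false ∷ a ∷ b ∷ c ∷ d ∷ []) ∷
      (a ∷ false ∷ e ∷ f ∷ g ∷ []) ∷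
      (b ∷ e ∷ false ∷ h ∷ i ∷ []) ∷
      (c ∷ f ∷ h ∷ false ∷ j ∷ []) ∷
      (d ∷ g ∷ i ∷ j ∷ false ∷ []) ∷ []) ! u) ! v

    Labels : (Fin 5 → Fin 5 → Bool) → (Fin 5 → Fin 5) → Set
    Labels B π = ∀ i j → (π i ≡ π j → i ≡ j) × (B (π i) (π j) ≡ does (adjacent? i j))

    labels? : ∀ B π → Dec (Labels B π)
    labels? B π = Finₚ.all? λ i → Finₚ.all? λ j →
      ((π i Finₚ.≟ π j) →-dec (i Finₚ.≟ j)) ×-dec (B (π i) (π j) Boolₚ.≟ does (adjacent? i j))

    -- The 4!/2 = 12 five-cycles on five points, written from 0 in the direction in which the second
    -- entry is below the last.
    orders : Vec (Vec (Fin 5) 5) 12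
    orders =
      (0F ∷ 1F ∷ 2F ∷ 3F ∷ 4F ∷ []) ∷ (0F ∷ 1F ∷ 2F ∷ 4F ∷ 3F ∷ []) ∷ (0F ∷ 1F ∷ 3F ∷ 2F ∷ 4F ∷ []) ∷
      (0F ∷ 1F ∷ 3F ∷ 4F ∷ 2F ∷ []) ∷ (0F ∷ 1F ∷ 4F ∷ 2F ∷ 3F ∷ []) ∷ (0F ∷ 1F ∷ 4F ∷ 3F ∷ 2F ∷ []) ∷
      (0F ∷ 2F ∷ 1F ∷ 3F ∷ 4F ∷ []) ∷ (0F ∷ 2F ∷ 1F ∷ 4F ∷ 3F ∷ []) ∷ (0F ∷ 2F ∷ 3F ∷ 1F ∷ 4F ∷ []) ∷
      (0F ∷ 2F ∷ 4F ∷ 1F ∷ 3F ∷ []) ∷ (0F ∷ 3F ∷ 1F ∷ 2F ∷ 4F ∷ []) ∷ (0F ∷ 3F ∷ 2F ∷ 1F ∷ 4F ∷ []) ∷ []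

    Goal : (Fin 5 → Fin 5 → Bool) → Set
    Goal B = (∀ i → # (B i) ≡ 2) → ∃ λ k → Labels B ((orders ! k) !_)

    goal? : ∀ B → Dec (Goal B)
    goal? B = (Finₚ.all? λ i → # (B i) ℕₚ.≟ 2) →-dec (Finₚ.any? λ k → labels? B ((orders ! k) !_))

    -- Evaluation over the 2^10 symmetric irreflexive relations on five points.
    goal : ∀ a b c d e f g h i j → Goal (relation a b c d e f g h i j)
    goal = dec-true⁻ (∀-bool? λ a → ∀-bool? λ b → ∀-bool? λ c → ∀-bool? λ d → ∀-bool? λ e → ∀-bool? λ f → ∀-bool? λ g →
      ∀-bool? λ h → ∀-bool? λ i → ∀-bool? λ j → goal? (relation a b c d e f g h i j)) refl

  abstract
    unique : (B : Fin 5 → Fin 5 → Bool) → (∀ u v → B u v ≡ B v u) → (∀ u → B u u ≡ false) → (∀ i → # (B i) ≡ 2) →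
      Σ (Fin 5 → Fin 5) λ π → Injective _≡_ _≡_ π × (∀ i j → B (π i) (π j) ≡ does (adjacent? i j))
    unique B B-sym B-irrefl reg = (orders ! proj₁ found) !_ ,
      (λ {i} {j} → proj₁ (proj₂ found i j)) , λ i j → trans (same _ _) (proj₂ (proj₂ found i j))
      where
      B′ : Fin 5 → Fin 5 → Bool
      B′ = relation (B 0F 1F) (B 0F 2F) (B 0F 3F) (B 0F 4F) (B 1F 2F) (B 1F 3F) (B 1F 4F) (B 2F 3F) (B 2F 4F) (B 3F 4F)
      same : ∀ u v → B u v ≡ B′ u v
      same 0F 0F = B-irrefl _
      same 0F 1F = refl
      same 0F 2F = refl
      same 0F 3F = refl
      same 0F 4F = refl
      same 1F 0F = B-sym _ _
      same 1F 1F = B-irrefl _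
      same 1F 2F = refl
      same 1F 3F = refl
      same 1F 4F = refl
      same 2F 0F = B-sym _ _
      same 2F 1F = B-sym _ _
      same 2F 2F = B-irrefl _
      same 2F 3F = refl
      same 2F 4F = refl
      same 3F 0F = B-sym _ _
      same 3F 1F = B-sym _ _
      same 3F 2F = B-sym _ _
      same 3F 3F = B-irrefl _
      same 3F 4F = refl
      same 4F 0F = B-sym _ _
      same 4F 1F = B-sym _ _
      same 4F 2F = B-sym _ _
      same 4F 3F = B-sym _ _
      same 4F 4F = B-irrefl _
      found : ∃ λ k → Labels B′ ((orders ! k) !_)
      found = goal (B 0F 1F) (B 0F 2F) (B 0F 3F) (B 0F 4F) (B 1F 2F) (B 1F 3F) (B 1F 4F) (B 2F 3F) (B 2F 4F) (B 3F 4F) (λ i →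
          trans (#-cong (λ j → ≡sym (same i j))) (reg i))

-- Cells and the edges between them

xor-cancelˡ : ∀ c {a b} → c xor a ≡ c xor b → a ≡ b
xor-cancelˡ false e = e
xor-cancelˡ true  e = Boolₚ.not-injective e

co-iff : ∀ {b k} {i j : Fin k} → T b ⇔ i ≢ j → not b ≡ true ⇔ i ≡ j
co-iff {false} {i = i} {j} e = mk⇔ (λ _ → decidable-stable (i Finₚ.≟ j) (Equivalence.from e)) (λ _ → refl)
co-iff {true} e = mk⇔ (λ ()) (λ q → ⊥-elim (Equivalence.to e tt q))

module CellTheory (G : Graph) (s : ℕ) (st : IsStable G s) where

  open Cells G s public
  open Bridge G s st public

  _∼?_ : ∀ u v → Dec (u ∼ v)
  _∼?_ = CR-dec G s

  size : V → ℕ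
  size x = # (cell x)

  cell-cong : ∀ {x y} → x ∼ y → ∀ v → cell x v ≡ cell y v
  cell-cong e v = bool-iff (λ h → cell⁺ (≈-trans (≈-sym e) (cell⁻ h))) (λ h → cell⁺ (≈-trans e (cell⁻ h)))

  size-cong : ∀ {x y} → x ∼ y → size x ≡ size y
  size-cong {x} {y} e = #-cong (cell-cong {x} {y} e)

  size-positive : ∀ x → 0 < size x
  size-positive x = #-positive (cell x) x (cell-refl x)

  Enumerates⇒Enum : ∀ {A : Set} {x} {f : A → V} → Enumerates x f → Enum (cell x) f
  Enumerates⇒Enum (inj , on) = inj , λ v → mk⇔ (λ h → Equivalence.to (on v) (cell⁻ h)) (λ h → cell⁺ (Equivalence.from (on v) h))

  Enum⇒Enumerates : ∀ {A : Set} {x} {f : A → V} → Enum (cell x) f → Enumerates x f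
  Enum⇒Enumerates (inj , on) = inj , λ v → mk⇔ (λ h → Equivalence.to (on v) (cell⁺ h)) (λ h → cell⁻ (Equivalence.from (on v) h))

  card : ∀ x → Card x (size x)
  card x = proj₁ (enumerate (cell x)) , Enum⇒Enumerates (proj₂ (enumerate (cell x)))

  card-size : ∀ {x k} → Card x k → k ≡ size x
  card-size (f , P) = Enum-# (Enumerates⇒Enum P)

  card-subst : ∀ {x k} → size x ≡ k → Card x k
  card-subst {x} e = subst (Card x) e (card x)

  CardLe⁺ : ∀ x y → size x ≤ size y → CardLe x y
  CardLe⁺ x y le = _ , _ , card x , card y , le

  CardLe⁻ : ∀ x y → CardLe x y → size x ≤ size y
  CardLe⁻ x y (a , b , cx , cy , le) = subst₂ _≤_ (card-size {x} cx) (card-size {y} cy) le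

  complete? : ∀ x y → Dec (CompleteBip x y)
  complete? x y = Finₚ.all? λ a → Finₚ.all? λ b → (x ∼? a) →-dec ((y ∼? b) →-dec Boolₚ.T? (adj G a b))

  empty? : ∀ x y → Dec (EmptyBip x y)
  empty? x y = Finₚ.all? λ a → Finₚ.all? λ b → (x ∼? a) →-dec ((y ∼? b) →-dec ¬? (Boolₚ.T? (adj G a b)))

  isotropic? : ∀ x y → Dec (Isotropic x y)
  isotropic? x y = complete? x y ⊎-dec empty? x y

  homogeneous? : ∀ x → Dec (Homogeneous x)
  homogeneous? x = (Finₚ.all? λ a → Finₚ.all? λ b → (x ∼? a) →-dec ((x ∼? b) →-dec (¬? (a Finₚ.≟ b) →-dec Boolₚ.T? (adj G a b))))
    ⊎-dec empty? x x

  E-sym : ∀ {u v} → E G u v → E G v u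
  E-sym {u} {v} = subst T (Graph.sym G u v)

  isotropic-sym : ∀ {x y} → Isotropic x y → Isotropic y x
  isotropic-sym (inj₁ h) = inj₁ λ a b ya xb → E-sym {b} {a} (h b a xb ya)
  isotropic-sym (inj₂ h) = inj₂ λ a b ya xb e → h b a xb ya (E-sym {a} {b} e)

  isotropic-resp : ∀ {x x′ y y′} → x ∼ x′ → y ∼ y′ → Isotropic x y → Isotropic x′ y′
  isotropic-resp p q (inj₁ h) = inj₁ λ a b xa yb → h a b (≈-trans p xa) (≈-trans q yb)
  isotropic-resp p q (inj₂ h) = inj₂ λ a b xa yb → h a b (≈-trans p xa) (≈-trans q yb)

  aniso-sym : ∀ {x y} → Anisotropic x y → Anisotropic y x
  aniso-sym {x} {y} a i = a (isotropic-sym {y} {x} i)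

  aniso-resp : ∀ {x x′ y y′} → x ∼ x′ → y ∼ y′ → Anisotropic x y → Anisotropic x′ y′
  aniso-resp {x} {x′} {y} {y′} p q a i = a (isotropic-resp {x′} {x} {y′} {y} (≈-sym p) (≈-sym q) i)

  -- The colour c selects the adjacency relation (false) or its complement (true).
  dg : Bool → (V → V → Bool) → V → V → ℕ
  dg c A x v = # (λ u → cell x u ∧ (c xor A u v))

  -- The count in the complement is the cell size minus the plain count, so the plain count
  -- determines both.
  dg-cong : ∀ c {A B : V → V → Bool} → (∀ u v → A u v ≡ A v u) → (∀ u v → B u v ≡ B v u) → ∀ x v w →
    deg A v x ≡ deg B w x → dg c A x v ≡ dg c B x w
  dg-cong c {A} {B} A-sym B-sym x v w e = go c
    where
    swap : ∀ {C : V → V → Bool} → (∀ u v → C u v ≡ C v u) → ∀ v → dg false C x v ≡ deg C v x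
    swap C-sym v = #-cong λ u → trans (cong (cell x u ∧_) (C-sym u v)) (Boolₚ.∧-comm (cell x u) _)
    plain : dg false A x v ≡ dg false B x w
    plain = trans (swap A-sym v) (trans e (≡sym (swap B-sym w)))
    go : ∀ c → dg c A x v ≡ dg c B x w
    go false = plain
    go true  = ℕₚ.+-cancelˡ-≡ (dg false A x v) _ _ (trans (#-split (cell x) (λ u → A u v))
      (trans (≡sym (#-split (cell x) (λ u → B u w))) (cong (_+ dg true B x w) (≡sym plain))))

  dg-rewiring : ∀ {A} → Rewiring A → ∀ c x v → dg c A x v ≡ dg c (adj G) x v
  dg-rewiring (A-sym , _ , A-deg) c x v = dg-cong c A-sym (Graph.sym G) x v v (A-deg v x)

  dg-const : ∀ c x {v w} → v ∼ w → dg c (adj G) x v ≡ dg c (adj G) x w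
  dg-const c x {v} {w} e = dg-cong c (Graph.sym G) (Graph.sym G) x v w (deg-cell v w e x)

  dg-sym : ∀ c {A : V → V → Bool} → (∀ u v → A u v ≡ A v u) → ∀ y u → # (λ v → cell y v ∧ (c xor A u v)) ≡ dg c A y u
  dg-sym c A-sym y u = #-cong λ v → cong (λ z → cell y v ∧ (c xor z)) (A-sym u v)

  -- Degree 0 or |y| leaves no choice of neighbours in `y`: the neighbour sets under A and G are
  -- nested and equally large.
  isotropic-rewiring : ∀ {A} → Rewiring A → ∀ x y → Isotropic x y → ∀ u v → x ∼ u → y ∼ v → A u v ≡ adj G u v
  isotropic-rewiring {A} (_ , _ , A-deg) x y (inj₁ full) u v xu yv = trans
    (∧-left (#-full {p = λ w → A u w ∧ cell y w} {λ w → adj G u w ∧ cell y w}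
      (λ w h → ∧-true (T⇒≡ (full u w xu (cell⁻ (∧-right {A u w} h)))) (∧-right {A u w} h))
      (ℕₚ.≤-reflexive (≡sym (A-deg u y))) v (∧-true (T⇒≡ (full u v xu yv)) (cell⁺ yv))))
    (≡sym (T⇒≡ (full u v xu yv)))
  isotropic-rewiring {A} (_ , _ , A-deg) x y (inj₂ none) u v xu yv with A u v in eq | adj G u v in eq′
  ... | false | false = refl
  ... | _     | true  = ⊥-elim (none u v xu yv (≡⇒T eq′))
  ... | true  | false = ⊥-elim (none u v xu yv (≡⇒T (∧-left (#-full {p = λ w → adj G u w ∧ cell y w} {λ w → A u w ∧ cell y w}
      (λ w h → ⊥-elim (none u w xu (cell⁻ (∧-right {adj G u w} h)) (≡⇒T (∧-left h))))
      (ℕₚ.≤-reflexive (A-deg u y)) v (∧-true eq (cell⁺ yv))))))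

  homogeneous-rewiring : ∀ {A} → Rewiring A → ∀ x → Homogeneous x → ∀ u v → x ∼ u → x ∼ v → A u v ≡ adj G u v
  homogeneous-rewiring R x (inj₂ none) u v xu xv = isotropic-rewiring R x x (inj₂ none) u v xu xv
  homogeneous-rewiring {A} (A-sym , A-irrefl , A-deg) x (inj₁ full) u v xu xv with u Finₚ.≟ v
  ... | yes refl = trans (A-irrefl u) (≡sym (irrefl G u))
  ... | no u≢v   = trans
    (∧-left (#-full {p = λ w → A u w ∧ cell x w} {λ w → adj G u w ∧ cell x w}
      (λ w h → ∧-true (T⇒≡ (full u w xu (cell⁻ (∧-right {A u w} h)) λ { refl → true≢false (∧-left h) (A-irrefl u) })) (∧-right {A u w} h))
      (ℕₚ.≤-reflexive (≡sym (A-deg u x))) v (∧-true (T⇒≡ (full u v xu xv u≢v)) (cell⁺ xv))))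
    (≡sym (T⇒≡ (full u v xu xv u≢v)))

  -- Isomorphisms onto rewirings are composed of such permutations, one cell at a time; the twists
  -- in the necessity of C to F are of this kind too.
  record LocalPerm (x : V) : Set where
    field
      perm    : V ↔ V
      fixes   : ∀ v → ¬ x ∼ v → Inverse.to perm v ≡ v
      inside  : ∀ v → x ∼ v → x ∼ Inverse.to perm v
    act : V → V
    act = Inverse.to perm
    cellwise : CellPreserving perm
    cellwise v with x ∼? v
    ... | yes xv = ≈-trans (≈-sym xv) (inside v xv)
    ... | no ¬xv = subst (λ w → v ∼ w) (≡sym (fixes v ¬xv)) ≈-refl

  idLocal : ∀ x → LocalPerm x
  idLocal x = record { perm = Perm.id ; fixes = λ _ _ → refl ; inside = λ _ xv → xv }

  module _ {A : Set} {x : V} {h h′ : A → V} where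

    move : Enum (cell x) h → V → V
    move P v with x ∼? v
    ... | yes xv = h′ (proj₁ (Enum-index P v (cell⁺ xv)))
    ... | no _   = v

    move-enum : ∀ P t → move P (h t) ≡ h′ t
    move-enum P t with x ∼? h t
    ... | yes xt = cong h′ (proj₁ P (proj₂ (Enum-index P (h t) (cell⁺ xt))))
    ... | no ¬xt = ⊥-elim (¬xt (cell⁻ (Enum-∈ P t)))

    move-fixes : ∀ P v → ¬ x ∼ v → move P v ≡ v
    move-fixes P v ¬xv with x ∼? v
    ... | yes xv = ⊥-elim (¬xv xv)
    ... | no _   = refl

  module _ {A : Set} {x : V} {h h′ : A → V} (P : Enum (cell x) h) (Q : Enum (cell x) h′) where

    private
      inverse : ∀ {h h′ : A → V} (P : Enum (cell x) h) (Q : Enum (cell x) h′) v → move {h = h′} {h} Q (move {h = h} {h′} P v) ≡ v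
      inverse {h} {h′} P Q v with x ∼? v
      ... | yes xv = trans (move-enum Q _) (proj₂ (Enum-index P v (cell⁺ xv)))
      ... | no ¬xv = move-fixes Q v ¬xv

    -- Every local permutation used apart from the identity arises from two labellings of one cell
    -- by the same index set.
    relabel : Σ (LocalPerm x) λ τ → ∀ t → LocalPerm.act τ (h t) ≡ h′ t
    relabel = record
      { perm   = permutation (move {h = h} {h′} P) (move {h = h′} {h} Q) (inverse Q P) (inverse P Q)
      ; fixes  = move-fixes P
      ; inside = λ v xv → let t , e = Enum-index P v (cell⁺ xv) in
          subst (x ∼_) (trans (≡sym (move-enum P t)) (cong (move P) e)) (cell⁻ (Enum-∈ Q t))
      } , move-enum P

  -- `x` holds the centres and `y` the leaves, with `t` leaves per centre; for `c = true` this
  -- describes the bipartite complement of G[x, y].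
  record IsStar (c : Bool) (t : ℕ) (x y : V) : Set where
    constructor isStar
    field
      ones   : ∀ v → y ∼ v → dg c (adj G) x v ≡ 1
      spread : ∀ u → x ∼ u → # (λ v → cell y v ∧ (c xor adj G u v)) ≡ t

  IsStar-size : ∀ {c t x y} → IsStar c t x y → size x * t ≡ size y
  IsStar-size {c} {t} {x} {y} (isStar ones spread) = trans
    (double-count (cell x) (cell y) (λ u v → c xor adj G u v) t 1 (λ u h → spread u (cell⁻ h)) (λ v h → ones v (cell⁻ h)))
    (ℕₚ.*-identityʳ (size y))

  spread-const : ∀ c x y u → x ∼ u → # (λ v → cell y v ∧ (c xor adj G u v)) ≡ dg c (adj G) y x
  spread-const c x y u xu = trans (dg-sym c (Graph.sym G) y u) (≡sym (dg-const c y xu))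

  ones⇒star : ∀ {c x y} → (∀ v → y ∼ v → dg c (adj G) x v ≡ 1) → IsStar c (dg c (adj G) y x) x y
  ones⇒star {c} {x} {y} ones = isStar ones λ u xu → spread-const c x y u xu

  -- If instead each vertex of x sees exactly one vertex of y, then |x| = |y| t ≥ |x| t forces t = 1.
  flipped-ones : ∀ {c x y} → (∀ u → x ∼ u → dg c (adj G) y u ≡ 1) → size x ≤ size y → ∀ v → y ∼ v → dg c (adj G) x v ≡ 1
  flipped-ones {c} {x} {y} ones le v yv = trans (≡sym (dg-const c x yv)) (one (dg c (adj G) x y) count)
    where
    count : size x ≡ size y * dg c (adj G) x y
    count = trans (≡sym (ℕₚ.*-identityʳ (size x))) (double-count (cell x) (cell y) (λ u v → c xor adj G u v) 1 (dg c (adj G) x y)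
      (λ u h → trans (dg-sym c (Graph.sym G) y u) (ones u (cell⁻ h))) (λ v h → ≡sym (dg-const c x (cell⁻ h))))
    one : ∀ t → size x ≡ size y * t → t ≡ 1
    one zero e = contradiction (trans e (ℕₚ.*-zeroʳ (size y))) (ℕₚ.>⇒≢ (size-positive x))
    one (suc zero) e = refl
    one (suc (suc t)) e = contradiction le (ℕₚ.<⇒≱ (begin-strict
      size y                          <⟨ ℕₚ.m<m+n (size y) (size-positive y) ⟩
      size y + size y                 ≤⟨ ℕₚ.+-monoʳ-≤ (size y) (ℕₚ.m≤m*n (size y) (suc t)) ⟩
      size y + size y * suc t         ≡⟨ ℕₚ.*-suc (size y) (suc t) ⟨
      size y * suc (suc t)            ≡⟨ e ⟨
      size x                          ∎))
      where open ℕₚ.≤-Reasoning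

  -- The smaller cell can always serve as the set of centres: if B puts the centres into `y`, the
  -- sizes force the stars to be single edges, and the roles may be swapped by `flipped-ones`.
  star : CondB → ∀ x y → ¬ x ∼ y → Anisotropic x y → size x ≤ size y → ∃ λ c → ∃ λ t → IsStar c t x y
  star B x y x≁y aniso le with B x y x≁y
  ... | inj₁ empty = ⊥-elim (aniso (inj₂ empty))
  ... | inj₂ (inj₁ full) = ⊥-elim (aniso (inj₁ full))
  ... | inj₂ (inj₂ (inj₁ (_ , _ , f , g , P , Q , fg))) = false , _ , ones⇒star λ v yv →
    star-ones (adj G) (Enumerates⇒Enum P) (Enumerates⇒Enum Q)
      (λ i b → mk⇔ (λ h → Equivalence.to (fg i b) (≡⇒T h)) (λ h → T⇒≡ (Equivalence.from (fg i b) h))) v (cell⁺ yv)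
  ... | inj₂ (inj₂ (inj₂ (inj₁ (_ , _ , f , g , P , Q , fg)))) = false , _ , ones⇒star (flipped-ones {false} (λ u xu →
    star-ones (adj G) (Enumerates⇒Enum P) (Enumerates⇒Enum Q)
      (λ i b → mk⇔ (λ h → Equivalence.to (fg i b) (≡⇒T h)) (λ h → T⇒≡ (Equivalence.from (fg i b) h))) u (cell⁺ xu)) le)
  ... | inj₂ (inj₂ (inj₂ (inj₂ (inj₁ (_ , _ , f , g , P , Q , fg))))) = true , _ , ones⇒star λ v yv →
    star-ones (λ u v → not (adj G u v)) (Enumerates⇒Enum P) (Enumerates⇒Enum Q) (λ i b → co-iff (fg i b)) v (cell⁺ yv)
  ... | inj₂ (inj₂ (inj₂ (inj₂ (inj₂ (_ , _ , f , g , P , Q , fg))))) = true , _ , ones⇒star (flipped-ones {true} (λ u xu →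
    star-ones (λ u v → not (adj G u v)) (Enumerates⇒Enum P) (Enumerates⇒Enum Q) (λ i b → co-iff (fg i b)) u (cell⁺ xu)) le)

  -- For a matching (`c = false`) and for the complement of one (`c = true`) alike, this is the
  -- perfect matching behind the cell. The diagonal is removed because it would otherwise belong to
  -- the complement.
  pairing : Bool → (V → V → Bool) → V → V → Bool
  pairing c A u v = (c xor A u v) ∧ not (does (u Finₚ.≟ v))

  pairing⁻ : ∀ c (A : V → V → Bool) {u v} → u ≢ v → pairing c A u v ≡ c xor A u v
  pairing⁻ c A {u} {v} ne = trans (cong (λ z → (c xor A u v) ∧ not z) (dec-false (u Finₚ.≟ v) ne)) (Boolₚ.∧-identityʳ _)

  pairing-irrefl : ∀ c (A : V → V → Bool) u → pairing c A u u ≡ false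
  pairing-irrefl c A u = trans (cong (λ z → (c xor A u u) ∧ not z) (dec-true (u Finₚ.≟ u) refl)) (Boolₚ.∧-zeroʳ _)

  pairing-sym : ∀ c {A : V → V → Bool} → (∀ u v → A u v ≡ A v u) → ∀ u v → pairing c A u v ≡ pairing c A v u
  pairing-sym c A-sym u v = cong₂ (λ a b → (c xor a) ∧ not b) (A-sym u v)
    (bool-iff (λ h → dec-true (v Finₚ.≟ u) (≡sym (dec-true⁻ (u Finₚ.≟ v) h))) (λ h → dec-true (u Finₚ.≟ v) (≡sym (dec-true⁻
        (v Finₚ.≟ u) h))))

  -- Neither graph has loops, so the diagonal contributes equally to both counts and can be
  -- subtracted.
  pairing-rewiring : ∀ c {A} → Rewiring A → ∀ x u → # (λ v → cell x v ∧ pairing c A u v) ≡ # (λ v → cell x v ∧ pairing c (adj G) u v)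
  pairing-rewiring c {A} R@(A-sym , A-irrefl , _) x u = trans (#-cong (λ v → ≡sym (Boolₚ.∧-assoc (cell x v) _ _)))
    (trans off-diagonal (#-cong (λ v → Boolₚ.∧-assoc (cell x v) _ _)))
    where
    diagonal : # (λ v → (cell x v ∧ (c xor A u v)) ∧ does (u Finₚ.≟ v)) ≡ # (λ v → (cell x v ∧ (c xor adj G u v)) ∧ does (u Finₚ.≟ v))
    diagonal = #-cong λ v → pt v
      where
      pt : ∀ v → (cell x v ∧ (c xor A u v)) ∧ does (u Finₚ.≟ v) ≡ (cell x v ∧ (c xor adj G u v)) ∧ does (u Finₚ.≟ v)
      pt v with u Finₚ.≟ v
      ... | yes refl = cong (λ z → (cell x u ∧ (c xor z)) ∧ true) (trans (A-irrefl u) (≡sym (irrefl G u)))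
      ... | no _     = trans (Boolₚ.∧-zeroʳ _) (≡sym (Boolₚ.∧-zeroʳ _))
    off-diagonal : # (λ v → (cell x v ∧ (c xor A u v)) ∧ not (does (u Finₚ.≟ v))) ≡ # (λ v → (cell x v ∧ (c xor adj G u v)) ∧
        not (does (u Finₚ.≟ v)))
    off-diagonal = ℕₚ.+-cancelˡ-≡ (# (λ v → (cell x v ∧ (c xor A u v)) ∧ does (u Finₚ.≟ v))) _ _
      (trans (#-split _ (λ v → does (u Finₚ.≟ v))) (trans (dg-sym c A-sym x u) (trans (dg-rewiring R c x u) (trans (≡sym
          (dg-sym c (Graph.sym G) x u))
        (trans (≡sym (#-split _ (λ v → does (u Finₚ.≟ v)))) (cong (_+ _) (≡sym diagonal)))))))

  Paired : Bool → V → ∀ m → (Fin m × Fin 2 → V) → Set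
  Paired c x m f = Enum (cell x) f × (∀ a b → pairing c (adj G) (f a) (f b) ≡ true ⇔ Matched m a b)

  data Structure (x : V) : Set where
    paired    : ∀ c m f → Paired c x m f → Structure x
    pentagon  : ∀ (f : Fin 5 → V) → Enum (cell x) f → (∀ i j → adj G (f i) (f j) ≡ does (FiveCycle.adjacent? i j)) → Structure x

  next≡ : ∀ i → suc5 i ≡ FiveCycle.next i
  next≡ 0F = refl
  next≡ 1F = refl
  next≡ 2F = refl
  next≡ 3F = refl
  next≡ 4F = refl
  to-next : ∀ i j → j ≡ suc5 i ⊎ i ≡ suc5 j → j ≡ FiveCycle.next i ⊎ i ≡ FiveCycle.next j
  to-next i j (inj₁ e) = inj₁ (trans e (next≡ i))
  to-next i j (inj₂ e) = inj₂ (trans e (next≡ j))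
  from-next : ∀ i j → j ≡ FiveCycle.next i ⊎ i ≡ FiveCycle.next j → j ≡ suc5 i ⊎ i ≡ suc5 j
  from-next i j (inj₁ e) = inj₁ (trans e (≡sym (next≡ i)))
  from-next i j (inj₂ e) = inj₂ (trans e (≡sym (next≡ j)))

  structure : CondA → ∀ x → Heterogeneous x → Structure x
  structure A x het with A x
  ... | inj₁ empty = ⊥-elim (het (inj₂ empty))
  ... | inj₂ (inj₁ full) = ⊥-elim (het (inj₁ full))
  ... | inj₂ (inj₂ (inj₁ (m , f , P , ff))) = paired false m f (Enumerates⇒Enum P , λ a b → mk⇔
    (λ h → Equivalence.to (ff a b) (≡⇒T (∧-left h)))
    (λ M → trans (pairing⁻ false (adj G) (λ e → proj₂ M (cong proj₂ (proj₁ P e)))) (T⇒≡ (Equivalence.from (ff a b) M))))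
  ... | inj₂ (inj₂ (inj₂ (inj₁ (m , f , P , ff)))) = paired true m f (Enumerates⇒Enum P , λ a b → mk⇔ (fwd a b) (bwd a b))
    where
    fwd : ∀ a b → pairing true (adj G) (f a) (f b) ≡ true → Matched m a b
    fwd (a , i) (b , j) h with a Finₚ.≟ b
    ... | yes refl = refl , λ { refl → true≢false h (pairing-irrefl true (adj G) (f (a , i))) }
    ... | no ne    = true≢false (T⇒≡ (Equivalence.from (ff (a , i) (b , j)) ne)) (not-true⁻ (∧-left h))
    bwd : ∀ a b → Matched m a b → pairing true (adj G) (f a) (f b) ≡ true
    bwd (a , i) (b , j) (refl , ne) with adj G (f (a , i)) (f (a , j)) in eq
    ... | true  = ⊥-elim (Equivalence.to (ff (a , i) (a , j)) (≡⇒T eq) refl)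
    ... | false = not-true (dec-false (f (a , i) Finₚ.≟ f (a , j)) λ e → ne (cong proj₂ (proj₁ P e)))
  ... | inj₂ (inj₂ (inj₂ (inj₂ (f , P , ff)))) = pentagon f (Enumerates⇒Enum P) λ i j → bool-iff
    (λ h → dec-true (FiveCycle.adjacent? i j) (to-next i j (Equivalence.to (ff i j) (≡⇒T h))))
    (λ h → T⇒≡ (Equivalence.from (ff i j) (from-next i j (dec-true⁻ (FiveCycle.adjacent? i j) h))))

  paired-ones : ∀ {c x m f} → Paired c x m f → ∀ u → x ∼ u → # (λ v → cell x v ∧ pairing c (adj G) u v) ≡ 1
  paired-ones {c} {x} {m} {f} (P , M) u xu with (a , i) , refl ← Enum-index P u (cell⁺ xu) =
    #-single _ (f (a , other i)) (∧-true (Enum-∈ P _) (Equivalence.from (M (a , i) (a , other i)) (refl , other-≢ i))) only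
    where
    only : ∀ w → cell x w ∧ pairing c (adj G) (f (a , i)) w ≡ true → f (a , other i) ≡ w
    only w h with (b , j) , refl ← Enum-index P w (∧-left h)
      with refl , ne ← Equivalence.to (M (a , i) (b , j)) (∧-right {cell x w} h) = cong (λ z → f (a , z)) (≡sym (≢⇒other i j ne))

  relabel-rewiring : ∀ {A : Set} {x} {h h′ : A → V} (R : V → V → Bool) → Enum (cell x) h → Enum (cell x) h′ →
    (∀ a b → adj G (h a) (h b) ≡ R (h′ a) (h′ b)) →
    Σ (LocalPerm x) λ τ → ∀ u v → x ∼ u → x ∼ v → adj G u v ≡ R (LocalPerm.act τ u) (LocalPerm.act τ v)
  relabel-rewiring {x = x} {h} {h′} R P Q e with τ , τh ← relabel P Q = τ , λ u v xu xv →
    let a , ha = Enum-index P u (cell⁺ xu)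
        b , hb = Enum-index P v (cell⁺ xv)
        t = LocalPerm.act τ in
    trans (cong₂ (adj G) (≡sym ha) (≡sym hb)) (trans (e a b)
      (cong₂ R (trans (≡sym (τh a)) (cong t ha)) (trans (≡sym (τh b)) (cong t hb))))

  deg-enum : ∀ {x k} {f : Fin k → V} → Enum (cell x) f → ∀ (B : V → V → Bool) u → deg B u x ≡ # (λ j → B u (f j))
  deg-enum P B u = trans (#-cong (λ v → Boolₚ.∧-comm (B u v) _)) (#-reindex P (B u))

  -- A perfect matching, the complement of one and the five-cycle are determined by order and
  -- degree, and a rewiring keeps the degrees. Both graphs are brought to the same normal form, and
  -- the labels are compared.
  structure-rewiring : ∀ {A} → Rewiring A → ∀ x → Structure x →
    Σ (LocalPerm x) λ τ → ∀ u v → x ∼ u → x ∼ v → adj G u v ≡ A (LocalPerm.act τ u) (LocalPerm.act τ v)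
  structure-rewiring {A} R@(A-sym , A-irrefl , A-deg) x (paired c m f (P , M))
    with m′ , h , Q , N ← matching-enum (cell x) (pairing c A) (pairing-sym c A-sym) (pairing-irrefl c A)
      (λ u xu → trans (pairing-rewiring c R x u) (paired-ones {c} (P , M) u (cell⁻ xu)))
    with refl ← ℕₚ.*-cancelʳ-≡ m m′ 2 (trans (Enum-×-# P) (≡sym (Enum-×-# Q)))
    = relabel-rewiring A P Q same
    where
    same : ∀ a b → adj G (f a) (f b) ≡ A (h a) (h b)
    same a b with f a Finₚ.≟ f b
    ... | yes e = trans (trans (cong (adj G (f a)) (≡sym e)) (irrefl G (f a)))
                    (trans (≡sym (A-irrefl (h a))) (cong (λ z → A (h a) (h z)) (proj₁ P e)))
    ... | no ne = xor-cancelˡ c (trans (≡sym (pairing⁻ c (adj G) ne)) (trans step (pairing⁻ c A λ e → ne (cong f (proj₁ Q e)))))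
      where
      step : pairing c (adj G) (f a) (f b) ≡ pairing c A (h a) (h b)
      step = bool-iff (λ e → Equivalence.from (N a b) (Equivalence.to (M a b) e)) (λ e → Equivalence.from (M a b)
          (Equivalence.to (N a b) e))
  structure-rewiring {A} R@(A-sym , A-irrefl , A-deg) x (pentagon f P M)
    with π , π-inj , Aπ ← FiveCycle.unique (λ i j → A (f i) (f j)) (λ i j → A-sym _ _) (λ i → A-irrefl _)
      (λ i → trans (≡sym (deg-enum P A (f i))) (trans (A-deg (f i) x) (trans (deg-enum P (adj G) (f i)) (trans (#-cong (M i))
          (FiveCycle.two-neighbours i)))))
    = relabel-rewiring A P (Enum-from-injection {f = f ∘ π} (λ e → π-inj (proj₁ P e)) (λ i → Enum-∈ P (π i)) (≡sym (Enum-# P)))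
        (λ i j → trans (M i j) (≡sym (Aπ i j)))

  cell-rewiring : CondA → ∀ {A} → Rewiring A → ∀ x →
    Σ (LocalPerm x) λ τ → ∀ u v → x ∼ u → x ∼ v → adj G u v ≡ A (LocalPerm.act τ u) (LocalPerm.act τ v)
  cell-rewiring A R x with homogeneous? x
  ... | yes hom = idLocal x , λ u v xu xv → ≡sym (homogeneous-rewiring R x hom u v xu xv)
  ... | no het  = structure-rewiring R x (structure A x het)

-- Anisotropic paths

all-reverse : ∀ {A : Set} {P : A → Set} {xs} → All P xs → All P (reverse xs)
all-reverse [] = []
all-reverse {P = P} {x ∷ xs} (h ∷ hs) = subst (All P) (≡sym (Listₚ.unfold-reverse x xs)) (Allₚ.∷ʳ⁺ (all-reverse hs) h)

module PathTheory (G : Graph) (s : ℕ) (st : IsStable G s) where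

  open CellTheory G s st public

  Everywhere : V → Bool
  Everywhere _ = true

  Closed : (V → Bool) → Set
  Closed S = ∀ u v → u ∼ v → S u ≡ true → S v ≡ true

  lastOf-∷ʳ : ∀ (x : V) ys z → lastOf x (ys ∷ʳ z) ≡ z
  lastOf-∷ʳ x []       z = refl
  lastOf-∷ʳ x (y ∷ ys) z = lastOf-∷ʳ y ys z

  all-last : ∀ {P : V → Set} y ys → All P (y ∷ ys) → P (lastOf y ys)
  all-last y []       (h ∷ _) = h
  all-last y (x ∷ ys) (_ ∷ h) = all-last x ys h

  path-tail : ∀ {x xs} → AnisoPath (x ∷ xs) → AnisoPath xs
  path-tail (_ ∷ ap , [-])    = ap , []
  path-tail (_ ∷ ap , _ ∷ lk) = ap , lk

  path-prefix : ∀ xs ys → AnisoPath (xs ++ ys) → AnisoPath xs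
  path-prefix xs ys (ap , lk) = pairs xs ap , linked xs lk
    where
    pairs : ∀ xs → AllPairs (λ a b → ¬ a ∼ b) (xs ++ ys) → AllPairs (λ a b → ¬ a ∼ b) xs
    pairs []       _        = []
    pairs (x ∷ xs) (h ∷ ap) = Allₚ.++⁻ˡ xs h ∷ pairs xs ap
    linked : ∀ xs → Linked Anisotropic (xs ++ ys) → Linked Anisotropic xs
    linked []           _        = []
    linked (x ∷ [])     _        = [-]
    linked (x ∷ y ∷ xs) (h ∷ lk) = h ∷ linked (y ∷ xs) lk

  path-from-last : ∀ y ys zs → AnisoPath (y ∷ ys ++ zs) → AnisoPath (lastOf y ys ∷ zs)
  path-from-last y []       zs p = p
  path-from-last y (x ∷ ys) zs p = path-from-last x ys zs (path-tail p)

  path-snoc : ∀ x xs z → AnisoPath (x ∷ xs) → All (λ a → ¬ a ∼ z) (x ∷ xs) → Anisotropic (lastOf x xs) z → AnisoPath (x ∷ xs ∷ʳ z)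
  path-snoc x []       z (_ ∷ _ , _) (h ∷ []) e = (h ∷ []) ∷ [] ∷ [] , e ∷ [-]
  path-snoc x (y ∷ xs) z (a ∷ ap , l ∷ lk) (h ∷ hs) e with ap′ , lk′ ← path-snoc y xs z (ap , lk) hs e =
    Allₚ.∷ʳ⁺ a h ∷ ap′ , l ∷ lk′

  lastOf-reverse : ∀ (r x : V) xs → lastOf r (reverse (x ∷ xs)) ≡ x
  lastOf-reverse r x xs = trans (cong (lastOf r) (Listₚ.unfold-reverse x xs)) (lastOf-∷ʳ r (reverse xs) x)

  path-reverse : ∀ xs → AnisoPath xs → AnisoPath (reverse xs)
  path-reverse []       p = p
  path-reverse (x ∷ xs) p@(h ∷ _ , _) = subst AnisoPath (≡sym (Listₚ.unfold-reverse x xs))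
    (append (reverse xs) (path-reverse xs (path-tail p)) (all-reverse (All.map (λ a≁b e → a≁b (≈-sym e)) h)) (joint xs p))
    where
    append : ∀ ys → AnisoPath ys → All (λ a → ¬ a ∼ x) ys → (∀ y ys′ → ys ≡ y ∷ ys′ → Anisotropic (lastOf y ys′) x) → AnisoPath (ys ∷ʳ x)
    append []       _ _ _ = [] ∷ [] , [-]
    append (y ∷ ys) q d e = path-snoc y ys x q d (e y ys refl)
    joint : ∀ xs → AnisoPath (x ∷ xs) → ∀ y ys′ → reverse xs ≡ y ∷ ys′ → Anisotropic (lastOf y ys′) x
    joint (z ∷ xs) (_ , a ∷ _) y ys′ e = subst (λ w → Anisotropic w x) (trans (≡sym (lastOf-reverse y z xs)) (cong (lastOf y) e))
      (aniso-sym {x} {z} a)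

  -- Walks compose and reverse without regard to repeated cells, which paths do not; `erase`
  -- recovers paths. `S` confines the cells visited, and the end is fixed only up to its cell.
  data Walk (S : V → Bool) : V → V → Set where
    stop : ∀ {x z} → S x ≡ true → x ∼ z → Walk S x z
    step : ∀ {x y z} → S x ≡ true → Anisotropic x y → Walk S y z → Walk S x z

  walk-start : ∀ {S x z} → Walk S x z → S x ≡ true
  walk-start (stop h _)   = h
  walk-start (step h _ _) = h

  walk-resp : ∀ {S} → Closed S → ∀ {x x′ z} → x ∼ x′ → Walk S x z → Walk S x′ z
  walk-resp cl e (stop h q)              = stop (cl _ _ e h) (≈-trans (≈-sym e) q)
  walk-resp cl {x} {x′} e (step {y = y} h a w) = step (cl _ _ e h) (aniso-resp {x} {x′} {y} {y} e ≈-refl a) w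

  walk-trans : ∀ {S} → Closed S → ∀ {x y z} → Walk S x y → Walk S y z → Walk S x z
  walk-trans cl (stop h q)   w′ = walk-resp cl (≈-sym q) w′
  walk-trans cl (step h a w) w′ = step h a (walk-trans cl w w′)

  walk-sym : ∀ {S} → Closed S → ∀ {x z} → Walk S x z → Walk S z x
  walk-sym cl (stop h q)   = stop (cl _ _ q h) (≈-sym q)
  walk-sym cl (step {x} {y} h a w) = walk-trans cl (walk-sym cl w) (step (walk-start w) (aniso-sym {x} {y} a) (stop h ≈-refl))

  walk-widen : ∀ {S S′} → (∀ v → S v ≡ true → S′ v ≡ true) → ∀ {x z} → Walk S x z → Walk S′ x z
  walk-widen f (stop h q)   = stop (f _ h) q
  walk-widen f (step h a w) = step (f _ h) a (walk-widen f w)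

  path-walk : ∀ {S} x xs → All (λ v → S v ≡ true) (x ∷ xs) → Linked Anisotropic (x ∷ xs) → All (Walk S x) (x ∷ xs)
  path-walk x []       (h ∷ [])  _        = stop h ≈-refl ∷ []
  path-walk x (y ∷ xs) (h ∷ hs) (a ∷ lk) = stop h ≈-refl ∷ All.map (step h a) (path-walk y xs hs lk)

  Within : (V → Bool) → V → V → Set
  Within S x z = ∃ λ ys → AnisoPath (x ∷ ys ∷ʳ z) × All (λ v → S v ≡ true) (x ∷ ys ∷ʳ z)

  private
    PathTo : (V → Bool) → V → V → Set
    PathTo S x z = ∃ λ l → AnisoPath (x ∷ l) × All (λ v → S v ≡ true) (x ∷ l) × lastOf x l ∼ z

    -- Loop erasure for a new first cell: if the path meets the cell of `x` again, everything up to
    -- that visit is cut off.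
    trim : ∀ S x w l → S x ≡ true → AnisoPath (w ∷ l) → All (λ v → S v ≡ true) (w ∷ l) →
      All (λ v → ¬ x ∼ v) (w ∷ l) ⊎ PathTo S x (lastOf w l)
    trim S x w [] Sx p a with x ∼? w
    ... | yes e = inj₂ ([] , ([] ∷ [] , [-]) , Sx ∷ [] , e)
    ... | no ne = inj₁ (ne ∷ [])
    trim S x w (w′ ∷ l) Sx p@(_ , k ∷ lk) (_ ∷ a) with trim S x w′ l Sx (path-tail p) a
    ... | inj₂ r = inj₂ r
    ... | inj₁ none with x ∼? w
    ...   | yes e = inj₂ (w′ ∷ l , (none ∷ proj₁ (path-tail p) , aniso-resp {w} {x} {w′} {w′} (≈-sym e) ≈-refl k ∷ lk) , Sx ∷ a , ≈-refl)
    ...   | no ne = inj₁ (ne ∷ none)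

    erase′ : ∀ S {x z} → Walk S x z → PathTo S x z
    erase′ S (stop h q) = [] , ([] ∷ [] , [-]) , h ∷ [] , q
    erase′ S (step {x} {y} h a w) with l , p , m , e ← erase′ S w with trim S x y l h p m
    ... | inj₁ none = y ∷ l , (none ∷ proj₁ p , a ∷ proj₂ p) , h ∷ m , e
    ... | inj₂ (l′ , p′ , m′ , e′) = l′ , p′ , m′ , ≈-trans e′ e

  pairs-last : ∀ xs {w} → AllPairs (λ a b → ¬ a ∼ b) (xs ∷ʳ w) → All (λ a → ¬ a ∼ w) xs
  pairs-last []       _        = []
  pairs-last (x ∷ xs) (h ∷ ap) = proj₂ (Allₚ.∷ʳ⁻ h) ∷ pairs-last xs ap

  linked-last : ∀ {R : V → V → Set} x xs {w} → Linked R (x ∷ xs ∷ʳ w) → R (lastOf x xs) w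
  linked-last x []       (h ∷ _)  = h
  linked-last x (y ∷ xs) (_ ∷ lk) = linked-last y xs lk

  -- The path obtained from a walk ends somewhere in the cell of `z`; its last vertex is exchanged
  -- for `z` itself, as `Within` requires.
  erase : ∀ S → Closed S → ∀ {x z} → Walk S x z → x ∼ z ⊎ Within S x z
  erase S cl {x} {z} w with l , p , m , e ← erase′ S w with initLast l
  ... | []        = inj₁ e
  ... | ys ∷ʳ′ w′ = inj₂ (ys , path-snoc x ys z (path-prefix (x ∷ ys) (w′ ∷ []) p)
      (All.map (λ a≁w a∼z → a≁w (≈-trans a∼z (≈-sym w′∼z))) (pairs-last (x ∷ ys) (proj₁ p)))
      (aniso-resp {lastOf x ys} {lastOf x ys} {w′} {z} ≈-refl w′∼z (linked-last x ys (proj₂ p))) ,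
    Allₚ.∷ʳ⁺ (proj₁ (Allₚ.∷ʳ⁻ {xs = x ∷ ys} m)) (cl _ _ w′∼z (proj₂ (Allₚ.∷ʳ⁻ {xs = x ∷ ys} m))))
    where
    w′∼z : w′ ∼ z
    w′∼z = subst (_∼ z) (lastOf-∷ʳ x ys w′) e

  everywhere-closed : Closed Everywhere
  everywhere-closed _ _ _ _ = refl

  everywhere-all : ∀ xs → All (λ v → Everywhere v ≡ true) xs
  everywhere-all []       = []
  everywhere-all (x ∷ xs) = refl ∷ everywhere-all xs

  within-walk : ∀ {S x z} → Within S x z → Walk S x z
  within-walk {S} {x} {z} (ys , p , m) = proj₂ (Allₚ.∷ʳ⁻ {xs = x ∷ ys} (path-walk x (ys ∷ʳ z) m (proj₂ p)))

  conn-walk : ∀ {u v} → Conn u v → Walk Everywhere u v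
  conn-walk (inj₁ e)        = stop refl e
  conn-walk (inj₂ (ys , p)) = within-walk (ys , p , everywhere-all _)

  walk-conn : ∀ {u v} → Walk Everywhere u v → Conn u v
  walk-conn w with erase Everywhere everywhere-closed w
  ... | inj₁ e            = inj₁ e
  ... | inj₂ (ys , p , _) = inj₂ (ys , p)

  -- Cell sizes along anisotropic paths

  Up : List V → Set
  Up = Linked (λ a b → size a ≤ size b)

  up-≥ : ∀ {m} x xs → m ≤ size x → Up (x ∷ xs) → All (λ v → m ≤ size v) (x ∷ xs)
  up-≥ x []       le _        = le ∷ []
  up-≥ x (y ∷ xs) le (h ∷ up) = le ∷ up-≥ y xs (ℕₚ.≤-trans le h) up

  up-≤ : ∀ x xs → Up (x ∷ xs) → All (λ v → size v ≤ size (lastOf x xs)) (x ∷ xs)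
  up-≤ x []       _        = ℕₚ.≤-refl ∷ []
  up-≤ x (y ∷ xs) (h ∷ up) with r@(b ∷ _) ← up-≤ y xs up = ℕₚ.≤-trans h b ∷ r

  up-tail : ∀ {x xs} → Up (x ∷ xs) → Up xs
  up-tail [-]      = []
  up-tail (_ ∷ up) = up

  up-constant : ∀ x xs → Up (x ∷ xs) → Up (reverse (x ∷ xs)) → All (λ v → size v ≡ size x) (x ∷ xs)
  up-constant x xs up down = All.zipWith (λ (a , b) → ℕₚ.≤-antisym b a) (up-≥ x xs ℕₚ.≤-refl up ,
    subst (All (λ v → size v ≤ size x)) (Listₚ.reverse-involutive (x ∷ xs)) (all-reverse (bound (reverse (x ∷ xs)) refl down)))
    where
    bound : ∀ ys → ys ≡ reverse (x ∷ xs) → Up ys → All (λ v → size v ≤ size x) ys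
    bound []       _ _ = []
    bound (y ∷ ys) e u = subst (λ w → All (λ v → size v ≤ size w) (y ∷ ys))
      (trans (cong (lastOf y) e) (lastOf-reverse y x xs)) (up-≤ y ys u)

  module _ (cE : CondE) where

    no-peak : ∀ x y ys z → AnisoPath (x ∷ (y ∷ ys) ∷ʳ z) → size x < size y → All (λ w → size w ≡ size y) ys → ¬ size z < size y
    no-peak x y ys z p lt eq lt′ = proj₁ cE (x , y , ys , z , size y , size x , size z , p , card x ,
      card y ∷ All.map card-subst eq , card z , lt , lt′)

    -- `ys` accumulates the plateau at the height of `y` that follows the ascent from `x`. A descent
    -- at its end is a peak forbidden by E; an ascent starts a new plateau.
    rise : ∀ x y ys zs → AnisoPath (x ∷ y ∷ ys ++ zs) → size x < size y → All (λ w → size w ≡ size y) ys → Up (lastOf y ys ∷ zs)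
    rise x y ys [] p lt eq = [-]
    rise x y ys (z ∷ zs) p lt eq with ℕₚ.<-cmp (size z) (size y)
    ... | tri< lt′ _ _ = ⊥-elim (no-peak x y ys z
            (path-prefix (x ∷ (y ∷ ys) ∷ʳ z) zs (subst AnisoPath (≡sym (Listₚ.∷ʳ-++ (x ∷ y ∷ ys) z zs)) p)) lt eq lt′)
    ... | tri≈ _ z≡y _ = ℕₚ.≤-reflexive (trans last≡ (≡sym z≡y)) ∷ subst (λ w → Up (w ∷ zs)) (lastOf-∷ʳ y ys z)
            (rise x y (ys ∷ʳ z) zs (subst AnisoPath (≡sym (Listₚ.∷ʳ-++ (x ∷ y ∷ ys) z zs)) p) lt (Allₚ.∷ʳ⁺ eq z≡y))
      where
      last≡ : size (lastOf y ys) ≡ size y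
      last≡ = all-last y ys (refl ∷ eq)
    ... | tri> _ _ gt = ℕₚ.<⇒≤ lt′ ∷ rise (lastOf y ys) z [] zs (path-from-last y ys (z ∷ zs) (path-tail p)) lt′ []
      where
      lt′ : size (lastOf y ys) < size z
      lt′ = subst (_< size z) (≡sym (all-last y ys (refl ∷ eq))) gt

    -- The first change of size can only be an ascent, because no cell is below `r`; from there
    -- `rise` takes over.
    up-from-min : ∀ r xs → AnisoPath (r ∷ xs) → All (λ v → size r ≤ size v) xs → Up (r ∷ xs)
    up-from-min r []       p _ = [-]
    up-from-min r (y ∷ ys) p (le ∷ les) with ℕₚ.m≤n⇒m<n∨m≡n le
    ... | inj₁ lt = le ∷ rise r y [] ys p lt []
    ... | inj₂ e  = le ∷ up-from-min y ys (path-tail p) (subst (λ k → All (λ v → k ≤ size v) ys) e les)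

    -- The first change of size cannot be a descent: read backwards, the path would climb from a
    -- smaller cell to a plateau ending in the heterogeneous `r`, against F.
    up-from-hetero : CondF → ∀ r xs → Heterogeneous r → AnisoPath (r ∷ xs) → Up (r ∷ xs)
    up-from-hetero cF r xs het p = go [] xs p []
      where
      go : ∀ ys zs → AnisoPath (r ∷ ys ++ zs) → All (λ w → size w ≡ size r) ys → Up (lastOf r ys ∷ zs)
      go ys [] _ _ = [-]
      go ys (z ∷ zs) p eq with ℕₚ.<-cmp (size z) (size r)
      ... | tri< lt _ _ = ⊥-elim (cF (z , reverse ys , r , size r , size z ,
              subst AnisoPath back (path-reverse (r ∷ ys ∷ʳ z) (path-prefix (r ∷ ys ∷ʳ z) zs (subst AnisoPath (≡sym
                  (Listₚ.∷ʳ-++ (r ∷ ys) z zs)) p))) ,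
              card z , Allₚ.∷ʳ⁺ (all-reverse (All.map card-subst eq)) (card r) , lt , het))
        where
        back : reverse (r ∷ ys ∷ʳ z) ≡ z ∷ reverse ys ∷ʳ r
        back = trans (Listₚ.reverse-++ (r ∷ ys) (z ∷ [])) (cong (z ∷_) (Listₚ.unfold-reverse r ys))
      ... | tri≈ _ z≡r _ = ℕₚ.≤-reflexive (trans (all-last r ys (refl ∷ eq)) (≡sym z≡r)) ∷
              subst (λ w → Up (w ∷ zs)) (lastOf-∷ʳ r ys z)
                (go (ys ∷ʳ z) zs (subst AnisoPath (≡sym (Listₚ.∷ʳ-++ (r ∷ ys) z zs)) p) (Allₚ.∷ʳ⁺ eq z≡r))
      ... | tri> _ _ gt = ℕₚ.<⇒≤ lt′ ∷ rise (lastOf r ys) z [] zs (path-from-last r ys (z ∷ zs) p) lt′ []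
        where
        lt′ : size (lastOf r ys) < size z
        lt′ = subst (_< size z) (≡sym (all-last r ys (refl ∷ eq))) gt

  rotate : ∀ {x xs} → AnisoCycle (x ∷ xs) → AnisoCycle (xs ∷ʳ x)
  rotate {x} {y ∷ ys} (len , p@(h ∷ _ , a ∷ _) , c) = subst (2 ≤_) (≡sym (Listₚ.length-++-sucʳ ys x [])) (subst (λ k → 2 ≤
      suc k) (≡sym (Listₚ.length-++ ys {[]})) (subst (λ k → 2 ≤ suc k) (≡sym (ℕₚ.+-identityʳ _)) len)) ,
    path-snoc y ys x (path-tail p) (All.map (λ x≁b e → x≁b (≈-sym e)) h) c ,
    subst (λ w → Anisotropic w y) (≡sym (lastOf-∷ʳ y ys x)) a

  rotate-by : ∀ pre post → AnisoCycle (pre ++ post) → AnisoCycle (post ++ pre)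
  rotate-by []        post c = subst AnisoCycle (≡sym (Listₚ.++-identityʳ post)) c
  rotate-by (x ∷ pre) post c = subst AnisoCycle (Listₚ.∷ʳ-++ post x pre)
    (rotate-by pre (post ∷ʳ x) (subst AnisoCycle (Listₚ.++-assoc pre post (x ∷ [])) (rotate c)))

  smallest : ∀ x xs → ∃ λ pre → ∃ λ m → ∃ λ post → x ∷ xs ≡ pre ++ m ∷ post × All (λ v → size m ≤ size v) (post ++ pre)
  smallest x [] = [] , x , [] , refl , []
  smallest x (y ∷ ys) with smallest y ys
  ... | pre , m , post , e , le with ℕₚ.≤-total (size m) (size x)
  ...   | inj₁ m≤x = x ∷ pre , m , post , cong (x ∷_) e ,
            Allₚ.++⁺ (Allₚ.++⁻ˡ post le) (m≤x ∷ Allₚ.++⁻ʳ post le)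
  ...   | inj₂ x≤m = [] , x , y ∷ ys , refl , subst (All (λ v → size x ≤ size v)) (≡sym (trans (Listₚ.++-identityʳ (y ∷ ys)) e))
            (All.map (ℕₚ.≤-trans x≤m) (Allₚ.++⁺ (Allₚ.++⁻ʳ post le) (ℕₚ.≤-refl ∷ Allₚ.++⁻ˡ post le)))

  -- Started at a smallest cell, the cycle has nondecreasing sizes in both directions, so all cells
  -- except the first have one size. Then E excludes a smaller first cell and D an equally large
  -- one.
  no-cycle : CondD → CondE → ∀ xs → ¬ AnisoCycle xs
  no-cycle cD cE (x ∷ xs) c with pre , m , post , e , le ← smallest x xs =
    contra (post ++ pre) (rotate-by pre (m ∷ post) (subst AnisoCycle e c)) le
    where
    contra : ∀ ys → AnisoCycle (m ∷ ys) → All (λ v → size m ≤ size v) ys → ⊥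
    contra (y ∷ ys) c@(len , p , a) les@(le ∷ _) = decide (ℕₚ.m≤n⇒m<n∨m≡n le)
      where
      back : AnisoPath (m ∷ reverse (y ∷ ys))
      back = subst AnisoPath (Listₚ.reverse-++ (y ∷ ys) (m ∷ [])) (path-reverse (y ∷ ys ∷ʳ m) (proj₁ (proj₂ (rotate c))))
      constant : All (λ v → size v ≡ size y) (y ∷ ys)
      constant = up-constant y ys (up-tail (up-from-min cE m (y ∷ ys) p les)) (up-tail (up-from-min cE m (reverse (y ∷ ys))
          back (all-reverse les)))
      decide : size m < size y ⊎ size m ≡ size y → ⊥
      decide (inj₁ lt) = proj₂ cE (m , y ∷ ys , size y , size m , c , card m , All.map card-subst constant , lt)
      decide (inj₂ eq) = cD (m ∷ y ∷ ys , c , size y , card-subst eq ∷ All.map card-subst constant)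

  tree-monotone : CondD → CondE → CondG
  tree-monotone cD cE u = (λ (xs , c , _) → no-cycle cD cE xs c) , λ r (ur , least) ys y p →
    CardLe⁺ (lastOf r ys) y (linked-last r ys (up-from-min cE r (ys ∷ʳ y) p (All.tail (All.map
      (λ {v} w → CardLe⁻ r v (least v (walk-conn (walk-trans everywhere-closed (conn-walk ur) w))))
      (path-walk r (ys ∷ʳ y) (everywhere-all _) (proj₂ p))))))

  -- Sizes do not fall along paths leaving a heterogeneous cell. This makes it smallest in its
  -- component; between two such cells the sizes are nondecreasing from both ends, so the path is
  -- uniform, against C.
  hetero-root : CondC → CondE → CondF → CondH
  hetero-root cC cE cF u = at-most-one , λ r ur het → ur , λ z uz →
    CardLe⁺ r z (least r het z (walk-trans everywhere-closed (walk-sym everywhere-closed (conn-walk ur)) (conn-walk uz)))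
    where
    least : ∀ r → Heterogeneous r → ∀ z → Walk Everywhere r z → size r ≤ size z
    least r het z w with erase Everywhere everywhere-closed w
    ... | inj₁ e = ℕₚ.≤-reflexive (size-cong e)
    ... | inj₂ (ys , p , _) = subst (λ v → size r ≤ size v) (lastOf-∷ʳ r ys z)
      (proj₁ (All.uncons (up-≤ r (ys ∷ʳ z) (up-from-hetero cE cF r (ys ∷ʳ z) het p))))
    at-most-one : ∀ v w → Conn u v → Conn u w → Heterogeneous v → Heterogeneous w → v ∼ w
    at-most-one v w uv uw hv hw
      with erase Everywhere everywhere-closed (walk-trans everywhere-closed (walk-sym everywhere-closed (conn-walk uv)) (conn-walk uw))
    ... | inj₁ e = e
    ... | inj₂ (ys , p , _) = ⊥-elim (cC (v , ys , w , p , (size v , All.map card-subst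
      (up-constant v (ys ∷ʳ w) (up-from-hetero cE cF v (ys ∷ʳ w) hv p)
        (subst Up (≡sym back) (up-from-hetero cE cF w (reverse (v ∷ ys)) hw (subst AnisoPath back (path-reverse (v ∷ ys ∷ʳ w)
            p))))) ) , hv , hw))
      where
      back : reverse (v ∷ ys ∷ʳ w) ≡ w ∷ reverse (v ∷ ys)
      back = Listₚ.reverse-++ (v ∷ ys) (w ∷ [])

-- From the tree conditions to amenability

least-element : ∀ {m} (p : Fin m → Bool) (size : Fin m → ℕ) v → p v ≡ true →
  ∃ λ w → p w ≡ true × (∀ u → p u ≡ true → size w ≤ size u)
least-element p size v pv = go (size v) v pv ℕₚ.≤-refl
  where
  go : ∀ k v → p v ≡ true → size v ≤ k → ∃ λ w → p w ≡ true × (∀ u → p u ≡ true → size w ≤ size u)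
  go k v pv le with Finₚ.any? (λ w → (p w Boolₚ.≟ true) ×-dec (size w <? size v))
  ... | no none = v , pv , λ u pu → ℕₚ.≮⇒≥ λ lt → none (u , pu , lt)
  go zero    v pv le | yes (w , pw , lt) = contradiction (ℕₚ.<-≤-trans lt le) λ ()
  go (suc k) v pv le | yes (w , pw , lt) = go k w pw (ℕₚ.≤-pred (ℕₚ.<-≤-trans lt le))

-- The isomorphism onto a rewiring is built one cell at a time, following each anisotropic component outwards from its
-- root; a new cell then has at most one anisotropic neighbour x among the earlier ones, x is not larger than
-- it, and the new cell is homogeneous. So the stars around the vertices of x can be matched freely.
module Sufficiency (G : Graph) (s : ℕ) (st : IsStable G s) where

  open PathTheory G s st public

  rewiring-∘ : ∀ {A} → Rewiring A → (f : V ↔ V) → CellPreserving f → Rewiring (λ u v → A (Inverse.to f u) (Inverse.to f v))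
  rewiring-∘ {A} (A-sym , A-irrefl , A-deg) f cp = (λ u v → A-sym _ _) , (λ u → A-irrefl _) , λ u y → begin
    # (λ w → A (t u) (t w) ∧ cell y w)       ≡⟨ #-cong (λ w → cong (A (t u) (t w) ∧_) (cell-resp w (t w) (cp w) y)) ⟩
    # (λ w → A (t u) (t w) ∧ cell y (t w))   ≡⟨ #-bijection f (λ w → A (t u) w ∧ cell y w) ⟨
    # (λ w → A (t u) w ∧ cell y w)           ≡⟨ A-deg (t u) y ⟩
    deg (adj G) (t u) y                      ≡⟨ deg-cell u (t u) (cp u) y ⟨
    deg (adj G) u y                          ∎
    where
    open ≡-Reasoning
    t = Inverse.to f

  private
    isotropic-const : ∀ x y → Isotropic x y → ∀ u v v′ → x ∼ u → y ∼ v → y ∼ v′ → adj G u v ≡ adj G u v′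
    isotropic-const x y (inj₁ full) u v v′ xu yv yv′ = trans (T⇒≡ (full u v xu yv)) (≡sym (T⇒≡ (full u v′ xu yv′)))
    isotropic-const x y (inj₂ none) u v v′ xu yv yv′ = bool-iff (λ e → ⊥-elim (none u v xu yv (≡⇒T e))) (λ e → ⊥-elim (none u
        v′ xu yv′ (≡⇒T e)))

    homogeneous-const : ∀ x → Homogeneous x → (f : V → V) → Injective _≡_ _≡_ f → (∀ u → x ∼ u → x ∼ f u) →
      ∀ u v → x ∼ u → x ∼ v → adj G u v ≡ adj G (f u) (f v)
    homogeneous-const x (inj₂ none) f _ in′ u v xu xv = bool-iff (λ e → ⊥-elim (none u v xu xv (≡⇒T e)))
      (λ e → ⊥-elim (none (f u) (f v) (in′ u xu) (in′ v xv) (≡⇒T e)))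
    homogeneous-const x (inj₁ full) f inj in′ u v xu xv with u Finₚ.≟ v
    ... | yes refl = trans (irrefl G u) (≡sym (irrefl G (f u)))
    ... | no ne    = trans (T⇒≡ (full u v xu xv ne)) (≡sym (T⇒≡ (full (f u) (f v) (in′ u xu) (in′ v xv) (λ e → ne (inj e)))))

  Isomorphic : (V → V → Bool) → Set
  Isomorphic A = Σ (V ↔ V) λ f → CellPreserving f × (∀ u v → adj G u v ≡ A (Inverse.to f u) (Inverse.to f v))

  -- Instead of a partial isomorphism, the induction carries a rewiring that already coincides with
  -- G on the settled cells `S`. Each step replaces A by its conjugate under a permutation of the
  -- new cell, and these permutations compose to the isomorphism.
  Agree : (V → Bool) → (V → V → Bool) → Set
  Agree S A = ∀ u v → S u ≡ true → S v ≡ true → adj G u v ≡ A u v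

  Root : V → Set
  Root r = (∀ z → Walk Everywhere r z → size r ≤ size z) × (∀ v → Walk Everywhere r v → Heterogeneous v → v ∼ r)

  -- Every component that `S` meets has its root in `S`, and its settled part is connected inside
  -- `S`. Therefore the path from the root, and any path that would close a cycle, can be chosen to
  -- avoid the cell about to be added.
  record Grown (S : V → Bool) : Set where
    field
      closed    : Closed S
      rooted    : ∀ x → S x ≡ true → ∃ λ r → Root r × S r ≡ true × Walk Everywhere r x
      connected : ∀ x z → S x ≡ true → S z ≡ true → Walk Everywhere x z → Walk S x z

  add : V → (V → Bool) → V → Bool
  add y S v = S v ∨ cell y v

  add⁻ : ∀ y S v → add y S v ≡ true → S v ≡ true ⊎ y ∼ v
  add⁻ y S v h with S v
  ... | true  = inj₁ refl
  ... | false = inj₂ (cell⁻ h)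

  add-old : ∀ y S v → S v ≡ true → add y S v ≡ true
  add-old y S v h = cong (_∨ cell y v) h

  add-new : ∀ y S v → y ∼ v → add y S v ≡ true
  add-new y S v e = trans (cong (S v ∨_) (cell⁺ e)) (Boolₚ.∨-zeroʳ (S v))

  add-closed : ∀ y {S} → Closed S → Closed (add y S)
  add-closed y {S} cl u v e h with add⁻ y S u h
  ... | inj₁ Su = add-old y S v (cl u v e Su)
  ... | inj₂ yu = add-new y S v (≈-trans yu e)

  outside : ∀ {S} → Closed S → ∀ {y} → S y ≡ false → ∀ v → S v ≡ true → ¬ y ∼ v
  outside cl Sy v Sv yv = true≢false (cl v _ (≈-sym yv) Sv) Sy

  agree-add : ∀ {S A y} → Closed S → S y ≡ false → Rewiring A → Agree S A → (τ : LocalPerm y) → let t = LocalPerm.act τ in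
    (∀ u v → S u ≡ true → y ∼ v → adj G u v ≡ A u (t v)) → (∀ u v → y ∼ u → y ∼ v → adj G u v ≡ A (t u) (t v)) →
    Agree (add y S) (λ u v → A (t u) (t v))
  agree-add {S} {A} {y} cl Sy (A-sym , _) ag τ across within u v hu hv with add⁻ y S u hu | add⁻ y S v hv
  ... | inj₁ Su | inj₁ Sv = trans (ag u v Su Sv) (≡sym (cong₂ A (LocalPerm.fixes τ u (outside cl Sy u Su)) (LocalPerm.fixes τ
        v (outside cl Sy v Sv))))
  ... | inj₁ Su | inj₂ yv = trans (across u v Su yv) (cong (λ z → A z _) (≡sym (LocalPerm.fixes τ u (outside cl Sy u Su))))
  ... | inj₂ yu | inj₁ Sv = trans (Graph.sym G u v) (trans (across v u Sv yu)
          (trans (A-sym _ _) (cong (A _) (≡sym (LocalPerm.fixes τ v (outside cl Sy v Sv))))))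
  ... | inj₂ yu | inj₂ yv = within u v yu yv

  isotropic-across : ∀ {A} → Rewiring A → ∀ x y (τ : LocalPerm y) → Isotropic x y → ∀ u v → x ∼ u → y ∼ v →
    adj G u v ≡ A u (LocalPerm.act τ v)
  isotropic-across {A} R x y τ iso u v xu yv = trans (isotropic-const x y iso u v _ xu yv (LocalPerm.inside τ v yv))
    (≡sym (isotropic-rewiring {A} R x y iso u _ xu (LocalPerm.inside τ v yv)))

  module _ (cA : CondA) (cB : CondB) (cG : CondG) (cH : CondH) where

    -- The centres in `x` are settled already, so G and A get the same labels there; within each
    -- star the leaves may be matched arbitrarily.
    star-relabel : ∀ {A} → Rewiring A → ∀ x y → ¬ x ∼ y → Anisotropic x y → size x ≤ size y →
      Σ (LocalPerm y) λ τ → ∀ u v → x ∼ u → y ∼ v → adj G u v ≡ A u (LocalPerm.act τ v)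
    star-relabel {A} R@(A-sym , _) x y x≁y an le
      with c , t , isStar ones spread ← star cB x y x≁y an le
      with f , P ← enumerate (cell x)
      with g , Q , fg ← star-enum {q = cell y} (λ u v → c xor adj G u v) P (λ v h → ones v (cell⁻ h)) (λ u h → spread u (cell⁻ h))
      with g′ , Q′ , fg′ ← star-enum {t = t} {q = cell y} (λ u v → c xor A u v) P
        (λ v h → trans (dg-rewiring R c x v) (ones v (cell⁻ h)))
        (λ u h → trans (dg-sym c A-sym y u) (trans (dg-rewiring R c y u) (trans (≡sym (dg-sym c (Graph.sym G) y u)) (spread u (cell⁻ h)))))
      with τ , τg ← relabel Q Q′ = τ , λ u v xu yv →
        let i , fi = Enum-index P u (cell⁺ xu)
            b , gb = Enum-index Q v (cell⁺ yv) in
        subst₂ (λ u v → adj G u v ≡ A u (LocalPerm.act τ v)) fi gb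
          (trans (xor-cancelˡ c (bool-iff (λ h → Equivalence.from (fg′ i b) (Equivalence.to (fg i b) h))
                                          (λ h → Equivalence.from (fg i b) (Equivalence.to (fg′ i b) h))))
            (cong (A (f i)) (≡sym (τg b))))

    -- `k` bounds the number of unsettled vertices and drops in `extend`; `attach` adds a cell to a
    -- component already begun, `plant` begins a new one.
    grow : ∀ k S → # (λ v → not (S v)) ≤ k → Grown S → ∀ A → Rewiring A → Agree S A → Isomorphic A

    extend : ∀ k S → # (λ v → not (S v)) ≤ k → ∀ A → Rewiring A → ∀ y → S y ≡ false → Grown (add y S) →
      (τ : LocalPerm y) → Agree (add y S) (λ u v → A (LocalPerm.act τ u) (LocalPerm.act τ v)) → Isomorphic A
    extend zero S le A R y Sy gr τ ag = contradiction (#-positive (λ v → not (S v)) y (not-true Sy)) (ℕₚ.≤⇒≯ le)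
    extend (suc k) S le A R y Sy gr τ ag = prepend
      (grow k (add y S) (ℕₚ.≤-pred (ℕₚ.<-≤-trans fewer le)) gr _ (rewiring-∘ {A} R (LocalPerm.perm τ) (LocalPerm.cellwise τ)) ag)
      where
      prepend : Isomorphic (λ u v → A (LocalPerm.act τ u) (LocalPerm.act τ v)) → Isomorphic A
      prepend (f , cp , fa) = (f ∘ₚ LocalPerm.perm τ) , (λ u → ≈-trans (cp u) (LocalPerm.cellwise τ _)) , fa
      fewer : # (λ v → not (add y S v)) < # (λ v → not (S v))
      fewer = #-strict {p = λ v → not (add y S v)} shrink y
        (cong not (add-new y S y ≈-refl)) (not-true Sy)
        where
        shrink : ∀ v → not (S v ∨ cell y v) ≡ true → not (S v) ≡ true
        shrink v h with S v
        ... | false = refl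

    attach : ∀ k S → # (λ v → not (S v)) ≤ k → Grown S → ∀ A → Rewiring A → Agree S A →
      ∀ x y → S x ≡ true → S y ≡ false → Anisotropic x y → Isomorphic A
    attach k S le gr A R ag x y Sx Sy an with r , (r-min , r-het) , Sr , wr ← Grown.rooted gr x Sx =
      extend k S le A R y Sy grown′ τ (agree-add {S} {A} {y} closed Sy R ag τ across within)
      where
      open Grown gr
      x≁y : ¬ x ∼ y
      x≁y e = outside closed Sy x Sx (≈-sym e)
      edge : Walk Everywhere x y
      edge = step refl an (stop refl ≈-refl)
      root-min : MinInComp r r
      root-min = inj₁ ≈-refl , λ z rz → CardLe⁺ r z (r-min z (conn-walk rz))
      -- The path from the root to `x` inside `S` continues to `y`, so condition G compares the last
      -- two sizes. If `x` lies in the root's own cell, minimality of the root is enough.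
      grows : size x ≤ size y
      grows with erase S closed (connected r x Sr Sx wr)
      ... | inj₁ e = subst (_≤ size y) (size-cong e) (r-min y (walk-trans everywhere-closed wr edge))
      ... | inj₂ (ys , p , m) = subst (λ w → size w ≤ size y) (lastOf-∷ʳ r ys x) (CardLe⁻ _ _ (proj₂ (cG r) r root-min (ys ∷ʳ x) y
            (path-snoc r (ys ∷ʳ x) y p (All.map (λ {a} Sa e → outside closed Sy a Sa (≈-sym e)) m)
              (subst (λ w → Anisotropic w y) (≡sym (lastOf-∷ʳ r ys x)) an))))
      -- The root is the only cell of the component that may be heterogeneous, and it is settled.
      y-hom : Homogeneous y
      y-hom with homogeneous? y
      ... | yes h = h
      ... | no h  = ⊥-elim (outside closed Sy r Sr (r-het y (walk-trans everywhere-closed wr edge) h))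
      -- A second anisotropic neighbour of `y` in `S` would close a cycle with a path inside `S`,
      -- which avoids `y`.
      y-iso : ∀ z → S z ≡ true → ¬ x ∼ z → Isotropic z y
      y-iso z Sz x≁z with isotropic? z y
      ... | yes iso = iso
      ... | no an′ with erase S closed (connected x z Sx Sz (walk-trans everywhere-closed edge
                          (step refl (aniso-sym {z} {y} an′) (stop refl ≈-refl))))
      ...   | inj₁ e = ⊥-elim (x≁z e)
      ...   | inj₂ (ys , p , m) = ⊥-elim (proj₁ (cG y) (y ∷ x ∷ ys ∷ʳ z ,
                (s≤s (subst (1 ≤_) (≡sym (Listₚ.length-++-sucʳ ys z [])) (s≤s z≤n)) , cycle ,
                  subst (λ w → Anisotropic w y) (≡sym (lastOf-∷ʳ x ys z)) an′) ,
                All.map walk-conn (path-walk y (x ∷ ys ∷ʳ z) (everywhere-all _) (proj₂ cycle))))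
        where
        cycle : AnisoPath (y ∷ x ∷ ys ∷ʳ z)
        cycle = All.map (λ {a} Sa → outside closed Sy a Sa) m ∷ proj₁ p , aniso-sym {x} {y} an ∷ proj₂ p
      starred : Σ (LocalPerm y) λ τ → ∀ u v → x ∼ u → y ∼ v → adj G u v ≡ A u (LocalPerm.act τ v)
      starred = star-relabel {A} R x y x≁y an grows
      τ : LocalPerm y
      τ = proj₁ starred
      across : ∀ u v → S u ≡ true → y ∼ v → adj G u v ≡ A u (LocalPerm.act τ v)
      across u v Su yv = by (x ∼? u)
        where
        by : Dec (x ∼ u) → adj G u v ≡ A u (LocalPerm.act τ v)
        by (yes xu) = proj₂ starred u v xu yv
        by (no ¬xu) = isotropic-across {A} R u y τ (y-iso u Su ¬xu) u v ≈-refl yv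
      within : ∀ u v → y ∼ u → y ∼ v → adj G u v ≡ A (LocalPerm.act τ u) (LocalPerm.act τ v)
      within u v yu yv = trans (homogeneous-const y y-hom t (↔-injective (LocalPerm.perm τ)) (LocalPerm.inside τ) u v yu yv)
        (≡sym (homogeneous-rewiring {A} R y y-hom (t u) (t v) (LocalPerm.inside τ u yu) (LocalPerm.inside τ v yv)))
        where
        t : V → V
        t = LocalPerm.act τ
      cl′ : Closed (add y S)
      cl′ = add-closed y closed
      anchor : ∀ v → add y S v ≡ true → ∃ λ a → S a ≡ true × Walk (add y S) v a
      anchor v h with add⁻ y S v h
      ... | inj₁ Sv = v , Sv , stop h ≈-refl
      ... | inj₂ yv = x , Sx , step h (aniso-resp {y} {v} {x} {x} yv ≈-refl (aniso-sym {x} {y} an)) (stop (add-old y S x Sx) ≈-refl)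
      wide : ∀ {S : V → Bool} {a b} → Walk S a b → Walk Everywhere a b
      wide = walk-widen λ _ _ → refl
      grown′ : Grown (add y S)
      grown′ = record
        { closed    = cl′
        ; rooted    = λ v h → let a , Sa , w = anchor v h
                                  r , R , Sr , wr = rooted a Sa in
                      r , R , add-old y S r Sr , walk-trans everywhere-closed wr (walk-sym everywhere-closed (wide w))
        ; connected = λ u v hu hv w → let a , Sa , wa = anchor u hu
                                          b , Sb , wb = anchor v hv in
                      walk-trans cl′ wa (walk-trans cl′ (walk-widen (add-old y S) (connected a b Sa Sb
                        (walk-trans everywhere-closed (walk-sym everywhere-closed (wide wa)) (walk-trans everywhere-closed w (wide wb)))))
                        (walk-sym cl′ wb))
        }

    -- No anisotropic edge leaves `S`, so the component of `y` is disjoint from `S`, and G[y] is the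
    -- only constraint on the permutation of `y`.
    plant : ∀ k S → # (λ v → not (S v)) ≤ k → Grown S → ∀ A → Rewiring A → Agree S A →
      (∀ x y → S x ≡ true → S y ≡ false → Isotropic x y) → ∀ y → S y ≡ false → Root y → Isomorphic A
    plant k S le gr A R ag iso y Sy root with τ , within ← cell-rewiring cA {A} R y =
      extend k S le A R y Sy grown′ τ (agree-add {S} {A} {y} closed Sy R ag τ (λ u v Su yv → isotropic-across {A} R u y τ
          (iso u y Su Sy) u v ≈-refl yv) within)
      where
      open Grown gr
      stays : ∀ {u v} → Walk Everywhere u v → S u ≡ true → S v ≡ true
      stays (stop _ e) Su = closed _ _ e Su
      stays (step {u} {v} _ a w) Su with S v in eq
      ... | true  = stays w eq
      ... | false = ⊥-elim (a (iso u v Su eq))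
      grown′ : Grown (add y S)
      grown′ = record
        { closed    = add-closed y closed
        ; rooted    = λ v h → [ (λ Sv → let r , R , Sr , wr = rooted v Sv in r , R , add-old y S r Sr , wr)
                              , (λ yv → y , root , add-new y S y ≈-refl , stop refl yv) ] (add⁻ y S v h)
        ; connected = λ u v hu hv w → joined u v hu hv w
        }
        where
        joined : ∀ u v → add y S u ≡ true → add y S v ≡ true → Walk Everywhere u v → Walk (add y S) u v
        joined u v hu hv w with add⁻ y S u hu | add⁻ y S v hv
        ... | inj₁ Su | inj₁ Sv = walk-widen (add-old y S) (connected u v Su Sv w)
        ... | inj₁ Su | inj₂ yv = ⊥-elim (outside closed Sy v (stays w Su) yv)
        ... | inj₂ yu | inj₁ Sv = ⊥-elim (outside closed Sy u (stays (walk-sym everywhere-closed w) Sv) yu)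
        ... | inj₂ yu | inj₂ yv = stop hu (≈-trans (≈-sym yu) yv)

    grow k S le gr A R ag
      with Finₚ.any? (λ x → Finₚ.any? λ y → (S x Boolₚ.≟ true) ×-dec ((S y Boolₚ.≟ false) ×-dec ¬? (isotropic? x y)))
    ... | yes (x , y , Sx , Sy , an) = attach k S le gr A R ag x y Sx Sy an
    ... | no none = go (Finₚ.any? (λ v → (S v Boolₚ.≟ false) ×-dec ¬? (homogeneous? v))) (Finₚ.any? (λ v → S v Boolₚ.≟ false))
      where
      open Grown gr
      iso : ∀ x y → S x ≡ true → S y ≡ false → Isotropic x y
      iso x y Sx Sy = decidable-stable (isotropic? x y) λ an → none (x , y , Sx , Sy , an)
      stays : ∀ {u v} → Walk Everywhere u v → S u ≡ false → S v ≡ false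
      stays {u} {v} (stop _ e) Su with S v in eq
      ... | false = refl
      ... | true  = true≢false (closed v u (≈-sym e) eq) Su
      stays (step {u} {v} _ a w) Su with S v in eq
      ... | false = stays w eq
      ... | true  = ⊥-elim (a (isotropic-sym {v} {u} (iso v u eq Su)))
      go : Dec (∃ λ v → S v ≡ false × Heterogeneous v) → Dec (∃ λ v → S v ≡ false) → Isomorphic A
      -- Heterogeneous cells come first, since H makes each of them the root of its component; once
      -- none is left, a smallest unsettled cell can serve as a root.
      go (yes (y , Sy , het)) _ = plant k S le gr A R ag iso y Sy
        ((λ z w → CardLe⁻ y z (proj₂ (proj₂ (cH y) y (inj₁ ≈-refl) het) z (walk-conn w))) ,
         λ v w hv → proj₁ (cH y) v y (walk-conn w) (inj₁ ≈-refl) hv het)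
      go (no homs) (yes (v , Sv)) with y , py , least ← least-element (λ v → not (S v)) size v (not-true Sv) =
        plant k S le gr A R ag iso y (not-true⁻ py)
          ((λ z w → least z (not-true (stays w (not-true⁻ py)))) , λ v w hv → ⊥-elim (homs (v , stays w (not-true⁻ py) , hv)))
      go _ (no full) = Perm.id , (λ _ → ≈-refl) , λ u v → ag u v (S-all u) (S-all v)
        where
        S-all : ∀ v → S v ≡ true
        S-all v with S v in eq
        ... | true  = refl
        ... | false = ⊥-elim (full (v , eq))

    tree-conditions⇒rigid : Rigid
    tree-conditions⇒rigid A R = grow (n G) (λ _ → false) (ℕₚ.≤-reflexive (#-all _ (λ _ → refl)))
      (record { closed = λ _ _ _ () ; rooted = λ _ () ; connected = λ _ _ () }) A R λ _ _ ()

-- Regular graphs not determined by their order and degree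

#-⊎ : ∀ {m} (p q : Fin m → Bool) → (∀ v → p v ≡ true → q v ≡ false) → # (λ v → p v ∨ q v) ≡ # p + # q
#-⊎ p q disjoint = trans (sum-cong-≗ λ v → pt (p v) (q v) (disjoint v)) (∑-distrib-+ (λ v → bit (p v)) (λ v → bit (q v)))
  where
  pt : ∀ a b → (a ≡ true → b ≡ false) → bit (a ∨ b) ≡ bit a + bit b
  pt true  true  h with () ← h refl
  pt true  false h = refl
  pt false b     h = refl

pair : ∀ {m} → Fin m → Fin m → Fin m → Bool
pair b c j = does (j Finₚ.≟ b) ∨ does (j Finₚ.≟ c)

pair⁻ : ∀ {m} (b c j : Fin m) → pair b c j ≡ true → j ≡ b ⊎ j ≡ c
pair⁻ b c j h with j Finₚ.≟ b | j Finₚ.≟ c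
... | yes e | _     = inj₁ e
... | no _  | yes e = inj₂ e

pair-left : ∀ {m} (b c : Fin m) → pair b c b ≡ true
pair-left b c = cong (_∨ does (b Finₚ.≟ c)) (dec-true (b Finₚ.≟ b) refl)

pair-right : ∀ {m} (b c : Fin m) → pair b c c ≡ true
pair-right b c = trans (cong (does (c Finₚ.≟ b) ∨_) (dec-true (c Finₚ.≟ c) refl)) (Boolₚ.∨-zeroʳ _)

pair-out : ∀ {m} (b c j : Fin m) → j ≢ b → j ≢ c → pair b c j ≡ false
pair-out b c j j≢b j≢c = cong₂ _∨_ (dec-false (j Finₚ.≟ b) j≢b) (dec-false (j Finₚ.≟ c) j≢c)

#-flip : ∀ {m} (p : Fin m → Bool) {b c} → p b ≡ not (p c) → # (λ j → p j xor pair b c j) ≡ # p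
#-flip p {b} {c} e = trans (≡sym (#-split (λ j → p j xor pair b c j) (pair b c))) (trans (cong₂ _+_ (trans in′ (≡sym in-p))
    out) (#-split p (pair b c)))
  where
  one : ∀ (q : Fin _ → Bool) → q b ≡ not (q c) → # (λ j → q j ∧ pair b c j) ≡ 1
  one q e with q b in eb | q c in ec
  ... | true  | false = #-single _ b (∧-true eb (pair-left b c)) λ w h → [ ≡sym , (λ { refl → true≢false (∧-left h) ec }) ]
        (pair⁻ b c w (∧-right {q w} h))
  ... | false | true  = #-single _ c (∧-true ec (pair-right b c)) λ w h → [ (λ { refl → true≢false (∧-left h) eb }) , ≡sym ]
        (pair⁻ b c w (∧-right {q w} h))
  in-p : # (λ j → p j ∧ pair b c j) ≡ 1
  in-p = one p e
  in′ : # (λ j → (p j xor pair b c j) ∧ pair b c j) ≡ 1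
  in′ = one (λ j → p j xor pair b c j) (trans (cong (p b xor_) (pair-left b c)) (trans (flipped (p b)) (trans (cong not e)
    (≡sym (trans (cong (λ z → not (p c xor z)) (pair-right b c)) (cong not (flipped (p c))))))))
    where
    flipped : ∀ x → x xor true ≡ not x
    flipped true  = refl
    flipped false = refl
  out : # (λ j → (p j xor pair b c j) ∧ not (pair b c j)) ≡ # (λ j → p j ∧ not (pair b c j))
  out = #-cong λ j → pt (p j) (pair b c j)
    where
    pt : ∀ x y → (x xor y) ∧ not y ≡ x ∧ not y
    pt true  true  = refl
    pt true  false = refl
    pt false true  = refl
    pt false false = refl

record Regular (m d : ℕ) (B : Fin m → Fin m → Bool) : Set where
  field
    symmetric   : ∀ i j → B i j ≡ B j i
    irreflexive : ∀ i → B i i ≡ false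
    degree      : ∀ i → # (B i) ≡ d

Isomorphism : ∀ {m} → (Fin m → Fin m → Bool) → (Fin m → Fin m → Bool) → Permutation m m → Set
Isomorphism B B′ π = ∀ i j → B i j ≡ B′ (π ⟨$⟩ʳ i) (π ⟨$⟩ʳ j)

record Ambiguous (m d : ℕ) : Set where
  field
    one two    : Fin m → Fin m → Bool
    one-reg    : Regular m d one
    two-reg    : Regular m d two
    distinct   : ∀ π → ¬ Isomorphism one two π

complement : ∀ {m} → (Fin m → Fin m → Bool) → Fin m → Fin m → Bool
complement B i j = not (B i j) ∧ not (does (i Finₚ.≟ j))

does-≟-sym : ∀ {m} (i j : Fin m) → does (i Finₚ.≟ j) ≡ does (j Finₚ.≟ i)
does-≟-sym i j = bool-iff (λ h → dec-true (j Finₚ.≟ i) (≡sym (dec-true⁻ (i Finₚ.≟ j) h))) (λ h → dec-true (i Finₚ.≟ j) (≡sym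
    (dec-true⁻ (j Finₚ.≟ i) h)))

regular-complement : ∀ {m d d′ B} → d + suc d′ ≡ m → Regular m d B → Regular m d′ (complement B)
regular-complement {m} {d} {d′} {B} e R = record
  { symmetric   = λ i j → cong₂ (λ x y → not x ∧ not y) (symmetric i j) (does-≟-sym i j)
  ; irreflexive = λ i → trans (cong (λ z → not (B i i) ∧ not z) (dec-true (i Finₚ.≟ i) refl)) (Boolₚ.∧-zeroʳ _)
  ; degree      = λ i → ℕₚ.suc-injective (ℕₚ.+-cancelˡ-≡ d _ _ (trans (cong (_+ suc (# (complement B i))) (≡sym (degree i)))
        (trans (total i) (≡sym e))))
  }
  where
  open Regular R
  total : ∀ i → # (B i) + suc (# (complement B i)) ≡ m
  total i = begin
    # (B i) + suc (# (complement B i))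
      ≡⟨ cong (λ z → # (B i) + (z + # (complement B i))) (≡sym (#-single (λ j → not (B i j) ∧ does (i Finₚ.≟ j)) i
           (∧-true (not-true (irreflexive i)) (dec-true (i Finₚ.≟ i) refl)) (λ w h → dec-true⁻ (i Finₚ.≟ w) (∧-right {not (B i w)} h)))) ⟩
    # (B i) + (# (λ j → not (B i j) ∧ does (i Finₚ.≟ j)) + # (complement B i))
      ≡⟨ cong (# (B i) +_) (#-split (λ j → not (B i j)) (λ j → does (i Finₚ.≟ j))) ⟩
    # (B i) + # (λ j → not (B i j))
      ≡⟨ #-split (λ _ → true) (B i) ⟩
    # {m} (λ _ → true)
      ≡⟨ #-all _ (λ _ → refl) ⟩
    m ∎
    where open ≡-Reasoning

ambiguous-complement : ∀ {m d d′} → d + suc d′ ≡ m → Ambiguous m d → Ambiguous m d′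
ambiguous-complement e A = record
  { one = complement one ; two = complement two
  ; one-reg = regular-complement e one-reg ; two-reg = regular-complement e two-reg
  ; distinct = λ π iso → distinct π λ i j → back π iso i j
  }
  where
  open Ambiguous A
  back : ∀ π → Isomorphism (complement one) (complement two) π → Isomorphism one two π
  back π iso i j with i Finₚ.≟ j
  ... | yes refl = trans (Regular.irreflexive one-reg i) (≡sym (Regular.irreflexive two-reg _))
  ... | no ne = Boolₚ.not-injective (trans (≡sym (off one ne)) (trans (iso i j) (off two λ e → ne (↔-injective π e))))
    where
    off : ∀ (B : Fin _ → Fin _ → Bool) {i j} → i ≢ j → complement B i j ≡ not (B i j)
    off B {i} {j} ne = trans (cong (λ z → not (B i j) ∧ not z) (dec-false (i Finₚ.≟ j) ne)) (Boolₚ.∧-identityʳ _)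

-- Splitting each row at the diagonal counts every edge once from either end, so m d is twice the
-- number of edges.
handshake : ∀ {m d B} → Regular m d B → parity (m * d) ≡ 0ℙ
handshake {m} {d} {B} R = begin
  parity (m * d)              ≡⟨ cong parity total ⟩
  parity (half + half)        ≡⟨ Parityₚ.+-homo-+ half half ⟩
  parity half Parity.+ parity half ≡⟨ Parityₚ.p+p≡0ℙ (parity half) ⟩
  0ℙ                          ∎
  where
  open Regular R
  open ≡-Reasoning
  below : Fin m → Fin m → Bool
  below i j = does (i Finₚ.<? j)
  half : ℕ
  half = sum (λ i → # (λ j → B i j ∧ below i j))
  other-half : sum (λ i → # (λ j → B i j ∧ not (below i j))) ≡ half
  other-half = trans (∑-comm (λ i j → bit (B i j ∧ not (below i j)))) (sum-cong-≗ λ j → #-cong λ i → pt i j)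
    where
    pt : ∀ i j → B i j ∧ not (below i j) ≡ B j i ∧ below j i
    pt i j with Finₚ.<-cmp i j
    ... | tri< lt _ ngt = trans (cong (λ z → B i j ∧ not z) (dec-true (i Finₚ.<? j) lt))
          (trans (Boolₚ.∧-zeroʳ _) (≡sym (trans (cong (B j i ∧_) (dec-false (j Finₚ.<? i) ngt)) (Boolₚ.∧-zeroʳ _))))
    ... | tri≈ _ refl _ = trans (cong (_∧ not (below i i)) (irreflexive i)) (≡sym (cong (_∧ below i i) (irreflexive i)))
    ... | tri> nlt _ gt = cong₂ _∧_ (symmetric i j) (trans (cong not (dec-false (i Finₚ.<? j) nlt)) (≡sym (dec-true (j Finₚ.<? i) gt)))
  total : m * d ≡ half + half
  total = begin
    m * d                         ≡⟨ cong (_* d) (≡sym (#-all {m} (λ _ → true) (λ _ → refl))) ⟩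
    # {m} (λ _ → true) * d        ≡⟨ ≡sym (sum-const-on (λ _ → true) (λ i → # (B i)) d (λ i _ → degree i) (λ _ ())) ⟩
    sum (λ i → # (B i))           ≡⟨ sum-cong-≗ (λ i → ≡sym (#-split (B i) (below i))) ⟩
    sum (λ i → # (λ j → B i j ∧ below i j) + # (λ j → B i j ∧ not (below i j)))
                                  ≡⟨ ∑-distrib-+ (λ i → # (λ j → B i j ∧ below i j)) (λ i → # (λ j → B i j ∧ not (below i j))) ⟩
    half + sum (λ i → # (λ j → B i j ∧ not (below i j)))
                                  ≡⟨ cong (half +_) other-half ⟩
    half + half                   ∎

-- For a graph B this is twice the number of triangles at `v`, as the pair (i, j) is ordered.
triangles : ∀ {m} → (Fin m → Fin m → Bool) → Fin m → ℕ
triangles B v = sum (λ i → # (λ j → B v i ∧ (B v j ∧ B i j)))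

triangles-iso : ∀ {m} {B B′ : Fin m → Fin m → Bool} (π : Permutation m m) → Isomorphism B B′ π → ∀ v → triangles B v ≡
    triangles B′ (π ⟨$⟩ʳ v)
triangles-iso {B = B} {B′} π iso v = ≡sym (trans (sum-permute _ π) (sum-cong-≗ λ i → trans
  (#-bijection π (λ j → B′ (π ⟨$⟩ʳ v) (π ⟨$⟩ʳ i) ∧ (B′ (π ⟨$⟩ʳ v) j ∧ B′ (π ⟨$⟩ʳ i) j)))
  (#-cong λ j → ≡sym (cong₂ _∧_ (iso v i) (cong₂ _∧_ (iso v j) (iso i j))))))

-- The switch ab, cd ↦ ac, bd keeps all degrees and destroys the triangle vab.
module Switch {m d} {B : Fin m → Fin m → Bool} (R : Regular m d B) (v a b c e : Fin m)
  (va : B v a ≡ true) (vb : B v b ≡ true) (vc : B v c ≡ false) (ve : B v e ≡ false)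
  (ab : B a b ≡ true) (ce : B c e ≡ true) (ac : B a c ≡ false) (be : B b e ≡ false) where

  open Regular R

  private
    K L : Fin m → Bool
    K = pair a e
    L = pair b c

    flips : Fin m → Fin m → Bool
    flips i j = (K i ∧ L j) ∨ (L i ∧ K j)

    differ : ∀ {i j k l} → B i j ≡ true → B k l ≡ false → i ≡ k → j ≢ l
    differ h h′ refl refl = true≢false h h′

    disjoint : ∀ i → K i ≡ true → L i ≡ false
    disjoint i h with pair⁻ a e i h
    ... | inj₁ refl = pair-out b c a (λ { refl → true≢false ab (irreflexive a) }) (λ { refl → true≢false va vc })
    ... | inj₂ refl = pair-out b c e (λ { refl → true≢false vb ve }) (λ { refl → true≢false ce (irreflexive e) })

  switched : Fin m → Fin m → Bool
  switched i j = B i j xor flips i j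

  private
    sw-sym : ∀ i j → switched i j ≡ switched j i
    sw-sym i j = cong₂ _xor_ (symmetric i j) (trans (Boolₚ.∨-comm (K i ∧ L j) _) (cong₂ _∨_ (Boolₚ.∧-comm (L i) _) (Boolₚ.∧-comm (K i) _)))

    sw-irrefl : ∀ i → switched i i ≡ false
    sw-irrefl i = cong₂ _xor_ (irreflexive i) (trans (cong₂ _∨_ none (trans (Boolₚ.∧-comm (L i) _) none)) refl)
      where
      none : K i ∧ L i ≡ false
      none with K i in eq
      ... | false = refl
      ... | true  = disjoint i eq

    sw-degree : ∀ i → # (switched i) ≡ d
    sw-degree i with K i in k | L i in l
    ... | true  | true  = true≢false l (disjoint i k)
    ... | true  | false = trans (#-cong {p = λ j → B i j xor (L j ∨ false)} {q = λ j → B i j xor L j} λ j → cong (B i j xor_)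
          (Boolₚ.∨-identityʳ _)) (trans (#-flip (B i) (balance (pair⁻ a e i k))) (degree i))
      where
      balance : i ≡ a ⊎ i ≡ e → B i b ≡ not (B i c)
      balance (inj₁ refl) = trans ab (≡sym (not-true ac))
      balance (inj₂ refl) = trans (symmetric e b) (trans be (≡sym (cong not (trans (symmetric e c) ce))))
    ... | false | true  = trans (#-flip (B i) (balance (pair⁻ b c i l))) (degree i)
      where
      balance : i ≡ b ⊎ i ≡ c → B i a ≡ not (B i e)
      balance (inj₁ refl) = trans (symmetric b a) (trans ab (≡sym (not-true be)))
      balance (inj₂ refl) = trans (symmetric c a) (trans ac (≡sym (cong not ce)))
    ... | false | false = trans (#-cong {p = λ j → B i j xor false} {q = B i} λ j → Boolₚ.xor-identityʳ _) (degree i)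

    row-v : ∀ j → switched v j ≡ B v j
    row-v j = trans (cong (λ z → B v j xor z) (cong₂ (λ x y → (x ∧ L j) ∨ (y ∧ K j))
      (pair-out a e v (λ { refl → true≢false va (irreflexive v) }) (λ { refl → true≢false ce (trans (symmetric c v) vc) }))
      (pair-out b c v (λ { refl → true≢false vb (irreflexive v) }) (λ { refl → true≢false ce ve })))) (Boolₚ.xor-identityʳ _)

    in-K : ∀ i → B v i ≡ true → K i ≡ true → i ≡ a
    in-K i h k = [ id , (λ { refl → true≢false h ve }) ] (pair⁻ a e i k)

    in-L : ∀ i → B v i ≡ true → L i ≡ true → i ≡ b
    in-L i h l = [ id , (λ { refl → true≢false h vc }) ] (pair⁻ b c i l)

    -- Of the four switched vertices only a and b are neighbours of v, and the edge ab between them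
    -- is removed; so no triangle at v is created.
    flips-near : ∀ i j → B v i ≡ true → B v j ≡ true → flips i j ≡ true → B i j ≡ true
    flips-near i j vi vj h with K i in k | L j in l | L i in l′ | K j in k′
    ... | true | true | _ | _ = subst₂ (λ x y → B x y ≡ true) (≡sym (in-K i vi k)) (≡sym (in-L j vj l)) ab
    ... | true | false | true | true = subst₂ (λ x y → B x y ≡ true) (≡sym (in-L i vi l′)) (≡sym (in-K j vj k′)) (trans (symmetric b a) ab)
    ... | false | _ | true | true = subst₂ (λ x y → B x y ≡ true) (≡sym (in-L i vi l′)) (≡sym (in-K j vj k′)) (trans (symmetric b a) ab)

    shrink : ∀ i j → switched v i ∧ (switched v j ∧ switched i j) ≡ true → B v i ∧ (B v j ∧ B i j) ≡ true
    shrink i j h = ∧-true vi (∧-true vj (keep (flips i j) refl))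
      where
      vi : B v i ≡ true
      vi = trans (≡sym (row-v i)) (∧-left h)
      vj : B v j ≡ true
      vj = trans (≡sym (row-v j)) (∧-left (∧-right {switched v i} h))
      keep : ∀ x → flips i j ≡ x → B i j ≡ true
      keep true  q = flips-near i j vi vj q
      keep false q = trans (≡sym (Boolₚ.xor-identityʳ _)) (trans (cong (B i j xor_) (≡sym q)) (∧-right {switched v j}
          (∧-right {switched v i} h)))

    ab-flips : flips a b ≡ true
    ab-flips = cong₂ _∨_ (∧-true (pair-left a e) (pair-left b c)) refl

  fewer : triangles switched v < triangles B v
  fewer = sum-strict (λ i → #-mono (shrink i)) a (#-strict (shrink a) b
    (trans (cong (switched v a ∧_) (trans (cong (switched v b ∧_) (cong₂ _xor_ ab ab-flips)) (Boolₚ.∧-zeroʳ _))) (Boolₚ.∧-zeroʳ _))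
    (∧-true va (∧-true vb ab)))

  -- If all vertices of B lie in equally many triangles, `fewer` gives the switched graph a vertex
  -- with a number that does not occur in B.
  ambiguous : (∀ i j → triangles B i ≡ triangles B j) → Ambiguous m d
  ambiguous const = record
    { one = B ; two = switched ; one-reg = R
    ; two-reg = record { symmetric = sw-sym ; irreflexive = sw-irrefl ; degree = sw-degree }
    ; distinct = λ π iso → ℕₚ.<-irrefl (trans (≡sym (trans (triangles-iso {B = B} {switched} π iso (π ⟨$⟩ˡ v))
        (cong (triangles switched) (Perm.inverseʳ π)))) (const (π ⟨$⟩ˡ v) v)) fewer
    }

false-intro : ∀ {b} → ¬ b ≡ true → b ≡ false
false-intro {true}  h = ⊥-elim (h refl)
false-intro {false} h = refl

unsubtract : ∀ n {m o} → m ∸ n ≤ o → m ≤ n + o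
unsubtract n {m} h = ℕₚ.≤-trans (ℕₚ.m≤n+m∸n m n) (ℕₚ.+-monoʳ-≤ n h)

-- Intervals, rotations and circulant graphs

within : ℕ → ℕ → ℕ → Bool
within lo hi x = does (x <? hi) ∧ not (does (x <? lo))

within⁺ : ∀ {lo hi x} → lo ≤ x → x < hi → within lo hi x ≡ true
within⁺ {lo} {hi} {x} l h = ∧-true (dec-true (x <? hi) h) (not-true (dec-false (x <? lo) (ℕₚ.≤⇒≯ l)))

within⁻ : ∀ lo hi x → within lo hi x ≡ true → lo ≤ x × x < hi
within⁻ lo hi x h = ℕₚ.≮⇒≥ (dec-false⁻ (x <? lo) (not-true⁻ (∧-right {does (x <? hi)} h))) , dec-true⁻ (x <? hi) (∧-left h)

#-below : ∀ {m} k → k ≤ m → # {m} (λ j → does (toℕ j <? k)) ≡ k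
#-below {m}     zero    _        = #-none {m} (λ j → does (toℕ j <? 0)) (λ j → dec-false (toℕ j <? 0) λ ())
#-below {suc m} (suc k) (s≤s le) = cong suc (#-below k le)

#-within : ∀ {m} lo hi → lo ≤ hi → hi ≤ m → # {m} (λ j → within lo hi (toℕ j)) ≡ hi ∸ lo
#-within {m} lo hi lo≤hi hi≤m = ≡sym (trans (cong (_∸ lo) (≡sym total)) (ℕₚ.m+n∸m≡n lo _))
  where
  total : lo + # {m} (λ j → within lo hi (toℕ j)) ≡ hi
  total = trans (cong (_+ # {m} (λ j → within lo hi (toℕ j))) (≡sym (trans (#-iff {m} {λ j → does (toℕ j <? hi) ∧ does (toℕ j
      <? lo)} {λ j → does (toℕ j <? lo)}
      (λ j h → ∧-right {does (toℕ j <? hi)} h)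
      (λ j h → ∧-true (dec-true (toℕ j <? hi) (ℕₚ.<-≤-trans (dec-true⁻ (toℕ j <? lo) h) lo≤hi)) h))
      (#-below {m} lo (ℕₚ.≤-trans lo≤hi hi≤m)))))
    (trans (#-split {m} (λ j → does (toℕ j <? hi)) (λ j → does (toℕ j <? lo))) (#-below {m} hi hi≤m))

-- The shift from i to i - 1 modulo m + 1: index 0 goes to the last index and every other one to its
-- predecessor.
rotation : ∀ m → Permutation (suc m) (suc m)
rotation m = Perm.insert zero (fromℕ m) Perm.id

toℕ-punchIn-last : ∀ {m} (i : Fin m) → toℕ (punchIn (fromℕ m) i) ≡ toℕ i
toℕ-punchIn-last zero    = refl
toℕ-punchIn-last (suc i) = cong suc (toℕ-punchIn-last i)

toℕ-rotation-zero : ∀ m → toℕ (rotation m ⟨$⟩ʳ zero) ≡ m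
toℕ-rotation-zero m = Finₚ.toℕ-fromℕ m

toℕ-rotation-suc : ∀ m (i : Fin m) → toℕ (rotation m ⟨$⟩ʳ suc i) ≡ toℕ i
toℕ-rotation-suc m i = trans (cong toℕ (Perm.insert-punchIn zero (fromℕ m) Perm.id i)) (toℕ-punchIn-last i)

rotation-invariant : ∀ {m} (F : Fin (suc m) → ℕ) → (∀ i → F (rotation m ⟨$⟩ʳ i) ≡ F i) → ∀ i → F i ≡ F zero
rotation-invariant {m} F inv = Data.Fin.Induction.<-weakInduction (λ i → F i ≡ F zero) refl λ i e →
  trans (≡sym (inv (suc i))) (trans (cong F (Finₚ.toℕ-injective (trans (toℕ-rotation-suc m i) (≡sym (Finₚ.toℕ-inject₁ i))))) e)

-- `dist-sym` treats the distances j + 1 and (m + 1) - (j + 1) alike. So adjacency depends only on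
-- the cyclic distance, although it is computed from |i - j|, and is invariant under rotation.
module Circulant (m : ℕ) (dist : ℕ → Bool) (dist-zero : dist 0 ≡ false)
  (dist-sym : ∀ j → j < m → dist (suc j) ≡ dist (m ∸ j)) where

  circulant : Fin (suc m) → Fin (suc m) → Bool
  circulant i j = dist ∣ toℕ i - toℕ j ∣

  circulant-sym : ∀ i j → circulant i j ≡ circulant j i
  circulant-sym i j = cong dist (ℕₚ.∣-∣-comm (toℕ i) (toℕ j))

  private
    ρ = rotation m

    wrap : ∀ (j : Fin m) → circulant (ρ ⟨$⟩ʳ zero) (ρ ⟨$⟩ʳ suc j) ≡ circulant zero (suc j)
    wrap j = trans (cong₂ (λ x y → dist ∣ x - y ∣) (toℕ-rotation-zero m) (toℕ-rotation-suc m j))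
      (trans (cong dist (ℕₚ.m≤n⇒∣n-m∣≡n∸m (ℕₚ.<⇒≤ (Finₚ.toℕ<n j)))) (≡sym (dist-sym (toℕ j) (Finₚ.toℕ<n j))))

  rotate-circulant : ∀ i j → circulant i j ≡ circulant (ρ ⟨$⟩ʳ i) (ρ ⟨$⟩ʳ j)
  rotate-circulant zero    zero    = cong dist (≡sym (ℕₚ.∣n-n∣≡0 (toℕ (ρ ⟨$⟩ʳ zero))))
  rotate-circulant zero    (suc j) = ≡sym (wrap j)
  rotate-circulant (suc i) zero    = trans (circulant-sym (suc i) zero) (trans (≡sym (wrap i)) (circulant-sym (ρ ⟨$⟩ʳ zero) (ρ ⟨$⟩ʳ suc i)))
  rotate-circulant (suc i) (suc j) = ≡sym (cong₂ (λ x y → dist ∣ x - y ∣) (toℕ-rotation-suc m i) (toℕ-rotation-suc m j))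

  triangles-const : ∀ B → Isomorphism B B ρ → ∀ i j → triangles B i ≡ triangles B j
  triangles-const B iso i j = trans (at i) (≡sym (at j))
    where
    at : ∀ i → triangles B i ≡ triangles B zero
    at = rotation-invariant (triangles B) (λ i → ≡sym (triangles-iso {B = B} {B} ρ iso i))

  circulant-regular : Regular (suc m) (# {suc m} (λ j → dist (toℕ j))) circulant
  circulant-regular = record
    { symmetric   = circulant-sym
    ; irreflexive = λ i → trans (cong dist (ℕₚ.∣n-n∣≡0 (toℕ i))) dist-zero
    ; degree      = rotation-invariant (λ i → # (circulant i)) λ i →
        trans (#-bijection ρ (circulant (ρ ⟨$⟩ʳ i))) (#-cong λ j → ≡sym (rotate-circulant i j))
    }

  node : ∀ x → x < suc m → Fin (suc m)
  node x lt = fromℕ< lt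

  circulant-node : ∀ x y (p : x < suc m) (q : y < suc m) → circulant (node x p) (node y q) ≡ dist ∣ x - y ∣
  circulant-node x y p q = cong₂ (λ a b → dist ∣ a - b ∣) (Finₚ.toℕ-fromℕ< p) (Finₚ.toℕ-fromℕ< q)

  rotate-complement : ∀ i j → complement circulant i j ≡ complement circulant (ρ ⟨$⟩ʳ i) (ρ ⟨$⟩ʳ j)
  rotate-complement i j = cong₂ (λ x y → not x ∧ not y) (rotate-circulant i j)
    (bool-iff (λ h → dec-true (_ Finₚ.≟ _) (cong (ρ ⟨$⟩ʳ_) (dec-true⁻ (i Finₚ.≟ j) h)))
              (λ h → dec-true (i Finₚ.≟ j) (↔-injective ρ (dec-true⁻ (_ Finₚ.≟ _) h))))

  complement-node-true : ∀ x y (p : x < suc m) (q : y < suc m) → dist ∣ x - y ∣ ≡ false → x ≢ y → complement circulant (node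
      x p) (node y q) ≡ true
  complement-node-true x y p q d ne = ∧-true (not-true (trans (circulant-node x y p q) d))
    (not-true (dec-false (node x p Finₚ.≟ node y q) λ e → ne (trans (≡sym (Finₚ.toℕ-fromℕ< p)) (trans (cong toℕ e) (Finₚ.toℕ-fromℕ< q)))))

  complement-node-false : ∀ x y (p : x < suc m) (q : y < suc m) → dist ∣ x - y ∣ ≡ true → complement circulant (node x p) (node y q) ≡ false
  complement-node-false x y p q d = cong (λ z → not z ∧ not (does (node x p Finₚ.≟ node y q))) (trans (circulant-node x y p q) d)

-- Vertices at cyclic distance at most k are joined, which gives degree 2k. The 3 in `room` stands
-- for the vertex itself and at least two non-neighbours.
module Arcs (m k : ℕ) (k≥1 : 1 ≤ k) (room : k + k + 3 ≤ suc m) where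

  arcs : ℕ → Bool
  arcs x = within 1 (suc k) x ∨ within (suc m ∸ k) (suc m) x

  k+k<m : k + k < suc m
  k+k<m = ℕₚ.<-≤-trans (ℕₚ.m<m+n (k + k) (s≤s z≤n)) room

  k≤m : k ≤ suc m
  k≤m = ℕₚ.≤-trans (ℕₚ.m≤m+n k k) (ℕₚ.<⇒≤ k+k<m)

  arcs-near : ∀ {x} → 1 ≤ x → x ≤ k → arcs x ≡ true
  arcs-near {x} l h = cong (_∨ within (suc m ∸ k) (suc m) x) (within⁺ l (s≤s h))

  arcs-far : ∀ {x} → suc m ≤ x + k → x < suc m → arcs x ≡ true
  arcs-far {x} l h = trans (cong (within 1 (suc k) x ∨_) (within⁺ (ℕₚ.m≤n+o⇒m∸n≤o (suc m) k (subst (suc m ≤_) (ℕₚ.+-comm x k)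
      l)) h)) (Boolₚ.∨-zeroʳ _)

  arcs⁻ : ∀ {x} → arcs x ≡ true → (1 ≤ x × x ≤ k) ⊎ (suc m ≤ x + k × x < suc m)
  arcs⁻ {x} h with within 1 (suc k) x in e
  ... | true  = inj₁ (proj₁ (within⁻ 1 (suc k) x e) , ℕₚ.≤-pred (proj₂ (within⁻ 1 (suc k) x e)))
  ... | false = inj₂ (subst (suc m ≤_) (ℕₚ.+-comm k x) (unsubtract k (proj₁ (within⁻ (suc m ∸ k) (suc m) x h))) , proj₂
        (within⁻ (suc m ∸ k) (suc m) x h))

  arcs-no : ∀ {x} → k < x → x + k < suc m → arcs x ≡ false
  arcs-no k<x x+k<m = false-intro λ h → [ (λ (_ , le) → ℕₚ.<⇒≱ k<x le) , (λ (le , _) → ℕₚ.<⇒≱ x+k<m le) ]′ (arcs⁻ h)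

  arcs-zero : arcs 0 ≡ false
  arcs-zero = false-intro λ h → [ (λ { (() , _) }) , (λ (le , _) → ℕₚ.<⇒≱ k+k<m (ℕₚ.≤-trans le (ℕₚ.m≤m+n k k))) ]′ (arcs⁻ h)

  private
    mirror : ∀ x y → x + y ≡ suc m → 1 ≤ x → 1 ≤ y → arcs x ≡ true → arcs y ≡ true
    mirror x y e x≥1 y≥1 h with arcs⁻ h
    ... | inj₁ (_ , x≤k) = arcs-far (subst (_≤ y + k) (trans (ℕₚ.+-comm y x) e) (ℕₚ.+-monoʳ-≤ y x≤k)) (subst (y <_) e (ℕₚ.m<n+m y x≥1))
    ... | inj₂ (le , _)  = arcs-near y≥1 (ℕₚ.+-cancelˡ-≤ x y k (subst (_≤ x + k) (≡sym e) le))

  arcs-sym : ∀ j → j < m → arcs (suc j) ≡ arcs (m ∸ j)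
  arcs-sym j lt = bool-iff (mirror (suc j) (m ∸ j) total (s≤s z≤n) (ℕₚ.m<n⇒0<n∸m lt))
    (mirror (m ∸ j) (suc j) (trans (ℕₚ.+-comm (m ∸ j) (suc j)) total) (ℕₚ.m<n⇒0<n∸m lt) (s≤s z≤n))
    where
    total : suc j + (m ∸ j) ≡ suc m
    total = cong suc (ℕₚ.m+[n∸m]≡n (ℕₚ.<⇒≤ lt))

  #-arcs : # {suc m} (λ j → arcs (toℕ j)) ≡ k + k
  #-arcs = trans (#-⊎ {suc m} (λ j → within 1 (suc k) (toℕ j)) (λ j → within (suc m ∸ k) (suc m) (toℕ j)) apart)
    (cong₂ _+_ (#-within {suc m} 1 (suc k) (s≤s z≤n) (s≤s (ℕₚ.≤-pred (ℕₚ.≤-trans (s≤s (ℕₚ.m≤m+n k k)) k+k<m))))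
      (trans (#-within {suc m} (suc m ∸ k) (suc m) (ℕₚ.m∸n≤m (suc m) k) ℕₚ.≤-refl) (ℕₚ.m∸[m∸n]≡n k≤m)))
    where
    apart : ∀ (j : Fin (suc m)) → within 1 (suc k) (toℕ j) ≡ true → within (suc m ∸ k) (suc m) (toℕ j) ≡ false
    apart j h = false-intro λ h′ → ℕₚ.<⇒≱ k+k<m (ℕₚ.≤-trans (unsubtract k (proj₁ (within⁻ (suc m ∸ k) (suc m) (toℕ j) h′)))
      (ℕₚ.+-monoʳ-≤ k (ℕₚ.≤-pred (proj₂ (within⁻ 1 (suc k) (toℕ j) h)))))

  open Circulant m arcs arcs-zero arcs-sym public

  arcs-regular : Regular (suc m) (k + k) circulant
  arcs-regular = subst (λ d → Regular (suc m) d circulant) #-arcs circulant-regular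

-- In the circulant with distances up to k, the edges {0, 2} and {k + 2, k + 3} are switched at v = 1.
ambiguous-thick : ∀ m k → 2 ≤ k → k + k + 3 ≤ suc m → Ambiguous (suc m) (k + k)
ambiguous-thick m (suc zero) (s≤s ())
ambiguous-thick m k@(suc (suc l)) k≥2 room = Switch.ambiguous arcs-regular
  (node 1 l1) (node 0 l0) (node 2 l2) (node (2 + k) c) (node (3 + k) e)
  (at 1 0 l1 l0 (arcs-near ℕₚ.≤-refl (s≤s z≤n))) (at 1 2 l1 l2 (arcs-near ℕₚ.≤-refl (s≤s z≤n)))
  (at 1 (2 + k) l1 c near-miss) (at 1 (3 + k) l1 e miss)
  -- The neighbours 0 and 2 of 1 must be adjacent themselves; this needs k ≥ 2 and is what fails for
  -- the cycle.
  (at 0 2 l0 l2 (arcs-near (s≤s z≤n) (s≤s (s≤s z≤n))))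
  (at (2 + k) (3 + k) c e (trans (cong arcs (∣k-1+k∣ k)) (arcs-near ℕₚ.≤-refl (s≤s z≤n))))
  (at 0 (2 + k) l0 c miss) (at 2 (3 + k) l2 e near-miss)
  (triangles-const circulant rotate-circulant)
  where
  open Arcs m k (s≤s z≤n) room
  room′ : 2 + k + k < suc m
  room′ = subst (_≤ suc m) (ℕₚ.+-comm (k + k) 3) room
  e : 3 + k < suc m
  e = ℕₚ.≤-trans (ℕₚ.+-monoʳ-≤ 3 (ℕₚ.+-monoˡ-≤ k {1} {k} (s≤s z≤n))) room′
  c : 2 + k < suc m
  c = ℕₚ.<-trans ℕₚ.≤-refl e
  l0 : 0 < suc m
  l0 = s≤s z≤n
  l2 : 2 < suc m
  l2 = ℕₚ.≤-trans (s≤s (s≤s (s≤s z≤n))) e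
  l1 : 1 < suc m
  l1 = ℕₚ.<-trans ℕₚ.≤-refl l2
  miss : arcs (2 + k) ≡ false
  miss = arcs-no {2 + k} (s≤s (ℕₚ.n≤1+n k)) room′
  near-miss : arcs (1 + k) ≡ false
  near-miss = arcs-no {1 + k} ℕₚ.≤-refl (ℕₚ.<-trans ℕₚ.≤-refl room′)
  at : ∀ x y (p : x < suc m) (q : y < suc m) {b} → arcs ∣ x - y ∣ ≡ b → circulant (node x p) (node y q) ≡ b
  at x y p q h = trans (circulant-node x y p q) h
  ∣k-1+k∣ : ∀ k → ∣ 2 + k - 3 + k ∣ ≡ 1
  ∣k-1+k∣ k = trans (cong ∣ k -_∣ (ℕₚ.+-comm 1 k)) (ℕₚ.∣m-m+n∣≡n k 1)

-- The 2-regular case m ≥ 6 is obtained by switching in the complement of the cycle.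
ambiguous-cycle : ∀ m → 6 ≤ suc m → Ambiguous (suc m) 2
ambiguous-cycle m m≥6 = ambiguous-complement {d = suc m ∸ 3} (ℕₚ.m∸n+n≡m m≥3)
  (Switch.ambiguous (regular-complement (trans (ℕₚ.+-comm 2 (suc (suc m ∸ 3))) (trans (≡sym (ℕₚ.+-suc (suc m ∸ 3) 2))
      (ℕₚ.m∸n+n≡m m≥3))) arcs-regular)
    -- The triangle is formed by 0, 2, 4, pairwise nonadjacent on the cycle. In terms of the cycle,
    -- the edges {0, 1} and {3, 4} give way to {0, 4} and {1, 3}, which splits off the triangle 1,
    -- 2, 3; six vertices leave at least three for the other cycle.
    (node 2 l2) (node 4 l4) (node 0 l0) (node 3 l3) (node 1 l1)
    (complement-node-true 2 4 l2 l4 two λ ()) (complement-node-true 2 0 l2 l0 two λ ())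
    (complement-node-false 2 3 l2 l3 one) (complement-node-false 2 1 l2 l1 one)
    (complement-node-true 4 0 l4 l0 four λ ()) (complement-node-true 3 1 l3 l1 two λ ())
    (complement-node-false 4 3 l4 l3 one) (complement-node-false 0 1 l0 l1 one)
    (triangles-const (complement circulant) rotate-complement))
  where
  open Arcs m 1 ℕₚ.≤-refl (ℕₚ.≤-trans (ℕₚ.n≤1+n 5) m≥6)
  m≥3 : 3 ≤ suc m
  m≥3 = ℕₚ.≤-trans (s≤s (s≤s (s≤s z≤n))) m≥6
  l0 : 0 < suc m
  l0 = s≤s z≤n
  l4 : 4 < suc m
  l4 = ℕₚ.<-trans ℕₚ.≤-refl m≥6
  l3 : 3 < suc m
  l3 = ℕₚ.<-trans ℕₚ.≤-refl l4
  l2 : 2 < suc m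
  l2 = ℕₚ.<-trans ℕₚ.≤-refl l3
  l1 : 1 < suc m
  l1 = ℕₚ.<-trans ℕₚ.≤-refl l2
  one : arcs 1 ≡ true
  one = arcs-near ℕₚ.≤-refl ℕₚ.≤-refl
  two : arcs 2 ≡ false
  two = arcs-no (s≤s (s≤s z≤n)) (ℕₚ.≤-trans (s≤s (s≤s (s≤s (s≤s z≤n)))) m≥6)
  four : arcs 4 ≡ false
  four = arcs-no (s≤s (s≤s z≤n)) m≥6

half : ∀ d → parity d ≡ 0ℙ → ∃ λ k → d ≡ k + k
half zero          _ = 0 , refl
half (suc (suc d)) e with k , refl ← half d e = suc k , cong suc (≡sym (ℕₚ.+-suc k k))

ambiguous-even : ∀ m d → parity d ≡ 0ℙ → 2 ≤ d → d + 3 ≤ m → ¬ (m ≡ 5 × d ≡ 2) → Ambiguous m d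
ambiguous-even (suc m) d e d≥2 room no5 with half d e
ambiguous-even (suc m) _ e () room no5 | 0 , refl
ambiguous-even (suc m) _ e d≥2 room no5 | 1 , refl = ambiguous-cycle m (ℕₚ.≤∧≢⇒< room λ eq → no5 (≡sym eq , refl))
ambiguous-even (suc m) _ e d≥2 room no5 | k@(suc (suc _)) , refl = ambiguous-thick m k (s≤s (s≤s z≤n)) room
ambiguous-even zero d e d≥2 room no5 = contradiction (ℕₚ.≤-trans (ℕₚ.m≤n+m 3 d) room) λ ()

-- For odd d the handshake lemma makes m even, so the complement has even degree m - 1 - d. The two
-- bounds on d exchange roles under complementation, and m = 5 cannot occur there.
ambiguous-regular : ∀ {m d B} → Regular m d B → 2 ≤ d → d + 3 ≤ m → ¬ (m ≡ 5 × d ≡ 2) → Ambiguous m d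
ambiguous-regular {m} {d} R d≥2 room no5 with parity d in pd
... | 0ℙ = ambiguous-even m d pd d≥2 room no5
... | 1ℙ = ambiguous-complement total (ambiguous-even m d′ pd′ d′≥2 room′ λ { (refl , _) → absurd pm })
  where
  absurd : 1ℙ ≡ 0ℙ → ⊥
  absurd ()
  d′ : ℕ
  d′ = m ∸ suc d
  sd≤m : suc d ≤ m
  sd≤m = ℕₚ.≤-trans (ℕₚ.≤-reflexive (ℕₚ.+-comm 1 d)) (ℕₚ.≤-trans (ℕₚ.+-monoʳ-≤ d (s≤s z≤n)) room)
  total : d′ + suc d ≡ m
  total = ℕₚ.m∸n+n≡m sd≤m
  pm : parity m ≡ 0ℙ
  pm = trans (≡sym (trans (cong (parity m Parity.*_) pd) (Parityₚ.*-identityʳ (parity m)))) (trans (≡sym (Parityₚ.*-homo-* m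
      d)) (handshake R))
  psd : parity (suc d) ≡ 0ℙ
  psd = Parityₚ.⁻¹-injective (trans (Parityₚ.suc-homo-⁻¹ d) pd)
  pd′ : parity d′ ≡ 0ℙ
  pd′ = trans (≡sym (trans (cong (parity d′ Parity.+_) psd) (Parityₚ.+-identityʳ (parity d′)))) (trans (≡sym
      (Parityₚ.+-homo-+ d′ (suc d))) (trans (cong parity total) pm))
  d′≥2 : 2 ≤ d′
  d′≥2 = ℕₚ.+-cancelʳ-≤ (suc d) 2 d′ (subst (2 + suc d ≤_) (≡sym total) (subst (_≤ m) (ℕₚ.+-comm d 3) room))
  room′ : d′ + 3 ≤ m
  room′ = subst (d′ + 3 ≤_) total (ℕₚ.+-monoʳ-≤ d′ (s≤s d≥2))

-- Biregular graphs not determined by their parameters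

∨⁻ : ∀ {a b} → a ∨ b ≡ true → a ≡ true ⊎ b ≡ true
∨⁻ {true}  _ = inj₁ refl
∨⁻ {false} h = inj₂ h

record Biregular (p q a b : ℕ) (r : Fin p → Fin q → Bool) : Set where
  field
    rows    : ∀ x → # (r x) ≡ a
    columns : ∀ y → # (λ x → r x y) ≡ b

BiIsomorphism : ∀ {p q} → (Fin p → Fin q → Bool) → (Fin p → Fin q → Bool) → Permutation p p → Permutation q q → Set
BiIsomorphism r r′ π σ = ∀ x y → r x y ≡ r′ (π ⟨$⟩ʳ x) (σ ⟨$⟩ʳ y)

record BiAmbiguous (p q a b : ℕ) : Set where
  field
    one two  : Fin p → Fin q → Bool
    one-reg  : Biregular p q a b one
    two-reg  : Biregular p q a b two
    distinct : ∀ π σ → ¬ BiIsomorphism one two π σ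

#-not : ∀ {m a b} (p : Fin m → Bool) → a + b ≡ m → # p ≡ a → # (λ v → not (p v)) ≡ b
#-not {m} {a} p e h = ℕₚ.+-cancelˡ-≡ a _ _ (trans (cong (_+ # (λ v → not (p v))) (≡sym h))
  (trans (#-split (λ _ → true) p) (trans (#-all {m} (λ _ → true) (λ _ → refl)) (≡sym e))))

biregular-complement : ∀ {p q a a′ b b′ r} → a + a′ ≡ q → b + b′ ≡ p → Biregular p q a b r → Biregular p q a′ b′ (λ x y → not (r x y))
biregular-complement {r = r} ea eb R = record
  { rows = λ x → #-not (r x) ea (rows x) ; columns = λ y → #-not (λ x → r x y) eb (columns y) }
  where open Biregular R

biambiguous-complement : ∀ {p q a a′ b b′} → a + a′ ≡ q → b + b′ ≡ p → BiAmbiguous p q a b → BiAmbiguous p q a′ b′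
biambiguous-complement ea eb A = record
  { one = λ x y → not (one x y) ; two = λ x y → not (two x y)
  ; one-reg = biregular-complement ea eb one-reg ; two-reg = biregular-complement ea eb two-reg
  ; distinct = λ π σ iso → distinct π σ λ x y → Boolₚ.not-injective (iso x y)
  }
  where open BiAmbiguous A

#-remove : ∀ {m} (p p′ : Fin m → Bool) y → p y ≡ true → p′ y ≡ false → (∀ z → z ≢ y → p z ≡ p′ z) → # p ≡ suc (# p′)
#-remove p p′ y py p′y same = trans (≡sym (#-split p (λ z → does (z Finₚ.≟ y)))) (cong₂ _+_
  (#-single _ y (∧-true py (dec-true (y Finₚ.≟ y) refl)) (λ w h → ≡sym (dec-true⁻ (w Finₚ.≟ y) (∧-right {p w} h))))
  (#-cong pt))
  where
  pt : ∀ z → p z ∧ not (does (z Finₚ.≟ y)) ≡ p′ z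
  pt z with z Finₚ.≟ y
  ... | yes refl = trans (Boolₚ.∧-zeroʳ _) (≡sym p′y)
  ... | no ne    = trans (Boolₚ.∧-identityʳ _) (same z ne)

common : ∀ {p q} → (Fin p → Fin q → Bool) → Fin p → Fin p → ℕ
common r x x′ = # (λ y → r x y ∧ r x′ y)

-- Counting the overlaps above a threshold rather than at a value makes the comparison before and
-- after a switch monotone.
close : ∀ {p q} → (Fin p → Fin q → Bool) → ℕ → Fin p → ℕ
close r θ x = # (λ x′ → does (θ ≤? common r x x′))

close-iso : ∀ {p q} {r r′ : Fin p → Fin q → Bool} π σ → BiIsomorphism r r′ π σ → ∀ θ x → close r θ x ≡ close r′ θ (π ⟨$⟩ʳ x)
close-iso {r = r} {r′} π σ iso θ x = ≡sym (trans (#-bijection π _) (#-cong λ x′ → cong (λ k → does (θ ≤? k))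
  (trans (#-bijection σ _) (#-cong λ y → ≡sym (cong₂ _∧_ (iso x y) (iso x′ y))))))

-- The switch x₁y₁, x₂y₂ ↦ x₁y₂, x₂y₁ leaves the row of x alone and changes its overlaps with x₁ and x₂ by −1 and +1,
-- so it changes the distribution of the overlaps with x unless it merely swaps two of them.
module BiSwitch {p q a b} {r : Fin p → Fin q → Bool} (R : Biregular p q a b r) (x x₁ x₂ : Fin p) (y₁ y₂ : Fin q)
  (x≢x₁ : x ≢ x₁) (h : r x y₁ ≡ true) (h′ : r x y₂ ≡ false)
  (h₁₁ : r x₁ y₁ ≡ true) (h₁₂ : r x₁ y₂ ≡ false) (h₂₁ : r x₂ y₁ ≡ false) (h₂₂ : r x₂ y₂ ≡ true) where

  open Biregular R

  switched : Fin p → Fin q → Bool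
  switched x y = r x y xor (pair x₁ x₂ x ∧ pair y₁ y₂ y)

  private
    sw-rows : ∀ z → # (switched z) ≡ a
    sw-rows z with pair x₁ x₂ z in e
    ... | true  = trans (#-flip (r z) (balance (pair⁻ x₁ x₂ z e))) (rows z)
      where
      balance : z ≡ x₁ ⊎ z ≡ x₂ → r z y₁ ≡ not (r z y₂)
      balance (inj₁ refl) = trans h₁₁ (≡sym (not-true h₁₂))
      balance (inj₂ refl) = trans h₂₁ (≡sym (cong not h₂₂))
    ... | false = trans (#-cong {p = λ y → r z y xor false} {q = r z} λ y → Boolₚ.xor-identityʳ _) (rows z)

    sw-columns : ∀ w → # (λ z → switched z w) ≡ b
    sw-columns w with pair y₁ y₂ w in e
    ... | true  = trans (#-cong {p = λ z → r z w xor (pair x₁ x₂ z ∧ true)} {q = λ z → r z w xor pair x₁ x₂ z} λ z → cong (r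
          z w xor_) (Boolₚ.∧-identityʳ _))
                    (trans (#-flip (λ z → r z w) (balance (pair⁻ y₁ y₂ w e))) (columns w))
      where
      balance : w ≡ y₁ ⊎ w ≡ y₂ → r x₁ w ≡ not (r x₂ w)
      balance (inj₁ refl) = trans h₁₁ (≡sym (not-true h₂₁))
      balance (inj₂ refl) = trans h₁₂ (≡sym (cong not h₂₂))
    ... | false = trans (#-cong {p = λ z → r z w xor (pair x₁ x₂ z ∧ false)} {q = λ z → r z w}
                    λ z → trans (cong (r z w xor_) (Boolₚ.∧-zeroʳ _)) (Boolₚ.xor-identityʳ _)) (columns w)

    unchanged : ∀ z → z ≢ x₁ → z ≢ x₂ → ∀ y → switched z y ≡ r z y
    unchanged z n₁ n₂ y = trans (cong (λ k → r z y xor (k ∧ pair y₁ y₂ y)) (pair-out x₁ x₂ z n₁ n₂)) (Boolₚ.xor-identityʳ _)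

    row-x : ∀ y → switched x y ≡ r x y
    row-x = unchanged x x≢x₁ (λ { refl → true≢false h h₂₁ })

    changed : ∀ z → pair x₁ x₂ z ≡ true → ∀ y → switched z y ≡ r z y xor pair y₁ y₂ y
    changed z e y = cong (λ k → r z y xor (k ∧ pair y₁ y₂ y)) e

    common-other : ∀ z → z ≢ x₁ → z ≢ x₂ → common switched x z ≡ common r x z
    common-other z n₁ n₂ = #-cong λ y → cong₂ _∧_ (row-x y) (unchanged z n₁ n₂ y)

    away : ∀ z → pair x₁ x₂ z ≡ true → ∀ y → y ≢ y₁ → r x y ∧ r z y ≡ switched x y ∧ switched z y
    away z e y ne = by (y Finₚ.≟ y₂)
      where
      by : Dec (y ≡ y₂) → r x y ∧ r z y ≡ switched x y ∧ switched z y
      by (yes refl) = trans (cong (_∧ r z y) h′) (≡sym (cong (_∧ switched z y) (trans (row-x y) h′)))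
      by (no ne′)   = ≡sym (cong₂ _∧_ (row-x y) (trans (changed z e y)
        (trans (cong (r z y xor_) (pair-out y₁ y₂ y ne ne′)) (Boolₚ.xor-identityʳ _))))

    common-₁ : common r x x₁ ≡ suc (common switched x x₁)
    common-₁ = #-remove _ _ y₁ (∧-true h h₁₁)
      (trans (cong (switched x y₁ ∧_) (trans (changed x₁ (pair-left x₁ x₂) y₁) (cong₂ _xor_ h₁₁ (pair-left y₁ y₂)))) (Boolₚ.∧-zeroʳ _))
      (away x₁ (pair-left x₁ x₂))

    common-₂ : common switched x x₂ ≡ suc (common r x x₂)
    common-₂ = #-remove _ _ y₁ (∧-true (trans (row-x y₁) h) (trans (changed x₂ (pair-right x₁ x₂) y₁) (cong₂ _xor_ h₂₁ (pair-left y₁ y₂))))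
      (trans (cong (r x y₁ ∧_) h₂₁) (Boolₚ.∧-zeroʳ _)) (λ z ne → ≡sym (away x₂ (pair-right x₁ x₂) z ne))

    -- Threshold just above the overlap with x₂: after the switch x₂ is counted, while x₁ was not
    -- counted before.
    more : common r x x₁ < suc (common r x x₂) → close r (suc (common r x x₂)) x < close switched (suc (common r x x₂)) x
    more lt = #-strict keep x₂ (dec-false (θ ≤? common r x x₂) (ℕₚ.<⇒≱ ℕₚ.≤-refl)) (dec-true (θ ≤? _) (ℕₚ.≤-reflexive (≡sym common-₂)))
      where
      θ : ℕ
      θ = suc (common r x x₂)
      keep : ∀ z → does (θ ≤? common r x z) ≡ true → does (θ ≤? common switched x z) ≡ true
      keep z e = by (z Finₚ.≟ x₁) (z Finₚ.≟ x₂)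
        where
        by : Dec (z ≡ x₁) → Dec (z ≡ x₂) → does (θ ≤? common switched x z) ≡ true
        by (yes refl) _ = contradiction (dec-true⁻ (θ ≤? common r x z) e) (ℕₚ.<⇒≱ lt)
        by (no _) (yes refl) = contradiction (dec-true⁻ (θ ≤? common r x z) e) (ℕₚ.<⇒≱ ℕₚ.≤-refl)
        by (no n₁) (no n₂) = trans (cong (λ k → does (θ ≤? k)) (common-other z n₁ n₂)) e

    -- Threshold at the overlap with x₁: x₁ drops out, and x₂ stays below even after its increase.
    less : suc (common r x x₂) < common r x x₁ → close switched (common r x x₁) x < close r (common r x x₁) x
    less lt = #-strict keep x₁ (dec-false (θ ≤? _) (ℕₚ.<⇒≱ (ℕₚ.≤-reflexive (≡sym common-₁)))) (dec-true (θ ≤? common r x x₁) ℕₚ.≤-refl)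
      where
      θ : ℕ
      θ = common r x x₁
      keep : ∀ z → does (θ ≤? common switched x z) ≡ true → does (θ ≤? common r x z) ≡ true
      keep z e = by (z Finₚ.≟ x₁) (z Finₚ.≟ x₂)
        where
        by : Dec (z ≡ x₁) → Dec (z ≡ x₂) → does (θ ≤? common r x z) ≡ true
        by (yes refl) _ = dec-true (θ ≤? common r x z) ℕₚ.≤-refl
        by (no _) (yes refl) = contradiction (subst (θ ≤_) common-₂ (dec-true⁻ (θ ≤? common switched x z) e)) (ℕₚ.<⇒≱ lt)
        by (no n₁) (no n₂) = trans (cong (λ k → does (θ ≤? k)) (≡sym (common-other z n₁ n₂))) e

  biambiguous : (∀ θ z w → close r θ z ≡ close r θ w) → common r x x₁ ≢ suc (common r x x₂) → BiAmbiguous p q a b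
  biambiguous const ne = record
    { one = r ; two = switched ; one-reg = R ; two-reg = record { rows = sw-rows ; columns = sw-columns }
    ; distinct = λ π σ iso → differ (λ θ → trans (const θ x (π ⟨$⟩ˡ x)) (trans (close-iso {r = r} {switched} π σ iso θ (π ⟨$⟩ˡ x))
        (cong (close switched θ) (Perm.inverseʳ π))))
    }
    where
    differ : (∀ θ → close r θ x ≡ close switched θ x) → ⊥
    differ same with ℕₚ.<-cmp (common r x x₁) (suc (common r x x₂))
    ... | tri< lt _ _ = ℕₚ.<-irrefl (same (suc (common r x x₂))) (more lt)
    ... | tri≈ _ e _  = ne e
    ... | tri> _ _ gt = ℕₚ.<-irrefl (≡sym (same (common r x x₁))) (less gt)

-- Cyclic block patterns

block : ∀ {Q} g → Fin (Q * g) → Fin Q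
block g y = proj₁ (remQuot g y)

block-combine : ∀ {Q g} (i : Fin Q) (l : Fin g) → block g (combine i l) ≡ i
block-combine i l = cong proj₁ (Finₚ.remQuot-combine i l)

#-blocks : ∀ {Q} g (φ : Fin Q → Bool) → # (λ (y : Fin (Q * g)) → φ (block g y)) ≡ # φ * g
#-blocks {Q} g φ with E , P ← enumerate φ = ≡sym (Enum-×-# {f = f} (f-inj , λ v → mk⇔ (onto v) (λ { (t , refl) → trans (cong
    φ (block-combine (E (proj₁ t)) (proj₂ t))) (Enum-∈ P (proj₁ t)) })))
  where
  f : Fin (# φ) × Fin g → Fin (Q * g)
  f (i , l) = combine (E i) l
  f-inj : Injective _≡_ _≡_ f
  f-inj {i , l} {j , l′} e with q , refl ← Finₚ.combine-injective (E i) l (E j) l′ e = cong (_, l) (proj₁ P q)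
  onto : ∀ v → φ (block g v) ≡ true → ∃ λ t → f t ≡ v
  onto v h with i , e ← Enum-index P (block g v) h = (i , proj₂ (remQuot {Q} g v)) ,
    trans (cong (λ z → combine z (proj₂ (remQuot {Q} g v))) e) (Finₚ.combine-remQuot {Q} g v)

-- Row i of `slot` consists of the j for which i + j reduced modulo Q is below w. As i + j < 2 Q,
-- two intervals suffice for the reduction; the sum instead of a difference makes the pattern
-- symmetric, so rows and columns are alike.
module Window (m w : ℕ) (w≥1 : 1 ≤ w) (w≤m : w ≤ m) where

  private
    Q = suc m
    ρ = rotation m

  window : ℕ → Bool
  window z = does (z <? w) ∨ within Q (Q + w) z

  window-low : ∀ {z} → z < w → window z ≡ true
  window-low {z} lt = cong (_∨ within Q (Q + w) z) (dec-true (z <? w) lt)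

  window-high : ∀ {z} → Q ≤ z → z < Q + w → window z ≡ true
  window-high {z} l h = trans (cong (does (z <? w) ∨_) (within⁺ l h)) (Boolₚ.∨-zeroʳ _)

  window⁻ : ∀ {z} → window z ≡ true → z < w ⊎ (Q ≤ z × z < Q + w)
  window⁻ {z} h = [ (λ e → inj₁ (dec-true⁻ (z <? w) e)) , (λ e → inj₂ (within⁻ Q (Q + w) z e)) ]′ (∨⁻ h)

  window-gap : ∀ {z} → w ≤ z → z < Q → window z ≡ false
  window-gap w≤z z<Q = false-intro λ h → [ (λ lt → ℕₚ.<⇒≱ lt w≤z) , (λ (Q≤z , _) → ℕₚ.<⇒≱ z<Q Q≤z) ]′ (window⁻ h)

  window-period : ∀ j → j < Q → window (Q + j) ≡ window j
  window-period j j<Q = bool-iff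
    (λ h → [ (λ lt → contradiction (ℕₚ.<-≤-trans lt (ℕₚ.≤-trans w≤m (ℕₚ.≤-trans (ℕₚ.n≤1+n m) (ℕₚ.m≤m+n Q j)))) (ℕₚ.<-irrefl refl))
           , (λ (_ , lt) → window-low (ℕₚ.+-cancelˡ-< Q j w lt)) ]′ (window⁻ h))
    (λ h → [ (λ lt → window-high (ℕₚ.m≤m+n Q j) (ℕₚ.+-monoʳ-< Q lt))
           , (λ (Q≤j , _) → contradiction Q≤j (ℕₚ.<⇒≱ j<Q)) ]′ (window⁻ h))

  slot : Fin Q → Fin Q → Bool
  slot i j = window (toℕ i + toℕ j)

  slot-sym : ∀ i j → slot i j ≡ slot j i
  slot-sym i j = cong window (ℕₚ.+-comm (toℕ i) (toℕ j))

  private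
    wrap : ∀ (j : Fin m) → slot (ρ ⟨$⟩ʳ zero) (suc j) ≡ slot zero (ρ ⟨$⟩ʳ suc j)
    wrap j = trans (cong (λ z → window (z + suc (toℕ j))) (toℕ-rotation-zero m))
      (trans (cong window (ℕₚ.+-suc m (toℕ j))) (trans (window-period (toℕ j) (ℕₚ.<-trans (Finₚ.toℕ<n j) ℕₚ.≤-refl))
        (cong window (≡sym (toℕ-rotation-suc m j)))))

  slot-rotation : ∀ i j → slot (ρ ⟨$⟩ʳ i) j ≡ slot i (ρ ⟨$⟩ʳ j)
  slot-rotation zero    zero    = cong window (ℕₚ.+-identityʳ _)
  slot-rotation zero    (suc j) = wrap j
  slot-rotation (suc i) zero    = trans (slot-sym (ρ ⟨$⟩ʳ suc i) zero) (trans (≡sym (wrap i)) (slot-sym (ρ ⟨$⟩ʳ zero) (suc i)))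
  slot-rotation (suc i) (suc j) = cong window (trans (cong (_+ suc (toℕ j)) (toℕ-rotation-suc m i))
    (trans (ℕₚ.+-suc (toℕ i) (toℕ j)) (cong (suc (toℕ i) +_) (≡sym (toℕ-rotation-suc m j)))))

  #-slot : ∀ i → # (slot i) ≡ w
  #-slot i = trans (rotation-invariant (λ i → # (slot i)) (λ i → trans (#-cong (slot-rotation i)) (≡sym (#-bijection ρ (slot i)))) i)
    (trans (#-iff {p = slot zero} {q = λ j → does (toℕ j <? w)}
      (λ j h → [ dec-true (toℕ j <? w) , (λ (le , _) → contradiction le (ℕₚ.<⇒≱ (Finₚ.toℕ<n j))) ]′ (window⁻ h))
      (λ j h → window-low (dec-true⁻ (toℕ j <? w) h))) (#-below w (ℕₚ.≤-trans w≤m (ℕₚ.n≤1+n m))))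

  shared : Fin Q → Fin Q → ℕ
  shared i i′ = # (λ j → slot i j ∧ slot i′ j)

  shared-sym : ∀ i i′ → shared i i′ ≡ shared i′ i
  shared-sym i i′ = #-cong λ j → Boolₚ.∧-comm (slot i j) (slot i′ j)

  shared-rotation : ∀ i i′ → shared (ρ ⟨$⟩ʳ i) (ρ ⟨$⟩ʳ i′) ≡ shared i i′
  shared-rotation i i′ = trans (#-cong λ j → cong₂ _∧_ (slot-rotation i j) (slot-rotation i′ j))
    (≡sym (#-bijection ρ (λ j → slot i j ∧ slot i′ j)))

  -- Every entry of the Q by Q pattern is blown up to P rows and g columns.
  module Blocks (P g : ℕ) where

    blocks : Fin (Q * P) → Fin (Q * g) → Bool
    blocks x y = slot (block P x) (block g y)

    blocks-regular : Biregular (Q * P) (Q * g) (w * g) (w * P) blocks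
    blocks-regular = record
      { rows    = λ x → trans (#-blocks g (slot (block P x))) (cong (_* g) (#-slot (block P x)))
      ; columns = λ y → trans (#-blocks P (λ i → slot i (block g y)))
          (cong (_* P) (trans (#-cong λ i → slot-sym i (block g y)) (#-slot (block g y))))
      }

    common-blocks : ∀ x x′ → common blocks x x′ ≡ shared (block P x) (block P x′) * g
    common-blocks x x′ = #-blocks g (λ j → slot (block P x) j ∧ slot (block P x′) j)

    close-const : ∀ θ x x′ → close blocks θ x ≡ close blocks θ x′
    close-const θ x x′ = trans (at x) (≡sym (at x′))
      where
      κ : Fin Q → ℕ
      κ i = # (λ i′ → does (θ ≤? shared i i′ * g))
      κ-rotation : ∀ i → κ (ρ ⟨$⟩ʳ i) ≡ κ i
      κ-rotation i = trans (#-bijection ρ (λ i′ → does (θ ≤? shared (ρ ⟨$⟩ʳ i) i′ * g)))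
        (#-cong λ i′ → cong (λ k → does (θ ≤? k * g)) (shared-rotation i i′))
      at : ∀ x → close blocks θ x ≡ κ zero * P
      at x = trans (#-cong λ x′ → cong (λ k → does (θ ≤? k)) (common-blocks x x′))
        (trans (#-blocks P (λ i′ → does (θ ≤? shared (block P x) i′ * g))) (cong (_* P) (rotation-invariant κ κ-rotation (block P x))))

    row : Fin Q → Fin P → Fin (Q * P)
    row = combine

    column : Fin Q → Fin g → Fin (Q * g)
    column = combine

    blocks-at : ∀ i l j l′ → blocks (row i l) (column j l′) ≡ slot i j
    blocks-at i l j l′ = cong₂ slot (block-combine i l) (block-combine j l′)

    common-at : ∀ i l i′ l′ → common blocks (row i l) (row i′ l′) ≡ shared i i′ * g
    common-at i l i′ l′ = trans (common-blocks (row i l) (row i′ l′)) (cong₂ (λ i i′ → shared i i′ * g) (block-combine i l)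
        (block-combine i′ l′))

-- By rotation, row 0 overlaps its cyclic neighbours 1 and Q - 1 equally, so the overlaps do not
-- differ by the 1 that would make the switch a mere swap. Column 0 lies in the rows 0 and 1 but not
-- in Q - 1, column w the other way round; this uses 2 ≤ w < Q - 1.
biambiguous-wide : ∀ m w P g → Fin P → Fin g → 2 ≤ w → w < m → BiAmbiguous (suc m * P) (suc m * g) (w * g) (w * P)
biambiguous-wide m@(suc m′) w P g l k w≥2 w<m = BiSwitch.biambiguous blocks-regular
  (row zero l) (row 1F l) (row (ρ ⟨$⟩ʳ zero) l) (column zero k) (column y k)
  (λ e → absurd (Finₚ.combine-injectiveˡ {suc m} {P} zero l 1F l e))
  (at zero zero (window-low (ℕₚ.≤-trans (s≤s z≤n) w≥2))) (at zero y (trans (cong window toℕ-y) (window-gap ℕₚ.≤-refl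
      (ℕₚ.<-trans w<m ℕₚ.≤-refl))))
  (at 1F zero (window-low w≥2)) (at 1F y (trans (cong (λ z → window (1 + z)) toℕ-y) (window-gap (ℕₚ.n≤1+n w) (s≤s w<m))))
  (at (ρ ⟨$⟩ʳ zero) zero (trans (cong (λ z → window (z + 0)) (toℕ-rotation-zero m)) (window-gap (subst (w ≤_) (≡sym
      (ℕₚ.+-identityʳ m)) (ℕₚ.<⇒≤ w<m)) (s≤s (ℕₚ.≤-reflexive (ℕₚ.+-identityʳ m))))))
  (at (ρ ⟨$⟩ʳ zero) y (trans (cong₂ (λ z z′ → window (z + z′)) (toℕ-rotation-zero m) toℕ-y)
    (window-high (subst (_≤ m + w) (ℕₚ.+-comm m 1) (ℕₚ.+-monoʳ-≤ m (ℕₚ.≤-trans (s≤s z≤n) w≥2))) ℕₚ.≤-refl)))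
  close-const
  (λ e → ℕₚ.1+n≢n (≡sym (trans (cong (_* g) same) (trans (≡sym (common-at zero l 1F l)) (trans e (cong suc (common-at zero l
      (ρ ⟨$⟩ʳ zero) l)))))))
  where
  open Window m w (ℕₚ.≤-trans (s≤s z≤n) w≥2) (ℕₚ.<⇒≤ w<m)
  open Blocks P g
  ρ = rotation m
  y : Fin (suc m)
  y = fromℕ< {w} (ℕₚ.<-trans w<m ℕₚ.≤-refl)
  toℕ-y : toℕ y ≡ w
  toℕ-y = Finₚ.toℕ-fromℕ< (ℕₚ.<-trans w<m ℕₚ.≤-refl)
  absurd : zero ≡ 1F → ⊥
  absurd ()
  at : ∀ i j {b} → window (toℕ i + toℕ j) ≡ b → blocks (row i l) (column j k) ≡ b
  at i j e = trans (blocks-at i l j k) e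
  same : shared zero (ρ ⟨$⟩ʳ zero) ≡ shared zero 1F
  same = trans (≡sym (cong (λ z → shared z (ρ ⟨$⟩ʳ zero)) (Finₚ.toℕ-injective (trans (toℕ-rotation-suc m zero) refl))))
    (trans (shared-rotation 1F zero) (shared-sym 1F zero))

-- For w = 1 the pattern is a disjoint union of complete bipartite graphs. Two rows of one block
-- share g columns and rows of different blocks none; g ≥ 2 keeps the overlap g different from 0 +
-- 1.
biambiguous-thin : ∀ m P g → 1 ≤ m → (l l′ : Fin P) → l ≢ l′ → Fin g → 2 ≤ g → BiAmbiguous (suc m * P) (suc m * g) (1 * g) (1 * P)
biambiguous-thin m@(suc m′) P g m≥1 l l′ l≢l′ k g≥2 = BiSwitch.biambiguous blocks-regular
  (row zero l) (row zero l′) (row 1F l) (column zero k) (column (ρ ⟨$⟩ʳ zero) k)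
  (λ e → l≢l′ (Finₚ.combine-injectiveʳ {suc m} {P} zero l zero l′ e))
  (at zero l zero (window-low (s≤s z≤n))) (at zero l (ρ ⟨$⟩ʳ zero) last)
  (at zero l′ zero (window-low (s≤s z≤n))) (at zero l′ (ρ ⟨$⟩ʳ zero) last)
  (at 1F l zero (window-gap (s≤s z≤n) (s≤s (s≤s z≤n))))
  (at 1F l (ρ ⟨$⟩ʳ zero) (trans (cong (λ z → window (1 + z)) (toℕ-rotation-zero m))
    (window-high ℕₚ.≤-refl (s≤s (ℕₚ.≤-reflexive (ℕₚ.+-comm 1 m))))))
  close-const
  (λ e → big (trans (≡sym (trans (common-at zero l zero l′) (cong (_* g) full)))
    (trans e (cong suc (trans (common-at zero l 1F l) (cong (_* g) none))))))
  where
  open Window m 1 ℕₚ.≤-refl m≥1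
  open Blocks P g
  ρ = rotation m
  big : 1 * g ≢ suc (0 * g)
  big e = ℕₚ.<⇒≢ g≥2 (≡sym (trans (≡sym (ℕₚ.*-identityˡ g)) e))
  last : window (toℕ (ρ ⟨$⟩ʳ zero)) ≡ false
  last = trans (cong window (toℕ-rotation-zero m)) (window-gap (s≤s z≤n) ℕₚ.≤-refl)
  at : ∀ i l j {b} → window (toℕ i + toℕ j) ≡ b → blocks (row i l) (column j k) ≡ b
  at i l j e = trans (blocks-at i l j k) e
  full : shared zero zero ≡ 1
  full = trans (#-cong λ j → Boolₚ.∧-idem (slot zero j)) (#-slot zero)
  none : shared zero 1F ≡ 0
  none = #-none _ pt
    where
    pt : ∀ j → slot zero j ∧ slot 1F j ≡ false
    pt zero    = trans (cong (slot zero zero ∧_) (window-gap {1} (s≤s z≤n) (s≤s (s≤s z≤n)))) (Boolₚ.∧-zeroʳ (slot zero zero))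
    pt (suc j) = cong (_∧ slot 1F (suc j)) (window-gap (s≤s z≤n) (s≤s (Finₚ.toℕ<n j)))

private
  thin : ∀ m P g → 1 ≤ m → 2 ≤ P → 2 ≤ g → BiAmbiguous (suc m * P) (suc m * g) (1 * g) (1 * P)
  thin m (suc (suc P)) (suc (suc g)) m≥1 P≥2 g≥2 = biambiguous-thin m (suc (suc P)) (suc (suc g)) m≥1 zero (suc zero) (λ ()) zero g≥2
  thin m 1 g m≥1 (s≤s ()) g≥2
  thin m (suc (suc P)) 1 m≥1 P≥2 (s≤s ())

-- With g = gcd a q, every feasible (p, q, a, b) has the form (Q P, Q g, w g, w P).
biambiguous-blocks : ∀ Q w P g → 2 ≤ w * g → w * g + 2 ≤ Q * g → 2 ≤ w * P → w * P + 2 ≤ Q * P → BiAmbiguous (Q * P) (Q * g) (w * g) (w * P)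
biambiguous-blocks zero w P g a≥2 room _ _ = contradiction (ℕₚ.≤-trans (ℕₚ.m≤n+m 2 (w * g)) room) λ ()
biambiguous-blocks Q@(suc m) w P g a≥2 room b≥2 room′ with ℕₚ.<-cmp w 1 | ℕₚ.<-cmp w m
... | tri< w<1 _ _ | _ = contradiction (subst (λ w → 2 ≤ w * g) (ℕₚ.n<1⇒n≡0 w<1) a≥2) λ ()
... | tri≈ _ refl _ | _ = thin m P g m≥1 (subst (2 ≤_) (ℕₚ.*-identityˡ P) b≥2) (subst (2 ≤_) (ℕₚ.*-identityˡ g) a≥2)
  where
  m≥1 : 1 ≤ m
  m≥1 = ℕₚ.≤-pred (ℕₚ.*-cancelʳ-< g 1 (suc m) (ℕₚ.<-≤-trans (ℕₚ.m<m+n (1 * g) {2} (s≤s z≤n)) room))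
... | tri> _ _ w>1 | tri< w<m _ _ = biambiguous-wide m w P g (factor P b≥2) (factor g a≥2) w>1 w<m
  where
  factor : ∀ k → 2 ≤ w * k → Fin k
  factor zero    h = contradiction (subst (2 ≤_) (ℕₚ.*-zeroʳ w) h) λ ()
  factor (suc k) h = zero
-- The complement of a window of width Q - 1 has width 1.
... | tri> _ _ w>1 | tri≈ _ refl _ = biambiguous-complement (share g) (share P)
    (thin m P g (ℕₚ.<⇒≤ w>1) (two P room′) (two g room))
  where
  share : ∀ k → 1 * k + m * k ≡ suc m * k
  share k = cong (_+ m * k) (ℕₚ.*-identityˡ k)
  two : ∀ k → m * k + 2 ≤ suc m * k → 2 ≤ k
  two k h = ℕₚ.+-cancelˡ-≤ (m * k) 2 k (subst (m * k + 2 ≤_) (ℕₚ.+-comm k (m * k)) h)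
... | tri> _ _ w>1 | tri> _ _ w>m = contradiction (ℕₚ.≤-trans (ℕₚ.m<m+n (w * g) {2} (s≤s z≤n)) room) (ℕₚ.≤⇒≯ (ℕₚ.*-monoˡ-≤ g w>m))

-- Write a = w g and q = Q g. Cancelling g from p a = q b leaves p w = Q b with w and Q coprime, so
-- Q divides p, and the quotient P satisfies b = w P.
biambiguous : ∀ p q a b → p * a ≡ q * b → 2 ≤ a → a + 2 ≤ q → 2 ≤ b → b + 2 ≤ p → BiAmbiguous p q a b
biambiguous p q a b e a≥2 room b≥2 room′ with mkGCD a q
... | zero , G with divides w refl , _ ← GCD.commonDivisor G = contradiction (subst (2 ≤_) (ℕₚ.*-zeroʳ w) a≥2) λ ()
... | g@(suc _) , G with divides w refl , divides Q refl ← GCD.commonDivisor G = go (coprime-divisor (λ (d , d′) → co (d′ ,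
      d)) (divides b pw))
  where
  co : Coprime w Q
  co = Bézout-coprime {g} {w} {Q} (Bézout.identity G)
  pw : w * p ≡ b * Q
  pw = ℕₚ.*-cancelʳ-≡ (w * p) (b * Q) g (begin
    w * p * g     ≡⟨ cong (_* g) (ℕₚ.*-comm w p) ⟩
    p * w * g     ≡⟨ ℕₚ.*-assoc p w g ⟩
    p * (w * g)   ≡⟨ e ⟩
    Q * g * b     ≡⟨ ℕₚ.*-comm (Q * g) b ⟩
    b * (Q * g)   ≡⟨ ℕₚ.*-assoc b Q g ⟨
    b * Q * g     ∎)
    where open ≡-Reasoning
  Q≢0 : NonZero Q
  Q≢0 = >-nonZero (positive Q room)
    where
    positive : ∀ Q → w * g + 2 ≤ Q * g → 0 < Q
    positive zero    h = contradiction (ℕₚ.≤-trans (ℕₚ.m≤n+m 2 (w * g)) h) λ ()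
    positive (suc Q) h = s≤s z≤n
  go : Q ∣ p → BiAmbiguous p (Q * g) (w * g) b
  go (divides P ep) = subst₂ (λ p b → BiAmbiguous p (Q * g) (w * g) b) (≡sym p≡) (≡sym b≡)
    (biambiguous-blocks Q w P g a≥2 room (subst (2 ≤_) b≡ b≥2) (subst₂ (λ b p → b + 2 ≤ p) b≡ p≡ room′))
    where
    p≡ : p ≡ Q * P
    p≡ = trans ep (ℕₚ.*-comm P Q)
    b≡ : b ≡ w * P
    b≡ = ℕₚ.*-cancelʳ-≡ b (w * P) Q {{Q≢0}} (trans (≡sym pw) (trans (cong (w *_) ep) (≡sym (ℕₚ.*-assoc w P Q))))

-- Necessity of A and B

module Necessity (G : Graph) (s : ℕ) (st : IsStable G s) where

  open Sufficiency G s st public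

  -- `x` and `y` may be the same cell, where R replaces G[x]; symmetry and irreflexivity are
  -- therefore asked only where the two orientations of the pair overlap.
  record Replacement (x y : V) (R : V → V → Bool) : Set where
    field
      symmetric   : ∀ u v → x ∼ u → y ∼ v → x ∼ v → y ∼ u → R u v ≡ R v u
      irreflexive : ∀ u → x ∼ u → y ∼ u → R u u ≡ false
      rows        : ∀ u → x ∼ u → deg R u y ≡ deg (adj G) u y
      columns     : ∀ v → y ∼ v → deg (λ v u → R u v) v x ≡ deg (adj G) v x

  module _ {x y : V} {R : V → V → Bool} (rep : Replacement x y R) where

    open Replacement rep

    private
      choose : Bool → Bool → V → V → Bool
      choose true  _     u v = R u v
      choose false true  u v = R v u
      choose false false u v = adj G u v

    replace : V → V → Bool
    replace u v = choose (cell x u ∧ cell y v) (cell x v ∧ cell y u) u v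

    replace-there : ∀ u v → x ∼ u → y ∼ v → replace u v ≡ R u v
    replace-there u v xu yv = cong (λ z → choose z (cell x v ∧ cell y u) u v) (∧-true (cell⁺ xu) (cell⁺ yv))

    private
      no-cells : ∀ u v → ¬ (x ∼ u × y ∼ v) → cell x u ∧ cell y v ≡ false
      no-cells u v h = false-intro λ e → h (cell⁻ (∧-left e) , cell⁻ (∧-right {cell x u} e))

    replace-back : ∀ u v → ¬ (x ∼ u × y ∼ v) → x ∼ v → y ∼ u → replace u v ≡ R v u
    replace-back u v h xv yu = cong₂ (λ z z′ → choose z z′ u v) (no-cells u v h) (∧-true (cell⁺ xv) (cell⁺ yu))

    replace-elsewhere : ∀ u v → ¬ (x ∼ u × y ∼ v) → ¬ (x ∼ v × y ∼ u) → replace u v ≡ adj G u v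
    replace-elsewhere u v h h′ = cong₂ (λ z z′ → choose z z′ u v) (no-cells u v h) (no-cells v u h′)

    private
      #-in-cell : ∀ z {p q : V → Bool} → (∀ w → z ∼ w → p w ≡ q w) → # (λ w → p w ∧ cell z w) ≡ # (λ w → q w ∧ cell z w)
      #-in-cell z {p} {q} e = #-cong λ w → by w (cell z w) refl
        where
        by : ∀ w b → cell z w ≡ b → p w ∧ cell z w ≡ q w ∧ cell z w
        by w true  h = cong (_∧ cell z w) (e w (cell⁻ h))
        by w false h = trans (cong (p w ∧_) h) (trans (Boolₚ.∧-zeroʳ (p w)) (≡sym (trans (cong (q w ∧_) h) (Boolₚ.∧-zeroʳ (q w)))))

      deg-cell-cong : ∀ (A : V → V → Bool) u {z z′} → z ∼ z′ → deg A u z ≡ deg A u z′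
      deg-cell-cong A u e = #-cong λ w → cong (A u w ∧_) (cell-cong e w)

      replace-deg : ∀ u z → Dec (x ∼ u × z ∼ y) → Dec (y ∼ u × z ∼ x) → deg replace u z ≡ deg (adj G) u z
      replace-deg u z (yes (xu , zy)) _ = trans (#-in-cell z {replace u} {R u} (λ w zw → replace-there u w xu (≈-trans (≈-sym zy) zw)))
        (trans (deg-cell-cong R u zy) (trans (rows u xu) (≡sym (deg-cell-cong (adj G) u zy))))
      replace-deg u z (no h) (yes (yu , zx)) = trans (#-in-cell z {replace u} {λ w → R w u}
          (λ w zw → replace-back u w (λ (xu , yw) → h (xu , ≈-trans zw (≈-sym yw))) (≈-trans (≈-sym zx) zw) yu))
        (trans (deg-cell-cong (λ v u → R u v) u zx) (trans (columns u yu) (≡sym (deg-cell-cong (adj G) u zx))))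
      replace-deg u z (no h) (no h′) = #-in-cell z {replace u} {adj G u} λ w zw → replace-elsewhere u w
        (λ (xu , yw) → h (xu , ≈-trans zw (≈-sym yw))) (λ (xw , yu) → h′ (yu , ≈-trans zw (≈-sym xw)))

      replace-sym : ∀ u v → replace u v ≡ replace v u
      replace-sym u v = by (cell x u ∧ cell y v) (cell x v ∧ cell y u) refl refl
        where
        by : ∀ p q → cell x u ∧ cell y v ≡ p → cell x v ∧ cell y u ≡ q → choose p q u v ≡ choose q p v u
        by true  true  e e′ = symmetric u v (cell⁻ (∧-left e)) (cell⁻ (∧-right {cell x u} e)) (cell⁻ (∧-left e′)) (cell⁻
            (∧-right {cell x v} e′))
        by true  false e e′ = refl
        by false true  e e′ = refl
        by false false e e′ = Graph.sym G u v

      replace-irrefl : ∀ u → replace u u ≡ false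
      replace-irrefl u = by (cell x u ∧ cell y u) refl
        where
        by : ∀ p → cell x u ∧ cell y u ≡ p → choose p p u u ≡ false
        by true  e = irreflexive u (cell⁻ (∧-left e)) (cell⁻ (∧-right {cell x u} e))
        by false e = irrefl G u

    replace-rewiring : Rewiring replace
    replace-rewiring = replace-sym , replace-irrefl , λ u z → replace-deg u z ((x ∼? u) ×-dec (z ∼? y)) ((y ∼? u) ×-dec (z ∼? x))

  module _ (rigid : Rigid) where

    -- Since the isomorphism respects the cells, it splits: it carries G[x, y] to the new edges and
    -- preserves G on every other pair of cells.
    rigid-replace : ∀ {x y R} → Replacement x y R → Σ (V ↔ V) λ f → CellPreserving f ×
      (∀ u v → x ∼ u → y ∼ v → adj G u v ≡ R (Inverse.to f u) (Inverse.to f v)) ×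
      (∀ u v → ¬ (x ∼ u × y ∼ v) → ¬ (x ∼ v × y ∼ u) → adj G u v ≡ adj G (Inverse.to f u) (Inverse.to f v))
    rigid-replace {x} {y} {R} rep with f , cp , fa ← rigid (replace rep) (replace-rewiring rep) = f , cp ,
      (λ u v xu yv → trans (fa u v) (replace-there rep _ _ (≈-trans xu (cp u)) (≈-trans yv (cp v)))) ,
      λ u v h h′ → trans (fa u v) (replace-elsewhere rep _ _
        (λ (xu , yv) → h (≈-trans xu (≈-sym (cp u)) , ≈-trans yv (≈-sym (cp v))))
        (λ (xv , yu) → h′ (≈-trans xv (≈-sym (cp v)) , ≈-trans yu (≈-sym (cp u)))))

  module Index {k : ℕ} {x : V} {h : Fin k → V} (P : Enum (cell x) h) where

    private
      index′ : ∀ u → Dec (x ∼ u) → Fin k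
      index′ u (yes xu) = proj₁ (Enum-index P u (cell⁺ xu))
      -- A junk value: only vertices of the cell are ever looked up.
      index′ u (no _)   = proj₁ (Enum-index P x (cell-refl x))

      enum-index′ : ∀ u d → x ∼ u → h (index′ u d) ≡ u
      enum-index′ u (yes xu) _  = proj₂ (Enum-index P u (cell⁺ xu))
      enum-index′ u (no ¬xu) xu = ⊥-elim (¬xu xu)

    index : V → Fin k
    index u = index′ u (x ∼? u)

    enum-index : ∀ u → x ∼ u → h (index u) ≡ u
    enum-index u = enum-index′ u (x ∼? u)

    index-enum : ∀ i → index (h i) ≡ i
    index-enum i = proj₁ P (enum-index (h i) (cell⁻ (Enum-∈ P i)))

    conjugate : (f : V ↔ V) → CellPreserving f → Permutation k k
    conjugate f cp = permutation (λ i → index (Inverse.to f (h i))) (λ i → index (Inverse.from f (h i)))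
      (λ i → trans (cong (λ z → index (Inverse.to f z)) (enum-index _ (inside⁻ i)))
        (trans (cong index (Inverse.strictlyInverseˡ f (h i))) (index-enum i)))
      (λ i → trans (cong (λ z → index (Inverse.from f z)) (enum-index _ (inside i)))
        (trans (cong index (Inverse.strictlyInverseʳ f (h i))) (index-enum i)))
      where
      inside : ∀ i → x ∼ Inverse.to f (h i)
      inside i = ≈-trans (cell⁻ (Enum-∈ P i)) (cp (h i))
      inside⁻ : ∀ i → x ∼ Inverse.from f (h i)
      inside⁻ i = ≈-trans (subst (x ∼_) (≡sym (Inverse.strictlyInverseˡ f (h i))) (cell⁻ (Enum-∈ P i))) (≈-sym (cp (Inverse.from f (h i))))

  module _ (rigid : Rigid) where

    -- B may take the place of G[x] without changing any degree into a cell, so rigidity makes it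
    -- isomorphic to G[x]. Two nonisomorphic candidates are then impossible.
    realize : ∀ {k d x} {h : Fin k → V} → Enum (cell x) h → (∀ u → x ∼ u → deg (adj G) u x ≡ d) → ∀ B → Regular k d B →
      ∃ λ π → Isomorphism (λ i j → adj G (h i) (h j)) B π
    realize {k} {d} {x} {h} P hd B R = let f , cp , there , _ = rigid-replace rigid replacement in
      conjugate f cp , λ i j → there (h i) (h j) (cell⁻ (Enum-∈ P i)) (cell⁻ (Enum-∈ P j))
      where
      open Index P
      R′ : V → V → Bool
      R′ u v = B (index u) (index v)
      degree : ∀ u → x ∼ u → deg R′ u x ≡ deg (adj G) u x
      degree u xu = trans (deg-enum P R′ u) (trans (#-cong λ j → cong (B (index u)) (index-enum j)) (trans (Regular.degree R
          (index u)) (≡sym (hd u xu))))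
      replacement : Replacement x x R′
      replacement = record
        { symmetric   = λ u v _ _ _ _ → Regular.symmetric R _ _
        ; irreflexive = λ u _ _ → Regular.irreflexive R _
        ; rows        = degree
        ; columns     = λ v xv → trans (#-cong λ w → cong (_∧ cell x w) (Regular.symmetric R _ _)) (degree v xv)
        }

    not-ambiguous : ∀ {k d x} {h : Fin k → V} → Enum (cell x) h → (∀ u → x ∼ u → deg (adj G) u x ≡ d) → ¬ Ambiguous k d
    not-ambiguous {h = h} P hd A = let π , iso = realize P hd one one-reg
                                       π′ , iso′ = realize P hd two two-reg in
      distinct (Perm.flip π ∘ₚ π′) λ i j → trans (≡sym (cong₂ one (Perm.inverseʳ π) (Perm.inverseʳ π)))
        (trans (≡sym (iso (π ⟨$⟩ˡ i) (π ⟨$⟩ˡ j))) (iso′ (π ⟨$⟩ˡ i) (π ⟨$⟩ˡ j)))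
      where open Ambiguous A

    birealize : ∀ {p q a b x y} {h : Fin p → V} {k : Fin q → V} → ¬ x ∼ y → Enum (cell x) h → Enum (cell y) k →
      (∀ u → x ∼ u → deg (adj G) u y ≡ a) → (∀ v → y ∼ v → deg (adj G) v x ≡ b) → ∀ r → Biregular p q a b r →
      ∃₂ λ π σ → BiIsomorphism (λ i j → adj G (h i) (k j)) r π σ
    birealize {x = x} {y} {h} {k} x≁y P Q ha hb r R = let f , cp , there , _ = rigid-replace rigid replacement in
      X.conjugate f cp , Y.conjugate f cp , λ i j → there (h i) (k j) (cell⁻ (Enum-∈ P i)) (cell⁻ (Enum-∈ Q j))
      where
      module X = Index P
      module Y = Index Q
      R′ : V → V → Bool
      R′ u v = r (X.index u) (Y.index v)
      replacement : Replacement x y R′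
      replacement = record
        { symmetric   = λ u v _ yv xv _ → ⊥-elim (x≁y (≈-trans xv (≈-sym yv)))
        ; irreflexive = λ u xu yu → ⊥-elim (x≁y (≈-trans xu (≈-sym yu)))
        ; rows        = λ u xu → trans (deg-enum Q R′ u) (trans (#-cong λ j → cong (r (X.index u)) (Y.index-enum j))
                          (trans (Biregular.rows R (X.index u)) (≡sym (ha u xu))))
        ; columns     = λ v yv → trans (deg-enum P (λ v u → R′ u v) v) (trans (#-cong λ i → cong (λ z → r z (Y.index v)) (X.index-enum i))
                          (trans (Biregular.columns R (Y.index v)) (≡sym (hb v yv))))
        }

    not-biambiguous : ∀ {p q a b x y} {h : Fin p → V} {k : Fin q → V} → ¬ x ∼ y → Enum (cell x) h → Enum (cell y) k →
      (∀ u → x ∼ u → deg (adj G) u y ≡ a) → (∀ v → y ∼ v → deg (adj G) v x ≡ b) → ¬ BiAmbiguous p q a b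
    not-biambiguous x≁y P Q ha hb A = let π , σ , iso = birealize x≁y P Q ha hb one one-reg
                                          π′ , σ′ , iso′ = birealize x≁y P Q ha hb two two-reg in
      distinct (Perm.flip π ∘ₚ π′) (Perm.flip σ ∘ₚ σ′) λ i j → trans (≡sym (cong₂ one (Perm.inverseʳ π) (Perm.inverseʳ σ)))
        (trans (≡sym (iso (π ⟨$⟩ˡ i) (σ ⟨$⟩ˡ j))) (iso′ (π ⟨$⟩ˡ i) (σ ⟨$⟩ˡ j)))
      where open BiAmbiguous A

    module _ (x : V) where

      private
        d : ℕ
        d = deg (adj G) x x

        co : V → ℕ
        co u = # (λ v → cell x v ∧ pairing true (adj G) u v)

        h : Fin (size x) → V
        h = proj₁ (enumerate (cell x))

        P : Enum (cell x) h
        P = proj₂ (enumerate (cell x))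

        degree : ∀ u → x ∼ u → deg (adj G) u x ≡ d
        degree u xu = deg-cell u x (≈-sym xu) x

        plain : ∀ u → # (λ v → cell x v ∧ pairing false (adj G) u v) ≡ deg (adj G) u x
        plain u = #-iff (λ v e → ∧-true (∧-left {adj G u v} (∧-right {cell x v} e)) (∧-left e))
          (λ v e → ∧-true {cell x v} (∧-right {adj G u v} e) (trans (pairing⁻ false (adj G) (λ { refl → true≢false (∧-left e)
              (irrefl G u) })) (∧-left e)))

        total : ∀ u → x ∼ u → d + suc (co u) ≡ size x
        total u xu = begin
          d + suc (co u)
            ≡⟨ cong₂ (λ a b → a + (b + co u)) (≡sym (trans (#-cong λ v → Boolₚ.∧-comm (cell x v) _) (degree u xu)))
                 (≡sym (#-single (λ v → (cell x v ∧ not (adj G u v)) ∧ does (u Finₚ.≟ v)) u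
                   (∧-true (∧-true (cell⁺ xu) (not-true (irrefl G u))) (dec-true (u Finₚ.≟ u) refl))
                   (λ w e → dec-true⁻ (u Finₚ.≟ w) (∧-right {cell x w ∧ not (adj G u w)} e)))) ⟩
          # (λ v → cell x v ∧ adj G u v) + (# (λ v → (cell x v ∧ not (adj G u v)) ∧ does (u Finₚ.≟ v)) + co u)
            ≡⟨ cong (λ z → # (λ v → cell x v ∧ adj G u v) + (# (λ v → (cell x v ∧ not (adj G u v)) ∧ does (u Finₚ.≟ v)) + z))
                 (#-cong λ v → ≡sym (Boolₚ.∧-assoc (cell x v) (not (adj G u v)) (not (does (u Finₚ.≟ v))))) ⟩
          # (λ v → cell x v ∧ adj G u v) + (# (λ v → (cell x v ∧ not (adj G u v)) ∧ does (u Finₚ.≟ v))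
            + # (λ v → (cell x v ∧ not (adj G u v)) ∧ not (does (u Finₚ.≟ v))))
            ≡⟨ cong (# (λ v → cell x v ∧ adj G u v) +_) (#-split (λ v → cell x v ∧ not (adj G u v)) (λ v → does (u Finₚ.≟ v))) ⟩
          # (λ v → cell x v ∧ adj G u v) + # (λ v → cell x v ∧ not (adj G u v))
            ≡⟨ #-split (cell x) (adj G u) ⟩
          size x ∎
          where open ≡-Reasoning

        induced : Regular (size x) d (λ i j → adj G (h i) (h j))
        induced = record
          { symmetric   = λ i j → Graph.sym G (h i) (h j)
          ; irreflexive = λ i → irrefl G (h i)
          ; degree      = λ i → trans (≡sym (deg-enum P (adj G) (h i))) (degree (h i) (cell⁻ (Enum-∈ P i)))
          }

        pairs : ∀ c → (∀ u → x ∼ u → # (λ v → cell x v ∧ pairing c (adj G) u v) ≡ 1) →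
          ∃ λ m → Σ (Fin m × Fin 2 → V) λ h → Enum (cell x) h × (∀ a b → pairing c (adj G) (h a) (h b) ≡ true ⇔ Matched m a b)
        pairs c one = matching-enum (cell x) (pairing c (adj G)) (pairing-sym c (Graph.sym G)) (pairing-irrefl c (adj G)) (λ
            u e → one u (cell⁻ e))

        cell-matching : d ≡ 1 → ∃ λ m → InducedIso x (Fin m × Fin 2) (matching m)
        cell-matching e with m , g , Q , M ← pairs false (λ u xu → trans (plain u) (trans (degree u xu) e)) =
          m , g , Enum⇒Enumerates Q , λ a b → mk⇔ (to a b) (from a b)
          where
          to : ∀ a b → E G (g a) (g b) → matching m a b
          to a@(_ , _) b@(_ , _) t = Equivalence.to (M a b) (trans (pairing⁻ false (adj G) (λ q → true≢false (T⇒≡ t) (trans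
              (cong (adj G (g a)) (≡sym q)) (irrefl G (g a))))) (T⇒≡ t))
          from : ∀ a b → matching m a b → E G (g a) (g b)
          from a@(_ , _) b@(_ , _) q = ≡⇒T (∧-left (Equivalence.from (M a b) q))

        cell-comatching : d + 2 ≡ size x → ∃ λ m → InducedIso x (Fin m × Fin 2) (comatching m)
        cell-comatching e with m , g , Q , M ← pairs true (λ u xu → ℕₚ.suc-injective (ℕₚ.+-cancelˡ-≡ d _ _ (trans (total u xu) (≡sym e)))) =
          m , g , Enum⇒Enumerates Q , λ a b → mk⇔ (to a b) (from a b)
          where
          to : ∀ a b → E G (g a) (g b) → comatching m a b
          to (a , i) (b , j) t refl = true≢false (T⇒≡ t) (not-true⁻ (∧-left (Equivalence.from (M (a , i) (a , j))
            (refl , λ { refl → true≢false (T⇒≡ t) (irrefl G _) }))))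
          from : ∀ a b → comatching m a b → E G (g a) (g b)
          from (a , i) (b , j) ne = ≡⇒T (by (adj G (g (a , i)) (g (b , j))) refl)
            where
            by : ∀ z → adj G (g (a , i)) (g (b , j)) ≡ z → z ≡ true
            by true  _ = refl
            by false q = ⊥-elim (ne (proj₁ (Equivalence.to (M (a , i) (b , j))
              (trans (pairing⁻ true (adj G) (λ q′ → ne (cong proj₁ (proj₁ Q q′)))) (not-true q)))))

        cell-pentagon : size x ≡ 5 → d ≡ 2 → InducedIso x (Fin 5) cycle5
        cell-pentagon e e′ with k , K ← Enum-subst e (enumerate (cell x))
          with π , π-inj , Bπ ← FiveCycle.unique (λ i j → adj G (k i) (k j)) (λ i j → Graph.sym G _ _) (λ i → irrefl G _)
            (λ i → trans (≡sym (deg-enum K (adj G) (k i))) (trans (degree (k i) (cell⁻ (Enum-∈ K i))) e′))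
          = (k ∘ π) , Enum⇒Enumerates (Enum-from-injection (λ q → π-inj (proj₁ K q)) (λ i → Enum-∈ K (π i)) e) ,
            λ i j → mk⇔ (λ t → from-next i j (dec-true⁻ (FiveCycle.adjacent? i j) (trans (≡sym (Bπ i j)) (T⇒≡ t))))
                        (λ c → ≡⇒T (trans (Bπ i j) (dec-true (FiveCycle.adjacent? i j) (to-next i j c))))

        cell-empty : d ≡ 0 → EmptyCell x
        cell-empty e a b xa xb t = true≢false (∧-true (T⇒≡ t) (cell⁺ xb)) (#-zero (λ w → adj G a w ∧ cell x w) (trans (degree a xa) e) b)

        cell-complete : d + 1 ≡ size x → CompleteCell x
        cell-complete e a b xa xb ne = ≡⇒T (by (adj G a b) refl)
          where
          by : ∀ z → adj G a b ≡ z → z ≡ true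
          by true  _ = refl
          by false q = true≢false (∧-true (cell⁺ xb) (trans (pairing⁻ true (adj G) ne) (not-true q)))
            (#-zero (λ v → cell x v ∧ pairing true (adj G) a v) (ℕₚ.suc-injective (ℕₚ.+-cancelˡ-≡ d _ _ (trans (total a xa) (≡sym e)))) b)

      -- Each of the five forms is one condition on the degree d and the order m: d = 0, d = m - 1,
      -- d = 1, d = m - 2, or m = 5 with d = 2. Otherwise 2 ≤ d ≤ m - 3, where `ambiguous-regular`
      -- applies.
      rigid⇒A : EmptyCell x ⊎ CompleteCell x ⊎ (∃ λ m → InducedIso x (Fin m × Fin 2) (matching m))
        ⊎ (∃ λ m → InducedIso x (Fin m × Fin 2) (comatching m)) ⊎ InducedIso x (Fin 5) cycle5
      rigid⇒A with d ℕₚ.≟ 0 | d + 1 ℕₚ.≟ size x | d ℕₚ.≟ 1 | d + 2 ℕₚ.≟ size x | (size x ℕₚ.≟ 5) ×-dec (d ℕₚ.≟ 2)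
      ... | yes e | _ | _ | _ | _ = inj₁ (cell-empty e)
      ... | _ | yes e | _ | _ | _ = inj₂ (inj₁ (cell-complete e))
      ... | _ | _ | yes e | _ | _ = inj₂ (inj₂ (inj₁ (cell-matching e)))
      ... | _ | _ | _ | yes e | _ = inj₂ (inj₂ (inj₂ (inj₁ (cell-comatching e))))
      ... | _ | _ | _ | _ | yes (e , e′) = inj₂ (inj₂ (inj₂ (inj₂ (cell-pentagon e e′))))
      ... | no d≢0 | no d≢m-1 | no d≢1 | no d≢m-2 | no no5 = ⊥-elim (not-ambiguous P degree (ambiguous-regular induced
              (ℕₚ.≤∧≢⇒< (ℕₚ.n≢0⇒n>0 d≢0) (d≢1 ∘ ≡sym)) room no5))
        where
        room₁ : d + 1 ≤ size x
        room₁ = subst (d + 1 ≤_) (total x ≈-refl) (ℕₚ.+-monoʳ-≤ d (s≤s z≤n))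
        step-up : ∀ k → d + k ≤ size x → d + k ≢ size x → d + suc k ≤ size x
        step-up k le ne = subst (_≤ size x) (≡sym (ℕₚ.+-suc d k)) (ℕₚ.≤∧≢⇒< le ne)
        room : d + 3 ≤ size x
        room = step-up 2 (step-up 1 room₁ d≢m-1) d≢m-2

    star-bip : ∀ {c t x y} → IsStar c t x y → Σ (Fin (size x) → V) λ f → Σ (Fin (size x) × Fin t → V) λ g →
      Enumerates x f × Enumerates y g × (∀ i b → c xor adj G (f i) (g b) ≡ true ⇔ i ≡ proj₁ b)
    star-bip {c} {t} {x} {y} (isStar ones spread) with f , P ← enumerate (cell x)
      with g , Q , fg ← star-enum {q = cell y} (λ u v → c xor adj G u v) P (λ v e → ones v (cell⁻ e)) (λ u e → spread u (cell⁻ e))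
      = f , g , Enum⇒Enumerates P , Enum⇒Enumerates Q , fg

    star⇒StarsBetween : ∀ {t x y} → IsStar false t x y → StarsBetween x y
    star⇒StarsBetween S with f , g , P , Q , fg ← star-bip S = _ , _ , f , g , P , Q , λ { i (j , l) →
      mk⇔ (λ e → Equivalence.to (fg i (j , l)) (T⇒≡ e)) (λ e → ≡⇒T (Equivalence.from (fg i (j , l)) e)) }

    star⇒CoStarsBetween : ∀ {t x y} → IsStar true t x y → CoStarsBetween x y
    star⇒CoStarsBetween S with f , g , P , Q , fg ← star-bip S = _ , _ , f , g , P , Q , λ { i (j , l) →
      mk⇔ (λ t e → true≢false (T⇒≡ t) (not-true⁻ (Equivalence.from (fg i (j , l)) e)))
          (λ ne → ≡⇒T (by i (j , l) ne (adj G (f i) (g (j , l))) refl)) }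
      where
      by : ∀ i b → i ≢ proj₁ b → ∀ z → adj G (f i) (g b) ≡ z → z ≡ true
      by i b ne true  _ = refl
      by i b ne false q = ⊥-elim (ne (Equivalence.to (fg i b) (not-true q)))

    -- Counting the edges from both sides makes a extreme (0 or |y|) whenever b is extreme (0 or
    -- |x|). So if all six tests fail, a and b are both at least 2 away from their extremes.
    rigid⇒B : CondB
    rigid⇒B x y x≁y = decide (a ℕₚ.≟ 0) (a ℕₚ.≟ size y) (b ℕₚ.≟ 1) (a ℕₚ.≟ 1) (b + 1 ℕₚ.≟ size x) (a + 1 ℕₚ.≟ size y)
      where
      a b : ℕ
      a = deg (adj G) x y
      b = deg (adj G) y x
      a-const : ∀ u → x ∼ u → deg (adj G) u y ≡ a
      a-const u xu = deg-cell u x (≈-sym xu) y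
      b-const : ∀ v → y ∼ v → deg (adj G) v x ≡ b
      b-const v yv = deg-cell v y (≈-sym yv) x
      edges : size x * a ≡ size y * b
      edges = double-count (cell x) (cell y) (adj G) a b
        (λ u e → trans (#-cong λ v → Boolₚ.∧-comm (cell y v) (adj G u v)) (a-const u (cell⁻ e)))
        (λ v e → trans (#-cong λ u → trans (cong (cell x u ∧_) (Graph.sym G u v)) (Boolₚ.∧-comm (cell x u) (adj G v u)))
            (b-const v (cell⁻ e)))
      a≤ : a ≤ size y
      a≤ = #-mono λ v e → ∧-right {adj G x v} e
      b≤ : b ≤ size x
      b≤ = #-mono λ v e → ∧-right {adj G y v} e
      dg-plain : ∀ x y v → y ∼ v → dg false (adj G) x v ≡ deg (adj G) y x
      dg-plain x y v yv = trans (#-cong λ u → trans (cong (cell x u ∧_) (Graph.sym G u v)) (Boolₚ.∧-comm (cell x u) (adj G v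
          u))) (deg-cell v y (≈-sym yv) x)
      dg-co : ∀ x y v → y ∼ v → deg (adj G) y x + 1 ≡ size x → dg true (adj G) x v ≡ 1
      dg-co x y v yv e = ℕₚ.+-cancelˡ-≡ (deg (adj G) y x) _ _
        (trans (cong (_+ dg true (adj G) x v) (≡sym (dg-plain x y v yv))) (trans (#-split (cell x) (λ u → adj G u v)) (≡sym e)))
      decide : Dec (a ≡ 0) → Dec (a ≡ size y) → Dec (b ≡ 1) → Dec (a ≡ 1) → Dec (b + 1 ≡ size x) → Dec (a + 1 ≡ size y) →
        EmptyBip x y ⊎ CompleteBip x y ⊎ StarsBetween x y ⊎ StarsBetween y x ⊎ CoStarsBetween x y ⊎ CoStarsBetween y x
      decide (yes e) _ _ _ _ _ = inj₁ λ u v xu yv t → true≢false (∧-true (T⇒≡ t) (cell⁺ yv))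
        (#-zero (λ w → adj G u w ∧ cell y w) (trans (a-const u xu) e) v)
      decide _ (yes e) _ _ _ _ = inj₂ (inj₁ λ u v xu yv → ≡⇒T (∧-left (#-full {p = λ w → adj G u w ∧ cell y w} {q = cell y}
        (λ w h → ∧-right {adj G u w} h) (ℕₚ.≤-reflexive (≡sym (trans (a-const u xu) e))) v (cell⁺ yv))))
      decide _ _ (yes e) _ _ _ = inj₂ (inj₂ (inj₁ (star⇒StarsBetween (ones⇒star {false} λ v yv → trans (dg-plain x y v yv) e))))
      decide _ _ _ (yes e) _ _ = inj₂ (inj₂ (inj₂ (inj₁ (star⇒StarsBetween (ones⇒star {false} λ u xu → trans (dg-plain y x u xu) e)))))
      decide _ _ _ _ (yes e) _ = inj₂ (inj₂ (inj₂ (inj₂ (inj₁ (star⇒CoStarsBetween (ones⇒star {true} λ v yv → dg-co x y v yv e))))))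
      decide _ _ _ _ _ (yes e) = inj₂ (inj₂ (inj₂ (inj₂ (inj₂ (star⇒CoStarsBetween (ones⇒star {true} λ u xu → dg-co y x u xu e))))))
      decide (no a≢0) (no a≢q) (no b≢1) (no a≢1) (no b≢p-1) (no a≢q-1) = ⊥-elim (not-biambiguous x≁y
        (proj₂ (enumerate (cell x))) (proj₂ (enumerate (cell y))) a-const b-const
        (biambiguous (size x) (size y) a b edges (above a a≢0 a≢1) (below a (size y) a≤ a≢q a≢q-1) (above b b≢0 b≢1) (below b
            (size x) b≤ b≢p b≢p-1)))
        where
        above : ∀ k → k ≢ 0 → k ≢ 1 → 2 ≤ k
        above k h h′ = ℕₚ.≤∧≢⇒< (ℕₚ.n≢0⇒n>0 h) (h′ ∘ ≡sym)
        below : ∀ k m → k ≤ m → k ≢ m → k + 1 ≢ m → k + 2 ≤ m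
        below k m le h h′ = subst (_≤ m) (≡sym (ℕₚ.+-suc k 1)) (ℕₚ.≤∧≢⇒< (subst (_≤ m) (ℕₚ.+-comm 1 k) (ℕₚ.≤∧≢⇒< le h)) h′)
        b≢0 : b ≢ 0
        b≢0 e = [ (λ p → ℕₚ.<⇒≢ (size-positive x) (≡sym p)) , a≢0 ]′
          (ℕₚ.m*n≡0⇒m≡0∨n≡0 (size x) (trans edges (trans (cong (size y *_) e) (ℕₚ.*-zeroʳ (size y)))))
        b≢p : b ≢ size x
        b≢p e = a≢q (ℕₚ.*-cancelˡ-≡ a (size y) (size x) {{>-nonZero (size-positive x)}}
          (trans edges (trans (cong (size y *_) e) (ℕₚ.*-comm (size y) (size x)))))

-- Relative positions of two block structures or five-cycles on one set

-- A grid is a partition into s blocks of t points, namely the pairs of a matching or the leaves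
-- with a common centre. The bounds exclude the trivial partitions, which have only one position
-- relative to any other structure.
data Kind : Set where
  grid : (s t : ℕ) → 2 ≤ s → 2 ≤ t → Kind
  five : Kind

Ix : Kind → Set
Ix (grid s t _ _) = Fin s × Fin t
Ix five           = Fin 5

Rel : (K : Kind) → Ix K → Ix K → Set
Rel (grid s t _ _) a b = proj₁ a ≡ proj₁ b
Rel five           i j = does (FiveCycle.adjacent? i j) ≡ true

count : Kind → ℕ
count (grid s t _ _) = s * t
count five           = 5

flatten : ∀ K → Fin (count K) ↔ Ix K
flatten (grid s t _ _) = Finₚ.*↔×
flatten five           = Perm.id

-- The invariant that tells relative positions apart; quantifying over the point makes it
-- independent of the labels.
Nested : {A : Set} → (A → A → Set) → (A → A → Set) → Set
Nested R S = ∃ λ a → ∀ b → R a b → S a b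

pull : {A B : Set} → (A → B) → (B → B → Set) → A → A → Set
pull f S a b = S (f a) (f b)

nested-⇒ : ∀ {A : Set} {R R′ S S′ : A → A → Set} (α : A → A) → (∀ a → ∃ λ b → α b ≡ a) →
  (∀ a b → R a b ⇔ R′ (α a) (α b)) → (∀ a b → S a b ⇔ S′ (α a) (α b)) → Nested R S → Nested R′ S′
nested-⇒ {R′ = R′} {S′ = S′} α onto RR SS (a , h) = α a , λ b r → let b₀ , e = onto b in
  subst (S′ (α a)) e (Equivalence.to (SS a b₀) (h b₀ (Equivalence.from (RR a b₀) (subst (R′ (α a)) (≡sym e) r))))

nested-⇐ : ∀ {A : Set} {R R′ S S′ : A → A → Set} (α : A → A) → (∀ a → ∃ λ b → α b ≡ a) →
  (∀ a b → R a b ⇔ R′ (α a) (α b)) → (∀ a b → S a b ⇔ S′ (α a) (α b)) → Nested R′ S′ → Nested R S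
nested-⇐ {R′ = R′} {S′ = S′} α onto RR SS (a , h) with a₀ , refl ← onto a =
  a₀ , λ b r → Equivalence.from (SS a₀ b) (h (α b) (Equivalence.to (RR a₀ b) r))

-- Two identifications of the index sets under which the two structures are in different relative position.
record Separated (K K′ : Kind) : Set where
  field
    first second : Ix K ↔ Ix K′
    differ : (Nested (Rel K) (pull (Inverse.to first) (Rel K′)) × ¬ Nested (Rel K) (pull (Inverse.to second) (Rel K′))) ⊎
             (Nested (pull (Inverse.to first) (Rel K′)) (Rel K) × ¬ Nested (pull (Inverse.to second) (Rel K′)) (Rel K))

↔-trans : ∀ {A B C : Set} → A ↔ B → B ↔ C → A ↔ C
↔-trans f g = mk↔ₛ′ (Inverse.to g ∘ Inverse.to f) (Inverse.from f ∘ Inverse.from g)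
  (λ c → trans (cong (Inverse.to g) (Inverse.strictlyInverseˡ f _)) (Inverse.strictlyInverseˡ g c))
  (λ a → trans (cong (Inverse.from f) (Inverse.strictlyInverseʳ g _)) (Inverse.strictlyInverseʳ f a))

↔-sym : ∀ {A B : Set} → A ↔ B → B ↔ A
↔-sym f = mk↔ₛ′ (Inverse.from f) (Inverse.to f) (Inverse.strictlyInverseʳ f) (Inverse.strictlyInverseˡ f)

-- With consecutive numbers in a block, the blocks e / t are nested in the blocks e / t′ for t ≤ t′ (at e = 0),
-- but never in the residue classes mod s′.
module GridPositions (s t s′ t′ : ℕ) (t≤t′ : t ≤ t′) (total : s * t ≡ s′ * t′) where

  aligned : (Fin s × Fin t) ↔ (Fin s′ × Fin t′)
  aligned = ↔-trans (↔-sym Finₚ.*↔×) (↔-trans (Perm.cast-id total) Finₚ.*↔×)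

  crossed : (Fin s × Fin t) ↔ (Fin s′ × Fin t′)
  crossed = ↔-trans (↔-sym Finₚ.*↔×) (↔-trans (Perm.cast-id (trans total (ℕₚ.*-comm s′ t′)))
    (↔-trans Finₚ.*↔× (mk↔ₛ′ (λ (a , b) → b , a) (λ (a , b) → b , a) (λ _ → refl) (λ _ → refl))))

  aligned-value : ∀ i j → t′ * toℕ (proj₁ (Inverse.to aligned (i , j))) + toℕ (proj₂ (Inverse.to aligned (i , j))) ≡ t * toℕ i + toℕ j
  aligned-value i j = trans (≡sym (Finₚ.toℕ-combine (proj₁ (Inverse.to aligned (i , j))) (proj₂ (Inverse.to aligned (i , j)))))
    (trans (cong toℕ (Finₚ.combine-remQuot {s′} t′ (cast total (combine i j)))) (trans (Finₚ.toℕ-cast total (combine i j))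
        (Finₚ.toℕ-combine i j)))

  crossed-value : ∀ i j → s′ * toℕ (proj₂ (Inverse.to crossed (i , j))) + toℕ (proj₁ (Inverse.to crossed (i , j))) ≡ t * toℕ i + toℕ j
  crossed-value i j = trans (≡sym (Finₚ.toℕ-combine (proj₂ (Inverse.to crossed (i , j))) (proj₁ (Inverse.to crossed (i , j)))))
    (trans (cong toℕ (Finₚ.combine-remQuot {t′} s′ (cast total′ (combine i j)))) (trans (Finₚ.toℕ-cast total′ (combine i j))
        (Finₚ.toℕ-combine i j)))
    where
    total′ : s * t ≡ t′ * s′
    total′ = trans total (ℕₚ.*-comm s′ t′)

  first-block : ∀ i j → toℕ i ≡ 0 → toℕ (proj₁ (Inverse.to aligned (i , j))) ≡ 0
  first-block i j e = by (toℕ (proj₁ (Inverse.to aligned (i , j)))) (trans (aligned-value i j) (trans (cong (λ z → t * z +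
      toℕ j) e) (cong (_+ toℕ j) (ℕₚ.*-zeroʳ t))))
    where
    by : ∀ q {r} → t′ * q + r ≡ toℕ j → q ≡ 0
    by zero    _ = refl
    by (suc q) {r} h = contradiction (ℕₚ.<-≤-trans (Finₚ.toℕ<n j) (ℕₚ.≤-trans t≤t′ (ℕₚ.≤-trans (ℕₚ.m≤m*n t′ (suc q))
        (ℕₚ.≤-trans (ℕₚ.m≤m+n _ r) (ℕₚ.≤-reflexive h))))) (ℕₚ.<-irrefl refl)

  aligned-nested : ∀ i j → toℕ i ≡ 0 → Nested {Fin s × Fin t} (λ a b → proj₁ a ≡ proj₁ b) (pull (Inverse.to aligned) (λ a b →
      proj₁ a ≡ proj₁ b))
  aligned-nested i j e = (i , j) , λ { (_ , j′) refl → Finₚ.toℕ-injective (trans (first-block i j e) (≡sym (first-block i j′ e))) }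

  crossed-not-nested : 2 ≤ s′ → (j₀ j₁ : Fin t) → toℕ j₁ ≡ suc (toℕ j₀) →
    ¬ Nested {Fin s × Fin t} (λ a b → proj₁ a ≡ proj₁ b) (pull (Inverse.to crossed) (λ a b → proj₁ a ≡ proj₁ b))
  crossed-not-nested s′≥2 j₀ j₁ e ((i , j) , h) = gap (toℕ (proj₂ (Inverse.to crossed (i , j₁)))) (toℕ (proj₂ (Inverse.to
      crossed (i , j₀))))
    (ℕₚ.+-cancelʳ-≡ (toℕ (proj₁ (Inverse.to crossed (i , j₀)))) _ _ (begin
      s′ * toℕ (proj₂ (Inverse.to crossed (i , j₁))) + toℕ (proj₁ (Inverse.to crossed (i , j₀)))
        ≡⟨ cong (λ z → s′ * toℕ (proj₂ (Inverse.to crossed (i , j₁))) + toℕ z) (trans (≡sym (h (i , j₀) refl)) (h (i , j₁) refl)) ⟩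
      s′ * toℕ (proj₂ (Inverse.to crossed (i , j₁))) + toℕ (proj₁ (Inverse.to crossed (i , j₁)))
        ≡⟨ crossed-value i j₁ ⟩
      t * toℕ i + toℕ j₁
        ≡⟨ trans (cong (t * toℕ i +_) e) (ℕₚ.+-suc _ _) ⟩
      suc (t * toℕ i + toℕ j₀)
        ≡⟨ cong suc (≡sym (crossed-value i j₀)) ⟩
      suc (s′ * toℕ (proj₂ (Inverse.to crossed (i , j₀)))) + toℕ (proj₁ (Inverse.to crossed (i , j₀))) ∎))
    where
    open ≡-Reasoning
    gap : ∀ q q′ → s′ * q ≡ suc (s′ * q′) → ⊥
    gap q q′ eq with ℕₚ.≤-total q q′
    ... | inj₁ le = ℕₚ.1+n≰n (ℕₚ.≤-trans (ℕₚ.≤-reflexive (≡sym eq)) (ℕₚ.*-monoʳ-≤ s′ le))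
    ... | inj₂ ge with ℕₚ.m≤n⇒m<n∨m≡n ge
    ...   | inj₂ refl = ℕₚ.1+n≢n (≡sym eq)
    ...   | inj₁ gt   = contradiction (ℕₚ.≤-trans (ℕₚ.+-monoˡ-≤ (s′ * q′) s′≥2)
            (ℕₚ.≤-trans (ℕₚ.≤-reflexive (≡sym (ℕₚ.*-suc s′ q′))) (ℕₚ.≤-trans (ℕₚ.*-monoʳ-≤ s′ gt) (ℕₚ.≤-reflexive eq)))) (ℕₚ.<-irrefl refl)

private
  first-two : ∀ {t} → 2 ≤ t → Σ (Fin t) λ j₀ → Σ (Fin t) λ j₁ → toℕ j₁ ≡ suc (toℕ j₀)
  first-two (s≤s (s≤s _)) = zero , suc zero , refl

  first-one : ∀ {s} → 2 ≤ s → Σ (Fin s) λ i → toℕ i ≡ 0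
  first-one (s≤s _) = zero , refl

  -- 5 is prime, so a five-cycle never shares its cell with a partition into blocks.
  not-five : ∀ s t → 2 ≤ s → 2 ≤ t → s * t ≢ 5
  not-five s t s≥2 t≥2 e with ℕₚ.m≤n⇒m<n∨m≡n s≥2
  ... | inj₁ s≥3 = ℕₚ.<⇒≱ (ℕₚ.*-mono-≤ s≥3 t≥2) (ℕₚ.≤-reflexive e)
  ... | inj₂ refl with ℕₚ.m≤n⇒m<n∨m≡n t≥2
  ...   | inj₁ t≥3 = ℕₚ.<⇒≱ (ℕₚ.*-monoʳ-≤ 2 t≥3) (ℕₚ.≤-reflexive e)
  ...   | inj₂ refl with () ← e

  -- Multiplication by 2 modulo 5 exchanges the five-cycle with its complement, so no adjacency
  -- survives.
  doubling : Fin 5 ↔ Fin 5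
  doubling = permutation double halve (λ { 0F → refl ; 1F → refl ; 2F → refl ; 3F → refl ; 4F → refl })
    (λ { 0F → refl ; 1F → refl ; 2F → refl ; 3F → refl ; 4F → refl })
    where
    double halve : Fin 5 → Fin 5
    double 0F = 0F
    double 1F = 2F
    double 2F = 4F
    double 3F = 1F
    double 4F = 3F
    halve 0F = 0F
    halve 1F = 3F
    halve 2F = 1F
    halve 3F = 4F
    halve 4F = 2F

  doubling-not-nested : ¬ Nested (Rel five) (pull (Inverse.to doubling) (Rel five))
  doubling-not-nested (0F , h) with () ← h 1F refl
  doubling-not-nested (1F , h) with () ← h 0F refl
  doubling-not-nested (2F , h) with () ← h 1F refl
  doubling-not-nested (3F , h) with () ← h 2F refl
  doubling-not-nested (4F , h) with () ← h 0F refl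

separated : ∀ K K′ → count K ≡ count K′ → Separated K K′
separated five five _ = record { first = Perm.id ; second = doubling ; differ = inj₁ ((zero , λ _ r → r) , doubling-not-nested) }
separated five (grid s t s≥2 t≥2) e = ⊥-elim (not-five s t s≥2 t≥2 (≡sym e))
separated (grid s t s≥2 t≥2) five e = ⊥-elim (not-five s t s≥2 t≥2 e)
separated (grid s t s≥2 t≥2) (grid s′ t′ s′≥2 t′≥2) e with ℕₚ.≤-total t t′
... | inj₁ t≤t′ = let j₀ , j₁ , j = first-two t≥2 ; i , i₀ = first-one s≥2 in record
  { first = aligned ; second = crossed ; differ = inj₁ (aligned-nested i j₀ i₀ , crossed-not-nested s′≥2 j₀ j₁ j) }
  where open GridPositions s t s′ t′ t≤t′ e
-- Only the structure with the smaller blocks is certain to nest in the other, so here the two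
-- exchange roles.
... | inj₂ t′≤t = let j₀ , j₁ , j = first-two t′≥2 ; i , i₀ = first-one s′≥2 in record
  { first = ↔-sym aligned ; second = ↔-sym crossed
  ; differ = inj₂ (forth {aligned} (aligned-nested i j₀ i₀) , λ h → crossed-not-nested s≥2 j₀ j₁ j (back {crossed} h)) }
  where
  open GridPositions s′ t′ s t t′≤t (≡sym e)
  R : Fin s′ × Fin t′ → Fin s′ × Fin t′ → Set
  R a b = proj₁ a ≡ proj₁ b
  S : Fin s × Fin t → Fin s × Fin t → Set
  S a b = proj₁ a ≡ proj₁ b
  forth : ∀ {φ : (Fin s′ × Fin t′) ↔ (Fin s × Fin t)} → Nested R (pull (Inverse.to φ) S) → Nested (pull (Inverse.from φ) R) S
  forth {φ} (a , h) = Inverse.to φ a , λ b r → subst (S (Inverse.to φ a)) (Inverse.strictlyInverseˡ φ b)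
    (h (Inverse.from φ b) (subst (λ z → R z (Inverse.from φ b)) (Inverse.strictlyInverseʳ φ a) r))
  back : ∀ {φ : (Fin s′ × Fin t′) ↔ (Fin s × Fin t)} → Nested (pull (Inverse.from φ) R) S → Nested R (pull (Inverse.to φ) S)
  back {φ} (a , h) = Inverse.from φ a , λ b r → subst (λ z → S z (Inverse.to φ b)) (≡sym (Inverse.strictlyInverseˡ φ a))
    (h (Inverse.to φ b) (subst (R (Inverse.from φ a)) (≡sym (Inverse.strictlyInverseʳ φ b)) r))

-- Necessity of C to F

module PathNecessity (G : Graph) (s : ℕ) (st : IsStable G s) where

  open Necessity G s st public

  -- On every pair of cells other than {y, w}, the isomorphism obtained by twisting G[y, w] with σ preserves G;
  -- on {y, w} it does so after composition with σ.
  module Twisted (rigid : Rigid) {y w : V} (σ : LocalPerm y) where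

    private
      t : V → V
      t = LocalPerm.act σ

      R : V → V → Bool
      R u v = adj G (t u) (t v)

      twisted-deg : ∀ u z → deg R u z ≡ deg (adj G) u z
      twisted-deg = proj₂ (proj₂ (rewiring-∘ {adj G} (Graph.sym G , irrefl G , λ _ _ → refl) (LocalPerm.perm σ) (LocalPerm.cellwise σ)))

      replacement : Replacement y w R
      replacement = record
        { symmetric   = λ u v _ _ _ _ → Graph.sym G (t u) (t v)
        ; irreflexive = λ u _ _ → irrefl G (t u)
        ; rows        = λ u _ → twisted-deg u w
        ; columns     = λ v _ → trans (#-cong λ u → cong (_∧ cell y u) (Graph.sym G (t u) (t v))) (twisted-deg v y)
        }

      found : Σ (V ↔ V) λ f → CellPreserving f ×
        (∀ u v → y ∼ u → w ∼ v → adj G u v ≡ R (Inverse.to f u) (Inverse.to f v)) ×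
        (∀ u v → ¬ (y ∼ u × w ∼ v) → ¬ (y ∼ v × w ∼ u) → adj G u v ≡ adj G (Inverse.to f u) (Inverse.to f v))
      found = rigid-replace rigid replacement

    iso twist : V ↔ V
    iso   = proj₁ found
    twist = ↔-trans iso (LocalPerm.perm σ)

    iso-cells : CellPreserving iso
    iso-cells = proj₁ (proj₂ found)

    twist-cells : CellPreserving twist
    twist-cells u = ≈-trans (iso-cells u) (LocalPerm.cellwise σ _)

    twist-edges : ∀ u v → y ∼ u → w ∼ v → adj G u v ≡ adj G (Inverse.to twist u) (Inverse.to twist v)
    twist-edges = proj₁ (proj₂ (proj₂ found))

    iso-edges : ∀ u v → ¬ (y ∼ u × w ∼ v) → ¬ (y ∼ v × w ∼ u) → adj G u v ≡ adj G (Inverse.to iso u) (Inverse.to iso v)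
    iso-edges = proj₂ (proj₂ (proj₂ found))

  -- Labels and structures carried along paths of equally large cells

  Preserves : (V ↔ V) → V → V → Set
  Preserves f a b = ∀ u v → a ∼ u → b ∼ v → adj G u v ≡ adj G (Inverse.to f u) (Inverse.to f v)

  PreservesAlong : (V ↔ V) → V → List V → Set
  PreservesAlong f y []       = ⊤
  PreservesAlong f y (b ∷ ys) = Preserves f y b × PreservesAlong f b ys

  track : ∀ {A : Set} {x} {h : A → V} → Enum (cell x) h → (f : V ↔ V) → CellPreserving f → ∀ a → ∃ λ b → h b ≡ Inverse.to f (h a)
  track P f cp a = Enum-index P _ (cell⁺ (≈-trans (cell⁻ (Enum-∈ P a)) (cp _)))

  -- Thus f induces the same permutation of the indices through `h′` as through `h`, and relations
  -- on indices can be moved between cells.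
  Follows : {A : Set} → (A → V) → (A → V) → (V ↔ V) → Set
  Follows h h′ f = ∀ a b → Inverse.to f (h a) ≡ h b → Inverse.to f (h′ a) ≡ h′ b

  -- Equal sizes force t = 1, so G[a, b] or its bipartite complement is a perfect matching, which
  -- hands each label to the partner.
  transport-step : CondB → ∀ a b → ¬ a ∼ b → Anisotropic a b → size a ≡ size b → ∀ {A : Set} {h : A → V} → Enum (cell a) h →
    Σ (A → V) λ h′ → Enum (cell b) h′ × (∀ f → CellPreserving f → Preserves f a b → Follows h h′ f)
  transport-step cB a b a≁b an eq {A} {h} P with c , t , S ← star cB a b a≁b an (ℕₚ.≤-reflexive eq) = h′ , Q , follows
    where
    open IsStar S
    t≡1 : t ≡ 1
    t≡1 = ℕₚ.*-cancelˡ-≡ t 1 (size a) {{>-nonZero (size-positive a)}} (trans (IsStar-size S) (trans (≡sym eq) (≡sym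
        (ℕₚ.*-identityʳ (size a)))))
    partner : ∀ i → ∃ λ v → (cell b v ∧ (c xor adj G (h i) v) ≡ true) × (∀ w → cell b w ∧ (c xor adj G (h i) w) ≡ true → v ≡ w)
    partner i = #-unique _ (trans (spread (h i) (cell⁻ (Enum-∈ P i))) t≡1)
    h′ : A → V
    h′ i = proj₁ (partner i)
    h′∈b : ∀ i → cell b (h′ i) ≡ true
    h′∈b i = ∧-left (proj₁ (proj₂ (partner i)))
    joined : ∀ i → c xor adj G (h i) (h′ i) ≡ true
    joined i = ∧-right {cell b (h′ i)} (proj₁ (proj₂ (partner i)))
    partner-only : ∀ i v → b ∼ v → c xor adj G (h i) v ≡ true → h′ i ≡ v
    partner-only i v bv e = proj₂ (proj₂ (partner i)) v (∧-true (cell⁺ bv) e)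
    Q : Enum (cell b) h′
    Q = inj , λ v → mk⇔ (onto v) (λ { (i , refl) → h′∈b i })
      where
      inj : Injective _≡_ _≡_ h′
      inj {i} {j} e with _ , _ , only ← #-unique _ (ones (h′ i) (cell⁻ (h′∈b i))) = proj₁ P (trans
        (≡sym (only (h i) (∧-true (Enum-∈ P i) (joined i))))
        (only (h j) (∧-true (Enum-∈ P j) (subst (λ z → c xor adj G (h j) z ≡ true) (≡sym e) (joined j)))))
      onto : ∀ v → cell b v ≡ true → ∃ λ i → h′ i ≡ v
      onto v e with u , pr , _ ← #-unique _ (ones v (cell⁻ e)) with i , refl ← Enum-index P u (∧-left pr) =
        i , partner-only i v (cell⁻ e) (∧-right {cell a (h i)} pr)
    follows : ∀ f → CellPreserving f → Preserves f a b → Follows h h′ f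
    follows f cp pres i j e = ≡sym (partner-only j _ (≈-trans (cell⁻ (h′∈b i)) (cp (h′ i))) (trans (cong (c xor_)
      (trans (cong (λ z → adj G z (Inverse.to f (h′ i))) (≡sym e)) (≡sym (pres (h i) (h′ i) (cell⁻ (Enum-∈ P i)) (cell⁻ (h′∈b
          i)))))) (joined i)))

  transport : CondB → ∀ k y ys → AnisoPath (y ∷ ys) → All (λ v → size v ≡ k) (y ∷ ys) → ∀ {A : Set} {h : A → V} → Enum (cell y) h →
    Σ (A → V) λ h′ → Enum (cell (lastOf y ys)) h′ × (∀ f → CellPreserving f → PreservesAlong f y ys → Follows h h′ f)
  transport cB k y []       p eqs {h = h} P = h , P , λ f cp _ i j e → e
  transport cB k y (b ∷ ys) p@((y≁b ∷ _) ∷ _ , an ∷ _) (eq ∷ eqs@(eq′ ∷ _)) P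
    with h₁ , P₁ , F₁ ← transport-step cB y b y≁b an (trans eq (≡sym eq′)) P
    with h₂ , P₂ , F₂ ← transport cB k b ys (path-tail p) eqs P₁
    = h₂ , P₂ , λ f cp (pr , prs) i j e → F₂ f cp prs i j (F₁ f cp pr i j e)

  -- `w` is the cell from which the structure on `y` stems: `y` itself if it is heterogeneous, or a
  -- smaller neighbour. `rigidly` asks for the edges between `y` and `w` only, so it also applies to
  -- a twisted map.
  record End (y w : V) : Set where
    field
      kind  : Kind
      label : Ix kind → V
      enum  : Enum (cell y) label
      rigidly : ∀ f → CellPreserving f → Preserves f y w → ∀ a b a′ b′ → Inverse.to f (label a) ≡ label a′ → Inverse.to f
          (label b) ≡ label b′ →
        Rel kind a b ⇔ Rel kind a′ b′

  count-size : ∀ {y} K {h : Ix K → V} → Enum (cell y) h → count K ≡ size y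
  count-size K P = Enum-# (Enum-∘ (flatten K) P)

  -- A single pair would span a complete or an empty graph, hence a homogeneous cell; and no cell is
  -- without vertices.
  large-pairing : ∀ {c x m f} → Paired c x m f → Heterogeneous x → 2 ≤ m
  large-pairing {c} {x} {zero} (P , M) het with (() , _) , _ ← Enum-index P x (cell-refl x)
  large-pairing {c} {x} {suc zero} {f} (P , M) het = ⊥-elim (het (by c joined))
    where
    joined : ∀ u v → x ∼ u → x ∼ v → u ≢ v → c xor adj G u v ≡ true
    joined u v xu xv ne with (zero , i) , refl ← Enum-index P u (cell⁺ xu) with (zero , j) , refl ← Enum-index P v (cell⁺ xv) =
      trans (≡sym (pairing⁻ c (adj G) ne)) (Equivalence.from (M (zero , i) (zero , j)) (refl , λ { refl → ne refl }))
    by : ∀ c → (∀ u v → x ∼ u → x ∼ v → u ≢ v → c xor adj G u v ≡ true) → Homogeneous x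
    by false h = inj₁ λ u v xu xv ne → ≡⇒T (h u v xu xv ne)
    by true  h = inj₂ λ u v xu xv t → true≢false (T⇒≡ t) (not-true⁻ (h u v xu xv λ { refl → true≢false (T⇒≡ t) (irrefl G u) }))
  large-pairing {m = suc (suc m)} _ _ = s≤s (s≤s z≤n)

  hetero-end : CondA → ∀ y → Heterogeneous y → End y y
  hetero-end cA y het with structure cA y het
  ... | paired c m f PM@(P , M) = record
    { kind = grid m 2 (large-pairing {c} PM het) ℕₚ.≤-refl ; label = f ; enum = P ; rigidly = rigidly }
    where
    pairing-preserved : ∀ g → CellPreserving g → Preserves g y y → ∀ a b →
      pairing c (adj G) (f a) (f b) ≡ pairing c (adj G) (Inverse.to g (f a)) (Inverse.to g (f b))
    pairing-preserved g cp pr a b = cong₂ (λ x z → (c xor x) ∧ not z) (pr (f a) (f b) (cell⁻ (Enum-∈ P a)) (cell⁻ (Enum-∈ P b)))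
      (bool-iff (λ h → dec-true (_ Finₚ.≟ _) (cong (Inverse.to g) (dec-true⁻ (f a Finₚ.≟ f b) h)))
                (λ h → dec-true (f a Finₚ.≟ f b) (↔-injective g (dec-true⁻ (_ Finₚ.≟ _) h))))
    rigidly : ∀ g → CellPreserving g → Preserves g y y → ∀ a b a′ b′ → Inverse.to g (f a) ≡ f a′ → Inverse.to g (f b) ≡ f b′ →
      proj₁ a ≡ proj₁ b ⇔ proj₁ a′ ≡ proj₁ b′
    rigidly g cp pr a b a′ b′ ea eb = mk⇔ (to a b a′ b′ ea eb) (from a b a′ b′ ea eb)
      where
      same : ∀ a b a′ b′ → Inverse.to g (f a) ≡ f a′ → Inverse.to g (f b) ≡ f b′ → pairing c (adj G) (f a) (f b) ≡ pairing c
          (adj G) (f a′) (f b′)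
      same a b a′ b′ ea eb = trans (pairing-preserved g cp pr a b) (cong₂ (pairing c (adj G)) ea eb)
      to : ∀ a b a′ b′ → Inverse.to g (f a) ≡ f a′ → Inverse.to g (f b) ≡ f b′ → proj₁ a ≡ proj₁ b → proj₁ a′ ≡ proj₁ b′
      to (a , i) (b , j) a′ b′ ea eb refl with i Finₚ.≟ j
      ... | yes refl = cong proj₁ (proj₁ P (trans (≡sym ea) eb))
      ... | no ne    = proj₁ (Equivalence.to (M a′ b′) (trans (≡sym (same (a , i) (b , j) a′ b′ ea eb)) (Equivalence.from (M
            (a , i) (a , j)) (refl , ne))))
      from : ∀ a b a′ b′ → Inverse.to g (f a) ≡ f a′ → Inverse.to g (f b) ≡ f b′ → proj₁ a′ ≡ proj₁ b′ → proj₁ a ≡ proj₁ b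
      from a b (a′ , i) (b′ , j) ea eb refl with i Finₚ.≟ j
      ... | yes refl = cong proj₁ (proj₁ P (↔-injective g (trans ea (≡sym eb))))
      ... | no ne    = proj₁ (Equivalence.to (M a b) (trans (same a b (a′ , i) (b′ , j) ea eb) (Equivalence.from (M (a′ , i)
            (a′ , j)) (refl , ne))))
  ... | pentagon f P M = record
    { kind = five ; label = f ; enum = P
    ; rigidly = λ g cp pr a b a′ b′ ea eb → let e = trans (≡sym (M a b)) (trans (pr (f a) (f b) (cell⁻ (Enum-∈ P a)) (cell⁻ (Enum-∈ P b)))
                                                       (trans (cong₂ (adj G) ea eb) (M a′ b′))) in
        mk⇔ (trans (≡sym e)) (trans e)
    }

  record Labelled (c : Bool) (t : ℕ) (x y : V) (centre : Fin (size x) → V) : Set where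
    field
      leaf    : Fin (size x) × Fin t → V
      centres : Enum (cell x) centre
      leaves  : Enum (cell y) leaf
      joined  : ∀ i b → c xor adj G (centre i) (leaf b) ≡ true ⇔ i ≡ proj₁ b

    leaf-follows : ∀ f → Preserves f y x → ∀ b b′ i → Inverse.to f (leaf b) ≡ leaf b′ →
      Inverse.to f (centre (proj₁ b)) ≡ centre i → proj₁ b′ ≡ i
    leaf-follows f pr b b′ i e e′ = ≡sym (Equivalence.to (joined i b′) (trans (cong (c xor_) edge) (Equivalence.from (joined
        (proj₁ b) b) refl)))
      where
      edge : adj G (centre i) (leaf b′) ≡ adj G (centre (proj₁ b)) (leaf b)
      edge = trans (cong₂ (adj G) (≡sym e′) (≡sym e)) (trans (Graph.sym G _ _)
        (trans (≡sym (pr (leaf b) (centre (proj₁ b)) (cell⁻ (Enum-∈ leaves b)) (cell⁻ (Enum-∈ centres (proj₁ b))))) (Graph.sym G _ _)))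

  labelled : ∀ {c t x y f} → Enum (cell x) f → IsStar c t x y → Labelled c t x y f
  labelled {c} {t} {x} {y} P (isStar ones spread)
    with g , Q , fg ← star-enum {q = cell y} (λ u v → c xor adj G u v) P (λ v e → ones v (cell⁻ e)) (λ u e → spread u (cell⁻ e)) =
    record { leaf = g ; centres = P ; leaves = Q ; joined = fg }

  -- A single centre would be joined to all leaves or to none.
  many-centres : ∀ {c t x y} → IsStar c t x y → Anisotropic x y → 2 ≤ size x
  many-centres {c} {t} {x} {y} (isStar ones _) an with ℕₚ.m≤n⇒m<n∨m≡n (size-positive x)
  ... | inj₁ lt = lt
  ... | inj₂ e  = ⊥-elim (an (by c λ u v xu yv → ∧-right {cell x u} (#-full {p = λ u → cell x u ∧ (c xor adj G u v)} {q = cell x}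
          (λ u h → ∧-left h) (ℕₚ.≤-reflexive (trans (≡sym e) (≡sym (ones v yv)))) u (cell⁺ xu))))
    where
    by : ∀ c → (∀ u v → x ∼ u → y ∼ v → c xor adj G u v ≡ true) → Isotropic x y
    by false h = inj₁ λ u v xu yv → ≡⇒T (h u v xu yv)
    by true  h = inj₂ λ u v xu yv t → true≢false (T⇒≡ t) (not-true⁻ (h u v xu yv))

  -- The leaves are grouped by their centre; |x| < |y| gives every centre at least two of them.
  small-end : CondB → ∀ x y → ¬ x ∼ y → Anisotropic x y → size x < size y → End y x
  small-end cB x y x≁y an lt with c , t , S ← star cB x y x≁y an (ℕₚ.<⇒≤ lt) = record
    { kind = grid (size x) t (many-centres S an) (big t (IsStar-size S)) ; label = leaf ; enum = leaves ; rigidly = rigidly }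
    where
    f : Fin (size x) → V
    f = proj₁ (enumerate (cell x))
    open Labelled (labelled (proj₂ (enumerate (cell x))) S)
    big : ∀ t → size x * t ≡ size y → 2 ≤ t
    big zero          e = contradiction lt (ℕₚ.≤⇒≯ (subst (_≤ size x) (trans (≡sym (ℕₚ.*-zeroʳ (size x))) e) z≤n))
    big (suc zero)    e = contradiction (trans (≡sym (ℕₚ.*-identityʳ (size x))) e) (ℕₚ.<⇒≢ lt)
    big (suc (suc t)) e = s≤s (s≤s z≤n)
    rigidly : ∀ g → CellPreserving g → Preserves g y x → ∀ a b a′ b′ → Inverse.to g (leaf a) ≡ leaf a′ → Inverse.to g (leaf b) ≡ leaf b′ →
      proj₁ a ≡ proj₁ b ⇔ proj₁ a′ ≡ proj₁ b′
    rigidly g cp pr a b a′ b′ ea eb = mk⇔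
      (λ e → trans (centre-of a a′ ea) (trans (cong (λ z → proj₁ (track centres g cp z)) e) (≡sym (centre-of b b′ eb))))
      (λ e → proj₁ centres (↔-injective g (trans (≡sym (proj₂ (track centres g cp (proj₁ a))))
        (trans (cong f (trans (≡sym (centre-of a a′ ea)) (trans e (centre-of b b′ eb)))) (proj₂ (track centres g cp (proj₁ b)))))))
      where
      centre-of : ∀ a a′ → Inverse.to g (leaf a) ≡ leaf a′ → proj₁ a′ ≡ proj₁ (track centres g cp (proj₁ a))
      centre-of a a′ e = leaf-follows g pr a a′ _ e (≡sym (proj₂ (track centres g cp (proj₁ a))))

  -- The last cell of a path is left out because it may be the very cell `w` of its own end, namely
  -- when it is heterogeneous.
  AllButLast : (V → Set) → V → List V → Set
  AllButLast P y []       = ⊤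
  AllButLast P y (b ∷ ys) = P y × AllButLast P b ys

  all-but-last : ∀ {P : V → Set} y ys → All P (y ∷ ys) → AllButLast P y ys
  all-but-last y []       _        = tt
  all-but-last y (b ∷ ys) (h ∷ hs) = h , all-but-last b ys hs

  path-but-last : ∀ y ys → AllPairs (λ a b → ¬ a ∼ b) (y ∷ ys) → AllButLast (λ a → ¬ a ∼ lastOf y ys) y ys
  path-but-last y []       _        = tt
  path-but-last y (b ∷ ys) (h ∷ ap) = all-last b ys h , path-but-last b ys ap

  module _ (rigid : Rigid) (cB : CondB) where

    -- The twist only touches edges between the last cell and `w`, and every step of the path starts
    -- at a cell that is neither of them.
    preserves-along : ∀ y ys {w} (σ : LocalPerm (lastOf y ys)) → AllPairs (λ a b → ¬ a ∼ b) (y ∷ ys) → AllButLast (λ a → ¬ a ∼ w) y ys →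
      PreservesAlong (Twisted.iso rigid {w = w} σ) y ys
    preserves-along y ys {w} σ ap avoid = go y ys (path-but-last y ys ap) avoid
      where
      go : ∀ a as → AllButLast (λ a → ¬ a ∼ lastOf y ys) a as → AllButLast (λ a → ¬ a ∼ w) a as → PreservesAlong (Twisted.iso
          rigid {w = w} σ) a as
      go a []       _ _ = tt
      go a (b ∷ as) (h , hs) (h′ , hs′) = (λ u v au bv → Twisted.iso-edges rigid {w = w} σ u v
        (λ (yu , wv) → h (≈-trans au (≈-sym yu))) (λ (yv , wu) → h′ (≈-trans au (≈-sym wu)))) , go b as hs hs′

    private
      track-onto : ∀ {A : Set} {x} {h : A → V} (P : Enum (cell x) h) (f : V ↔ V) (cp : CellPreserving f) → ∀ a → ∃ λ b →
          proj₁ (track P f cp b) ≡ a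
      track-onto {x = x} {h} P f cp a = proj₁ found , proj₁ P (trans (proj₂ (track P f cp (proj₁ found)))
          (trans (cong (Inverse.to f) (proj₂ found)) (Inverse.strictlyInverseˡ f (h a))))
        where
        found : ∃ λ b → h b ≡ Inverse.from f (h a)
        found = Enum-index P _ (cell⁺ (≈-trans (cell⁻ (Enum-∈ P a))
          (≈-sym (subst (Inverse.from f (h a) ∼_) (Inverse.strictlyInverseˡ f (h a)) (cp (Inverse.from f (h a)))))))

      mover : ∀ {m} → 2 ≤ m → Σ (Permutation m m) λ π → ∃ λ i → π ⟨$⟩ʳ i ≢ i
      mover (s≤s (s≤s _)) = Perm.swap Perm.id , zero , λ ()

    -- Twisting the last cell makes any two relative positions of the two end structures isomorphic.
    not-separated : ∀ k y ys x w → AnisoPath (y ∷ ys) → All (λ v → size v ≡ k) (y ∷ ys) → (e₁ : End y x) (e₂ : End (lastOf y ys) w) →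
      AllButLast (λ a → ¬ a ∼ w) y ys →
      (∀ u v → y ∼ u → x ∼ v → ¬ (lastOf y ys ∼ u × w ∼ v) × ¬ (lastOf y ys ∼ v × w ∼ u)) → ¬ Separated (End.kind e₁) (End.kind e₂)
    not-separated k y ys x w p eqs e₁ e₂ avoid apart sep = conclude (Separated.differ sep)
      where
      module E₁ = End e₁
      module E₂ = End e₂
      z : V
      z = lastOf y ys
      moved : Σ (Ix E₁.kind → V) λ h′ → Enum (cell z) h′ × (∀ f → CellPreserving f → PreservesAlong f y ys → Follows E₁.label h′ f)
      moved = transport cB k y ys p eqs E₁.enum
      h : Ix E₁.kind → V
      h = proj₁ moved
      P : Enum (cell z) h
      P = proj₁ (proj₂ moved)
      -- The relative position found in G itself. It does not depend on the twist, so `first` and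
      -- `second` are both compared with it and hence with each other.
      κ : Ix E₁.kind → Ix E₂.kind
      κ a = proj₁ (Enum-index E₂.enum (h a) (Enum-∈ P a))
      label-κ : ∀ a → E₂.label (κ a) ≡ h a
      label-κ a = proj₂ (Enum-index E₂.enum (h a) (Enum-∈ P a))
      module At (τ : Ix E₁.kind ↔ Ix E₂.kind) where
        σ : LocalPerm z
        σ = proj₁ (relabel P (Enum-∘ τ E₂.enum))
        σh : ∀ a → LocalPerm.act σ (h a) ≡ E₂.label (Inverse.to τ a)
        σh = proj₂ (relabel P (Enum-∘ τ E₂.enum))
        module T = Twisted rigid {z} {w} σ
        α : Ix E₁.kind → Ix E₁.kind
        α a = proj₁ (track P T.iso T.iso-cells a)
        hα : ∀ a → Inverse.to T.iso (h a) ≡ h (α a)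
        hα a = ≡sym (proj₂ (track P T.iso T.iso-cells a))
        onto : ∀ a → ∃ λ b → α b ≡ a
        onto = track-onto P T.iso T.iso-cells
        -- Transport makes the isomorphism act on the labels at `y` by the same α as on the
        -- transported ones at `z`.
        label-α : ∀ a → Inverse.to T.iso (E₁.label a) ≡ E₁.label (α a)
        label-α a = let b , e = track E₁.enum T.iso T.iso-cells a in
          trans (≡sym e) (cong E₁.label (proj₁ P (trans (≡sym (follow a b (≡sym e))) (hα a))))
          where
          follow : Follows E₁.label h T.iso
          follow = proj₂ (proj₂ moved) T.iso T.iso-cells (preserves-along y ys {w} σ (proj₁ p) avoid)
        rel₁ : ∀ a b → Rel E₁.kind a b ⇔ Rel E₁.kind (α a) (α b)
        rel₁ a b = E₁.rigidly T.iso T.iso-cells (λ u v yu xv → let n , n′ = apart u v yu xv in T.iso-edges u v n n′)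
          a b (α a) (α b) (label-α a) (label-α b)
        twisted : ∀ a → Inverse.to T.twist (E₂.label (κ a)) ≡ E₂.label (Inverse.to τ (α a))
        twisted a = trans (cong (Inverse.to T.twist) (label-κ a)) (trans (cong (LocalPerm.act σ) (hα a)) (σh (α a)))
        rel₂ : ∀ a b → pull κ (Rel E₂.kind) a b ⇔ pull (Inverse.to τ) (Rel E₂.kind) (α a) (α b)
        rel₂ a b = E₂.rigidly T.twist T.twist-cells T.twist-edges (κ a) (κ b) _ _ (twisted a) (twisted b)
        shift : ∀ {R S R′ S′ : Ix E₁.kind → Ix E₁.kind → Set} → (∀ a b → R a b ⇔ R′ (α a) (α b)) → (∀ a b → S a b ⇔ S′ (α a)
            (α b)) → Nested R S ⇔ Nested R′ S′
        shift {R} {S} {R′} {S′} RR SS = mk⇔ (nested-⇒ {R = R} {R′} {S} {S′} α onto RR SS) (nested-⇐ {R = R} {R′} {S} {S′} α onto RR SS)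
        nested-in : Nested (Rel E₁.kind) (pull κ (Rel E₂.kind)) ⇔ Nested (Rel E₁.kind) (pull (Inverse.to τ) (Rel E₂.kind))
        nested-in = shift rel₁ rel₂
        nested-over : Nested (pull κ (Rel E₂.kind)) (Rel E₁.kind) ⇔ Nested (pull (Inverse.to τ) (Rel E₂.kind)) (Rel E₁.kind)
        nested-over = shift rel₂ rel₁
      module F = At (Separated.first sep)
      module S = At (Separated.second sep)
      conclude : (Nested (Rel E₁.kind) (pull (Inverse.to (Separated.first sep)) (Rel E₂.kind)) ×
                  ¬ Nested (Rel E₁.kind) (pull (Inverse.to (Separated.second sep)) (Rel E₂.kind))) ⊎
                 (Nested (pull (Inverse.to (Separated.first sep)) (Rel E₂.kind)) (Rel E₁.kind) ×
                  ¬ Nested (pull (Inverse.to (Separated.second sep)) (Rel E₂.kind)) (Rel E₁.kind)) → ⊥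
      conclude (inj₁ (nested , ¬nested)) = ¬nested (Equivalence.to S.nested-in (Equivalence.from F.nested-in nested))
      conclude (inj₂ (nested , ¬nested)) = ¬nested (Equivalence.to S.nested-over (Equivalence.from F.nested-over nested))

    no-two-ends : ∀ k y ys x w → AnisoPath (y ∷ ys) → All (λ v → size v ≡ k) (y ∷ ys) → End y x → End (lastOf y ys) w →
      AllButLast (λ a → ¬ a ∼ w) y ys →
      (∀ u v → y ∼ u → x ∼ v → ¬ (lastOf y ys ∼ u × w ∼ v) × ¬ (lastOf y ys ∼ v × w ∼ u)) → ⊥
    no-two-ends k y ys x w p eqs e₁ e₂ avoid apart = not-separated k y ys x w p eqs e₁ e₂ avoid apart
      (separated (End.kind e₁) (End.kind e₂) (trans (count-size (End.kind e₁) (End.enum e₁))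
        (trans (All.head eqs) (trans (≡sym (all-last y ys eqs)) (≡sym (count-size (End.kind e₂) (End.enum e₂)))))))

    -- Going round the cycle matches the stars at y with those at the last cell; a twist can make the induced
    -- permutation of x trivial or not.
    no-two-stars : ∀ {c₁ c₂ t} k x y ys → IsStar c₁ t x y → IsStar c₂ t x (lastOf y ys) → 2 ≤ size x → Fin t →
      AnisoPath (y ∷ ys) → All (λ v → size v ≡ k) (y ∷ ys) → All (λ v → ¬ x ∼ v) (y ∷ ys) → ¬ y ∼ lastOf y ys → ⊥
    no-two-stars {c₁} {c₂} {t} k x y ys S₁ S₂ x≥2 j p eqs x≁ y≁z = moves (trans (cong (π ⟨$⟩ʳ_) (≡sym e)) (trans (M.turned (a , j))
        (trans (cong M.α (≡sym I-turned)) e)))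
      where
      z : V
      z = lastOf y ys
      x≁z : ¬ x ∼ z
      x≁z = all-last y ys x≁
      f : Fin (size x) → V
      f = proj₁ (enumerate (cell x))
      C : Enum (cell x) f
      C = proj₂ (enumerate (cell x))
      module L₁ = Labelled (labelled C S₁)
      module L₂ = Labelled (labelled C S₂)
      moved : Σ (Fin (size x) × Fin t → V) λ h′ → Enum (cell z) h′ × (∀ f → CellPreserving f → PreservesAlong f y ys → Follows L₁.leaf h′ f)
      moved = transport cB k y ys p eqs L₁.leaves
      h : Fin (size x) × Fin t → V
      h = proj₁ moved
      P : Enum (cell z) h
      P = proj₁ (proj₂ moved)
      κ : Fin (size x) × Fin t → Fin (size x) × Fin t
      κ b = proj₁ (Enum-index L₂.leaves (h b) (Enum-∈ P b))
      leaf-κ : ∀ b → L₂.leaf (κ b) ≡ h b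
      leaf-κ b = proj₂ (Enum-index L₂.leaves (h b) (Enum-∈ P b))
      module At (π : Permutation (size x) (size x)) where
        τ : (Fin (size x) × Fin t) ↔ (Fin (size x) × Fin t)
        τ = mk↔ₛ′ (λ (i , l) → π ⟨$⟩ʳ i , l) (λ (i , l) → π ⟨$⟩ˡ i , l) (λ (i , l) → cong (_, l) (Perm.inverseʳ π)) (λ (i ,
            l) → cong (_, l) (Perm.inverseˡ π))
        σ : LocalPerm z
        σ = proj₁ (relabel P (Enum-∘ τ L₂.leaves))
        σh : ∀ b → LocalPerm.act σ (h b) ≡ L₂.leaf (Inverse.to τ b)
        σh = proj₂ (relabel P (Enum-∘ τ L₂.leaves))
        module T = Twisted rigid {z} {x} σ
        α : Fin (size x) → Fin (size x)
        α a = proj₁ (track C T.iso T.iso-cells a)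
        fα : ∀ a → Inverse.to T.iso (f a) ≡ f (α a)
        fα a = ≡sym (proj₂ (track C T.iso T.iso-cells a))
        twist-f : ∀ a → Inverse.to T.twist (f a) ≡ f (α a)
        twist-f a = trans (cong (LocalPerm.act σ) (fα a)) (LocalPerm.fixes σ (f (α a)) (λ e → x≁z (≈-trans (cell⁻ (Enum-∈ C
            (α a))) (≈-sym e))))
        turned : ∀ b → π ⟨$⟩ʳ α (proj₁ b) ≡ α (proj₁ (κ b))
        turned b = trans (cong (π ⟨$⟩ʳ_) (≡sym b′₁)) (L₂.leaf-follows T.twist T.twist-edges (κ b) (Inverse.to τ b′) (α (proj₁
            (κ b))) twisted (twist-f (proj₁ (κ b))))
          where
          b′ : Fin (size x) × Fin t
          b′ = proj₁ (track L₁.leaves T.iso T.iso-cells b)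
          leaf-b′ : Inverse.to T.iso (L₁.leaf b) ≡ L₁.leaf b′
          leaf-b′ = ≡sym (proj₂ (track L₁.leaves T.iso T.iso-cells b))
          b′₁ : proj₁ b′ ≡ α (proj₁ b)
          b′₁ = L₁.leaf-follows T.iso (λ u v yu xv → T.iso-edges u v (λ (zu , _) → y≁z (≈-trans yu (≈-sym zu))) (λ (zv , _) →
              x≁z (≈-trans xv (≈-sym zv))))
            b b′ (α (proj₁ b)) leaf-b′ (fα (proj₁ b))
          twisted : Inverse.to T.twist (L₂.leaf (κ b)) ≡ L₂.leaf (Inverse.to τ b′)
          twisted = trans (cong (Inverse.to T.twist) (leaf-κ b)) (trans (cong (LocalPerm.act σ)
            (proj₂ (proj₂ moved) T.iso T.iso-cells (preserves-along y ys {x} σ (proj₁ p)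
              (all-but-last y ys (All.map (λ x≁a e → x≁a (≈-sym e)) x≁))) b b′ leaf-b′)) (σh b′))
      π : Permutation (size x) (size x)
      π = proj₁ (mover x≥2)
      moves : π ⟨$⟩ʳ proj₁ (proj₂ (mover x≥2)) ≢ proj₁ (proj₂ (mover x≥2))
      moves = proj₂ (proj₂ (mover x≥2))
      -- The trivial twist shows that going round the cycle returns every leaf to its own centre.
      -- The twist by π then forces π to fix the point which it moves.
      module I = At Perm.id
      module M = At π
      a : Fin (size x)
      a = proj₁ (track-onto C M.T.iso M.T.iso-cells (proj₁ (proj₂ (mover x≥2))))
      e : M.α a ≡ proj₁ (proj₂ (mover x≥2))
      e = proj₂ (track-onto C M.T.iso M.T.iso-cells (proj₁ (proj₂ (mover x≥2))))
      I-turned : a ≡ proj₁ (κ (a , j))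
      I-turned = proj₁ C (↔-injective I.T.iso (trans (I.fα a) (trans (cong f (I.turned (a , j))) (≡sym (I.fα _)))))

    -- This serves D, with |x| = k, and the cyclic part of E, with |x| < k. Both stars around `x`
    -- satisfy |x| t = k, so they have equally many leaves per centre.
    no-loop : ∀ k x ys → AnisoCycle (x ∷ ys) → size x ≤ k → All (λ v → size v ≡ k) ys → ⊥
    no-loop k x (y ∷ []) (s≤s () , _) le eqs
    no-loop k x (y ∷ y′ ∷ ys) (_ , p@(x≁@(x≁y ∷ _) ∷ _ , an ∷ _) , closing) le eqs@(eq ∷ _)
      with c₁ , t₁ , S₁ ← star cB x y x≁y an (subst (size x ≤_) (≡sym eq) le)
      with c₂ , t₂ , S₂ ← star cB x (lastOf y (y′ ∷ ys)) (all-last y (y′ ∷ ys) x≁) (aniso-sym {lastOf y (y′ ∷ ys)} {x} closing)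
             (subst (size x ≤_) (≡sym (all-last y (y′ ∷ ys) eqs)) le)
      with refl ← ℕₚ.*-cancelˡ-≡ t₁ t₂ (size x) {{>-nonZero (size-positive x)}}
             (trans (IsStar-size S₁) (trans eq (≡sym (trans (IsStar-size S₂) (all-last y (y′ ∷ ys) eqs)))))
      = no-two-stars k x y (y′ ∷ ys) S₁ S₂ (many-centres S₁ an) (leaf t₁ (IsStar-size S₁)) (path-tail p) eqs x≁
          (proj₁ (path-but-last y (y′ ∷ ys) (proj₁ (path-tail p))))
      where
      leaf : ∀ t → size x * t ≡ size y → Fin t
      leaf zero    e = ⊥-elim (ℕₚ.<⇒≢ (size-positive y) (trans (≡sym (ℕₚ.*-zeroʳ (size x))) e))
      leaf (suc t) e = zero

    all-size : ∀ {k xs} → All (λ w → Card w k) xs → All (λ w → size w ≡ k) xs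
    all-size = All.map (λ {w} c → ≡sym (card-size {w} c))

    rigid⇒C : CondA → CondC
    rigid⇒C cA (x , ys , z , p , (k , cards) , hx , hz) = no-two-ends k x (ys ∷ʳ z) x (lastOf x (ys ∷ʳ z)) p (all-size cards)
      (hetero-end cA x hx) (subst (λ w → End w w) (≡sym last≡) (hetero-end cA z hz))
      (path-but-last x (ys ∷ʳ z) (proj₁ p))
      λ u v xu xv → (λ (zu , _) → x≁z (≈-trans xu (≈-sym zu))) , (λ (zv , _) → x≁z (≈-trans xv (≈-sym zv)))
      where
      last≡ : lastOf x (ys ∷ʳ z) ≡ z
      last≡ = lastOf-∷ʳ x ys z
      x≁z : ¬ x ∼ lastOf x (ys ∷ʳ z)
      x≁z e with h ∷ _ ← proj₁ p = proj₂ (Allₚ.∷ʳ⁻ h) (subst (x ∼_) last≡ e)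

    rigid⇒D : CondD
    rigid⇒D (x ∷ xs , c , k , cx ∷ cs) = no-loop k x xs c (ℕₚ.≤-reflexive (≡sym (card-size {x} cx))) (all-size cs)

    rigid⇒E : CondE
    rigid⇒E = peak , λ (x , ys , k , kx , c , cx , cs , lt) → no-loop k x ys c (ℕₚ.<⇒≤ (subst (_< k) (card-size {x} cx) lt)) (all-size cs)
      where
      peak : ¬ (∃ λ x → ∃ λ y → ∃ λ ys → ∃ λ z → ∃ λ k → ∃ λ kx → ∃ λ kz →
        AnisoPath (x ∷ (y ∷ ys) ∷ʳ z) × Card x kx × All (λ w → Card w k) (y ∷ ys) × Card z kz × kx < k × kz < k)
      peak (x , y , ys , z , k , kx , kz , p@((x≁y ∷ x≁) ∷ _ , an ∷ _) , cx , cs , cz , lx , lz) =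
        no-two-ends k y ys x z (path-prefix (y ∷ ys) (z ∷ []) (path-tail p)) sizes
          (small-end cB x y x≁y an (smaller x cx lx (All.head sizes)))
          (small-end cB z (lastOf y ys) (λ e → all-last y ys ≁z (≈-sym e)) (aniso-sym {lastOf y ys} {z} (linked-last y ys
              (proj₂ (path-tail p)))) (smaller z cz lz (all-last y ys sizes)))
          (all-but-last y ys ≁z)
          λ u v yu xv → (λ (_ , zv) → x≁z (≈-trans xv (≈-sym zv))) , (λ (_ , zu) → All.head ≁z (≈-trans yu (≈-sym zu)))
        where
        sizes : All (λ w → size w ≡ k) (y ∷ ys)
        sizes = all-size cs
        ≁z : All (λ a → ¬ a ∼ z) (y ∷ ys)
        ≁z = pairs-last (y ∷ ys) (proj₁ (path-tail p))
        x≁z : ¬ x ∼ z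
        x≁z = proj₂ (Allₚ.∷ʳ⁻ {xs = ys} x≁)
        smaller : ∀ a {ka b} → Card a ka → ka < k → size b ≡ k → size a < size b
        smaller a ca lt e = subst₂ _<_ (card-size {a} ca) (≡sym e) lt

    rigid⇒F : CondA → CondF
    rigid⇒F cA (x , ys , z , k , kx , p@(x≁ ∷ _ , _) , cx , cs , lt , het) = go ys p cs
      where
      go : ∀ ys → AnisoPath (x ∷ ys ∷ʳ z) → All (λ w → Card w k) (ys ∷ʳ z) → ⊥
      go [] ((x≁z ∷ []) ∷ _ , an ∷ _) cs = no-two-ends k z [] x z ([] ∷ [] , [-]) (all-size cs)
        (small-end cB x z x≁z an (subst₂ _<_ (card-size {x} cx) (≡sym (All.head (all-size cs))) lt)) (hetero-end cA z het) tt
        λ u v zu xv → (λ (_ , zv) → x≁z (≈-trans xv (≈-sym zv))) , (λ (zv , _) → x≁z (≈-trans xv (≈-sym zv)))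
      go (y ∷ ys) p@((x≁y ∷ x≁) ∷ _ , an ∷ _) cs = no-two-ends k y (ys ∷ʳ z) x (lastOf y (ys ∷ʳ z)) (path-tail p) (all-size cs)
        (small-end cB x y x≁y an (subst₂ _<_ (card-size {x} cx) (≡sym (All.head (all-size cs))) lt))
        (subst (λ w → End w w) (≡sym (lastOf-∷ʳ y ys z)) (hetero-end cA z het))
        (path-but-last y (ys ∷ʳ z) (proj₁ (path-tail p)))
        λ u v yu xv → (λ (_ , zv) → x≁z (≈-trans xv (≈-sym zv))) , (λ (zv , _) → x≁z (≈-trans xv (≈-sym zv)))
        where
        x≁z : ¬ x ∼ lastOf y (ys ∷ʳ z)
        x≁z e = proj₂ (Allₚ.∷ʳ⁻ {xs = ys} x≁) (subst (x ∼_) (lastOf-∷ʳ y ys z) e)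

theorem1 : (G : Graph) (s : ℕ) → IsStable G s →
    let open Cells G s in
    (Amenable G ⇔ (CondA × CondB × CondC × CondD × CondE × CondF)) ×
    (Amenable G ⇔ (CondA × CondB × CondG × CondH))
theorem1 G s st = mk⇔ necessary (sufficient ∘ trees) , mk⇔ (trees ∘ necessary) sufficient
  where
  open PathNecessity G s st
  necessary : Amenable G → CondA × CondB × CondC × CondD × CondE × CondF
  necessary am = cA , cB , rigid⇒C rigid cB cA , rigid⇒D rigid cB , rigid⇒E rigid cB , rigid⇒F rigid cB cA
    where
    rigid : Rigid
    rigid = amenable⇒rigid am
    cA : CondA
    cA = rigid⇒A rigid
    cB : CondB
    cB = rigid⇒B rigid
  trees : CondA × CondB × CondC × CondD × CondE × CondF → CondA × CondB × CondG × CondH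
  trees (cA , cB , cC , cD , cE , cF) = cA , cB , tree-monotone cD cE , hetero-root cC cE cF
  sufficient : CondA × CondB × CondG × CondH → Amenable G
  sufficient (cA , cB , cG , cH) = rigid⇒amenable (tree-conditions⇒rigid cA cB cG cH)
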